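{- (i) For $6\le n\le 9$: $\mathrm{ex}_3(n;\{P,C\}\mid M)=2n-4$. (ii) For $n=10$: $\mathrm{ex}_3(10;\{P,C\}\mid M)=20$. (iii) For $n\ge 11$: $\mathrm{ex}_3(n;\{P,C\}\mid M)=4+\binom{n-4}{2}$ and $\mathrm{Ex}_3(n;\{P,C\}\mid M)=\{\mathrm{Co}(n)\}$.
   Context: All hypergraphs are 3-uniform; containment means containing an isomorphic copy. $P$ is the loose 3-uniform path of length 3: vertices $a,b,c,d,e,f,g$, edges $\{a,b,c\},\{c,d,e\},\{e,f,g\}$. $C$ is the loose triangle: vertices $x_1,x_2,x_3,y_1,y_2,y_3$, edges $\{x_1,y_3,x_2\},\{x_2,y_1,x_3\},\{x_3,y_2,x_1\}$. $M$ is the 3-graph consisting of two disjoint edges. The comet $\mathrm{Co}(n)$ is the $n$-vertex 3-graph with vertex set $\{c,h_1,h_2,h_3\}\cup R$, $|R|=n-4$, whose edges are the four triples of $\{c,h_1,h_2,h_3\}$ together with all triples $\{c,u,v\}$ with $u,v\in R$. Conditional Turán number: $\mathrm{ex}_3(n;\mathcal F\mid\mathcal G)$ is the maximum number of edges of an $n$-vertex 3-graph $H$ that contains no member of $\mathcal F$ and contains some member of $\mathcal G$; $\mathrm{Ex}_3(n;\mathcal F\mid\mathcal G)$ is the family (up to isomorphism) of such $H$ attaining the maximum. -}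

module Defs where

open import Data.Bool.Properties using () renaming (_≟_ to _≟ᵇ_)
open import Data.Fin using (Fin; zero; suc; toℕ; #_)
import Data.Fin.Properties as Fin
open import Data.Fin.Permutation using (Permutation; _⟨$⟩ʳ_)
open import Data.Fin.Subset using (Subset; inside; outside; ⊥; ⁅_⁆; _∪_; _∈_; ∣_∣)
open import Data.Fin.Subset.Properties using (_∈?_)
open import Data.List using (List; []; _∷_; _++_; map; filter; length)
import Data.List.Membership.Propositional as List
open import Data.List.Membership.DecPropositional using () renaming (_∈?_ to ∈-dec)
open import Data.List.Relation.Unary.All as All using (All; []; _∷_)
open import Data.List.Relation.Unary.Any using (Any)
open import Data.Nat using (ℕ; zero; suc; _≤_; _<_; _≟_; _≤?_; _<?_)
open import Data.Product using (Σ; Σ-syntax; ∃-syntax; _×_; _,_; proj₁; proj₂)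
open import Data.Sum using (_⊎_)
open import Data.Vec using ([]; _∷_)
open import Data.Vec.Properties using (≡-dec)
open import Function using (_∘_; _⇔_; Injective)
open import Relation.Binary.Definitions using (DecidableEquality)
open import Relation.Binary.PropositionalEquality using (_≡_; refl)
open import Relation.Nullary using (¬_)
open import Relation.Nullary.Decidable using (_×-dec_; _⊎-dec_; _→-dec_)
open import Relation.Unary using (Decidable)

_≟ˢ_ : ∀ {n} → DecidableEquality (Subset n)
_≟ˢ_ = ≡-dec _≟ᵇ_

triple : ∀ {n} → Fin n → Fin n → Fin n → Subset n
triple x y z = ⁅ x ⁆ ∪ ⁅ y ⁆ ∪ ⁅ z ⁆

image : ∀ {m n} → (Fin m → Fin n) → Subset m → Subset n
image f []            = ⊥
image f (outside ∷ p) = image (f ∘ suc) p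
image f (inside  ∷ p) = ⁅ f zero ⁆ ∪ image (f ∘ suc) p

-- Every subset of Fin n, listed exactly once.
subsets : ∀ n → List (Subset n)
subsets zero    = [] ∷ []
subsets (suc n) = map (outside ∷_) (subsets n) ++ map (inside ∷_) (subsets n)

-- 3-uniform hypergraphs with vertex set Fin n.
record 3-Graph (n : ℕ) : Set₁ where
  field
    Edge    : Subset n → Set
    Edge?   : Decidable Edge
    uniform : ∀ {e} → Edge e → ∣ e ∣ ≡ 3

open 3-Graph public

∥_∥ : ∀ {n} → 3-Graph n → ℕ
∥_∥ {n} H = length (filter (Edge? H) (subsets n))

fromEdges : ∀ {n} (es : List (Subset n)) → All (λ e → ∣ e ∣ ≡ 3) es → 3-Graph n
fromEdges es 3-sets = record
  { Edge    = λ e → e List.∈ es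
  ; Edge?   = λ e → ∈-dec _≟ˢ_ e es
  ; uniform = All.lookup 3-sets
  }

-- H contains a (not necessarily induced) copy of F.
Contains : ∀ {m n} → 3-Graph n → 3-Graph m → Set
Contains {m} {n} H F =
  Σ[ f ∈ (Fin m → Fin n) ]
    Injective _≡_ _≡_ f × (∀ e → Edge F e → Edge H (image f e))

infix 4 _≅_

_≅_ : ∀ {m n} → 3-Graph m → 3-Graph n → Set
_≅_ {m} {n} G H =
  Σ[ π ∈ Permutation m n ] (∀ e → Edge G e ⇔ Edge H (image (π ⟨$⟩ʳ_) e))

Family : Set₁
Family = List (Σ ℕ 3-Graph)

Admissible : ∀ {n} → Family → Family → 3-Graph n → Set₁
Admissible 𝓕 𝓖 H =
  All (λ F → ¬ Contains H (proj₂ F)) 𝓕 × Any (λ G → Contains H (proj₂ G)) 𝓖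

-- ex₃ n 𝓕 𝓖 k says that the maximum defining ex₃(n; 𝓕 ∣ 𝓖) exists and equals k.
ex₃ : ℕ → Family → Family → ℕ → Set₁
ex₃ n 𝓕 𝓖 k =
    (Σ[ H ∈ 3-Graph n ] (Admissible 𝓕 𝓖 H × ∥ H ∥ ≡ k))
  × ((H : 3-Graph n) → Admissible 𝓕 𝓖 H → ∥ H ∥ ≤ k)

Ex₃ : (n : ℕ) → Family → Family → 3-Graph n → Set₁
Ex₃ n 𝓕 𝓖 H = Admissible 𝓕 𝓖 H × ex₃ n 𝓕 𝓖 ∥ H ∥

-- The vertices a , … , g are 0 , … , 6.
P : 3-Graph 7
P = fromEdges
  ( triple (# 0) (# 1) (# 2)
  ∷ triple (# 2) (# 3) (# 4)
  ∷ triple (# 4) (# 5) (# 6)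
  ∷ [])
  (refl ∷ refl ∷ refl ∷ [])

-- The vertices x₁ , x₂ , x₃ are 0 , 1 , 2 and y₁ , y₂ , y₃ are 3 , 4 , 5.
C : 3-Graph 6
C = fromEdges
  ( triple (# 0) (# 5) (# 1)
  ∷ triple (# 1) (# 3) (# 2)
  ∷ triple (# 2) (# 4) (# 0)
  ∷ [])
  (refl ∷ refl ∷ refl ∷ [])

M : 3-Graph 6
M = fromEdges
  ( triple (# 0) (# 1) (# 2)
  ∷ triple (# 3) (# 4) (# 5)
  ∷ [])
  (refl ∷ refl ∷ [])

-- The centre c is vertex 0, the vertices h₁ , h₂ , h₃ are 1 , 2 , 3, and R
-- consists of the vertices from 4 on.  Only n ≥ 4 is meaningful.  In InStar,
-- u ≢ v is forced by ∣ e ∣ ≡ 3.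
Co : ∀ n → 3-Graph n
Co n = record
  { Edge    = λ e → ∣ e ∣ ≡ 3 × (InHead e ⊎ InStar e)
  ; Edge?   = λ e → (∣ e ∣ ≟ 3) ×-dec (inHead? e ⊎-dec inStar? e)
  ; uniform = proj₁
  }
  where
  InHead : Subset n → Set
  InHead e = ∀ x → x ∈ e → toℕ x < 4

  InStar : Subset n → Set
  InStar e = ∃[ c ] ∃[ u ] ∃[ v ]
    (toℕ c ≡ 0 × 4 ≤ toℕ u × 4 ≤ toℕ v × e ≡ triple c u v)

  inHead? : Decidable InHead
  inHead? e = Fin.all? λ x → (x ∈? e) →-dec (toℕ x <? 4)

  inStar? : Decidable InStar
  inStar? e = Fin.any? λ c → Fin.any? λ u → Fin.any? λ v →
    (toℕ c ≟ 0) ×-dec (4 ≤? toℕ u) ×-dec (4 ≤? toℕ v) ×-dec (e ≟ˢ triple c u v)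

{-# OPTIONS --safe #-}
module Submission where

open import Defs
open import Data.Bool using (Bool; true; false; T; _∧_; _∨_; not; if_then_else_)
open import Data.Bool.ListAction using (any; all)
open import Data.Bool.Properties using (T-∧; T-≡; T?)
open import Data.Empty using (⊥-elim) renaming (⊥ to Absurd)
open import Data.Fin using (Fin; zero; suc; toℕ; #_; fromℕ<; remQuot; combine)
open import Data.Fin.Permutation using (permutation; _⟨$⟩ʳ_; _⟨$⟩ˡ_; inverseˡ; inverseʳ)
import Data.Fin.Properties as Fin
open import Data.Fin.Subset using (Subset; inside; outside; ⊥; ⁅_⁆; _∪_; ∣_∣)
  renaming (_∈_ to _∈ˢ_)
open import Data.Fin.Subset.Properties
  using (_∈?_; ∉⊥; ∪-comm; ∪-assoc; ∪-idem; ∪-identityˡ; ∪-identityʳ; ∣⁅x⁆∣≡1;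
         x∈p∪q⁻; x∈p∪q⁺; x∈⁅y⁆⇒x≡y; x∈⁅x⁆)
open import Data.List using (List; []; _∷_; _++_; length; map; filter; take; allFin; tabulate)
open import Data.List.Membership.Propositional using (_∈_)
open import Data.List.Membership.Propositional.Properties
  using (∈-∃++; ∈-allFin; ∈-tabulate⁻; ∈-map⁻)
open import Data.List.Properties
  using (++-assoc; ++-identityʳ; length-++; length-map; length-tabulate; map-tabulate)
open import Data.List.Relation.Binary.Permutation.Propositional
  using (_↭_; prep; swap; ↭-sym; ↭-trans; ↭⇒↭ₛ) renaming (refl to reflₚ; trans to transₚ)
open import Data.List.Relation.Binary.Permutation.Propositional.Properties
  using (↭-length; ++⁺ˡ; ++⁺ʳ; drop-∷; shift; shifts; ∈-resp-↭)
import Data.List.Relation.Binary.Permutation.Setoid.Properties as Permₛ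
open import Data.List.Relation.Unary.All as All using (All; []; _∷_)
import Data.List.Relation.Unary.All.Properties as All
open import Data.List.Relation.Unary.AllPairs as AllPairs using ([]; _∷_)
open import Data.List.Relation.Unary.Any using (Any; here; there)
import Data.List.Relation.Unary.Any.Properties as Any
open import Data.List.Relation.Unary.Unique.Propositional using (Unique)
import Data.List.Relation.Unary.Unique.Propositional.Properties as Unique
open import Data.Maybe using (Maybe; just; nothing)
open import Data.Nat
open import Data.Nat.Combinatorics using (nCk+nC[k+1]≡[n+1]C[k+1]; nC1≡n)
  renaming (_C_ to _choose_)
open import Data.Nat.Properties
open import Data.Nat.Tactic.RingSolver using (solve-∀)
open import Data.Product using (Σ; Σ-syntax; ∃-syntax; _×_; _,_; proj₁; proj₂)
open import Data.Sum using (_⊎_; inj₁; inj₂)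
open import Data.Vec as Vec using (Vec; []; _∷_; toList; lookup; here; there)
open import Function using (_∘_; id; _⇔_; mk⇔; Equivalence; Injective)
open import Relation.Binary.PropositionalEquality
open import Relation.Nullary using (¬_; Dec; yes; no; does; contradiction)
open import Relation.Nullary.Decidable
  using (True; toWitness; dec-true; _×-dec_; _⊎-dec_; _→-dec_)

open Equivalence using (to; from)

-- Say that two edges touch at v if v is their only common vertex.  A graph is
-- {P , C}-free iff whenever an edge {x , y , z} is touched by {x , a , b} at x and by
-- {y , s , t} at y, the pairs {a , b} and {s , t} coincide.
--
-- If that happens for some edge (a "double" {a , b , c}, {a , p , q}, {b , p , q}), all
-- other edges are so restricted by these five vertices that counting them gives the
-- bound, by induction on the vertices outside.  Otherwise every edge is touched at one
-- of its vertices at most.  Suppose then that there are edges {v , a , b}, {v , c , d}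
-- and {x , y , z} on eight vertices (a "hinge").  Any further vertex in an edge through
-- v lies in few edges and can be removed; once there is none, the edges can be counted,
-- and in case of equality {x , y , z} is the only edge avoiding v, which forces the
-- comet.  If there is no hinge, a graph with a matching has at most 2n − 4 edges, and a
-- graph without a matching is a star or has all edges meeting a given one in two points.
--
-- Each assertion about the edges on a bounded number of named vertices is proved by a
-- search, verified once and for all, through the sets of edges compatible with the
-- forbidden patterns.

-- Two obstacles shape the argument. First, deleting vertices can destroy the matching, so the
-- induction runs over all {P , C}-free graphs, with the weaker bound `F`, and the matching enters
-- only in the final classification. Secondly, uniqueness has to come out of counting alone: for n ≥
-- 11 every case other than the hinge must lose at least one edge against the comet, which is why
-- `G` lies one below the comet there, and the hinge bound is proved together with its equality
-- clause. All counts have one shape. A core of named vertices is moved to the front of the vertex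
-- list, and edges are sorted by how many of their vertices lie outside the core. How many edges
-- one, two or three given outside vertices can have is a question about at most twelve vertices, so
-- the search answers it; summing the answers over the outside vertices yields a bound in n. For
-- this reason vertex sets are lists without repetition, used up to permutation, and an edge set is
-- a symmetric Boolean function.

tri : ℕ → ℕ
tri zero    = 0
tri (suc n) = n + tri n

-- Sums over the entries, pairs and triples of a list.

module _ {V : Set} where

  Σ₁ : (V → ℕ) → List V → ℕ
  Σ₁ f []       = 0
  Σ₁ f (x ∷ xs) = f x + Σ₁ f xs

  Σ₂ : (V → V → ℕ) → List V → ℕ
  Σ₂ f []       = 0
  Σ₂ f (x ∷ xs) = Σ₁ (f x) xs + Σ₂ f xs

  Σ₃ : (V → V → V → ℕ) → List V → ℕ
  Σ₃ f []       = 0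
  Σ₃ f (x ∷ xs) = Σ₂ (f x) xs + Σ₃ f xs

  Σ₁-cong : ∀ {f g} → (∀ x → f x ≡ g x) → ∀ xs → Σ₁ f xs ≡ Σ₁ g xs
  Σ₁-cong f≡g []       = refl
  Σ₁-cong f≡g (x ∷ xs) = cong₂ _+_ (f≡g x) (Σ₁-cong f≡g xs)

  Σ₂-cong : ∀ {f g} → (∀ x y → f x y ≡ g x y) → ∀ xs → Σ₂ f xs ≡ Σ₂ g xs
  Σ₂-cong f≡g []       = refl
  Σ₂-cong f≡g (x ∷ xs) = cong₂ _+_ (Σ₁-cong (f≡g x) xs) (Σ₂-cong f≡g xs)

  Σ₁-+ : ∀ f g xs → Σ₁ (λ x → f x + g x) xs ≡ Σ₁ f xs + Σ₁ g xs
  Σ₁-+ f g []       = refl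
  Σ₁-+ f g (x ∷ xs) = begin
    f x + g x + Σ₁ (λ x → f x + g x) xs  ≡⟨ cong (f x + g x +_) (Σ₁-+ f g xs) ⟩
    f x + g x + (Σ₁ f xs + Σ₁ g xs)      ≡⟨ shuffle (f x) (g x) _ _ ⟩
    f x + Σ₁ f xs + (g x + Σ₁ g xs)      ∎
    where
    open ≡-Reasoning
    shuffle : ∀ a b c d → a + b + (c + d) ≡ a + c + (b + d)
    shuffle = solve-∀

  Σ₁-++ : ∀ f xs ys → Σ₁ f (xs ++ ys) ≡ Σ₁ f xs + Σ₁ f ys
  Σ₁-++ f []       ys = refl
  Σ₁-++ f (x ∷ xs) ys =
    trans (cong (f x +_) (Σ₁-++ f xs ys)) (sym (+-assoc (f x) _ _))

  Σ₁-const0 : ∀ xs → Σ₁ (λ _ → 0) xs ≡ 0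
  Σ₁-const0 []       = refl
  Σ₁-const0 (x ∷ xs) = Σ₁-const0 xs

  Symmetric₂ : (V → V → ℕ) → Set
  Symmetric₂ f = ∀ x y → f x y ≡ f y x

  record Symmetric₃ (f : V → V → V → ℕ) : Set where
    field
      swapˡ : ∀ x y z → f x y z ≡ f y x z
      swapʳ : ∀ x → Symmetric₂ (f x)

  open Symmetric₃ public

  Σ₂-++ : ∀ {f} → Symmetric₂ f → ∀ xs ys →
    Σ₂ f (xs ++ ys) ≡ Σ₂ f xs + Σ₁ (λ y → Σ₁ (f y) xs) ys + Σ₂ f ys
  Σ₂-++ {f} s []       ys = cong (_+ Σ₂ f ys) (sym (Σ₁-const0 ys))
  Σ₂-++ {f} s (x ∷ xs) ys = begin
    Σ₁ (f x) (xs ++ ys) + Σ₂ f (xs ++ ys)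
      ≡⟨ cong₂ _+_ (Σ₁-++ (f x) xs ys) (Σ₂-++ s xs ys) ⟩
    Σ₁ (f x) xs + Σ₁ (f x) ys + (Σ₂ f xs + Σ₁ (λ y → Σ₁ (f y) xs) ys + Σ₂ f ys)
      ≡⟨ shuffle (Σ₁ (f x) xs) _ _ _ _ ⟩
    Σ₁ (f x) xs + Σ₂ f xs + (Σ₁ (f x) ys + Σ₁ (λ y → Σ₁ (f y) xs) ys) + Σ₂ f ys
      ≡⟨ cong (λ k → Σ₁ (f x) xs + Σ₂ f xs + (k + Σ₁ (λ y → Σ₁ (f y) xs) ys) + Σ₂ f ys)
           (Σ₁-cong (s x) ys) ⟩
    Σ₁ (f x) xs + Σ₂ f xs + (Σ₁ (λ y → f y x) ys + Σ₁ (λ y → Σ₁ (f y) xs) ys) + Σ₂ f ys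
      ≡⟨ cong (λ k → Σ₁ (f x) xs + Σ₂ f xs + k + Σ₂ f ys)
           (sym (Σ₁-+ (λ y → f y x) (λ y → Σ₁ (f y) xs) ys)) ⟩
    Σ₁ (f x) xs + Σ₂ f xs + Σ₁ (λ y → f y x + Σ₁ (f y) xs) ys + Σ₂ f ys ∎
    where
    open ≡-Reasoning
    shuffle : ∀ a b c d e → a + b + (c + d + e) ≡ a + c + (b + d) + e
    shuffle = solve-∀

  -- The four summands collect the triples with three, two, one and no entries in `xs`. Symmetry
  -- enters because a triple with two entries in `xs` is met with these first on the left, but with
  -- its entry from `ys` first on the right.
  Σ₃-++ : ∀ {f} → Symmetric₃ f → ∀ xs ys →
    Σ₃ f (xs ++ ys) ≡
    Σ₃ f xs + Σ₁ (λ y → Σ₂ (f y) xs) ys + Σ₁ (λ x → Σ₂ (f x) ys) xs + Σ₃ f ys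
  Σ₃-++ {f} s []       ys =
    cong (_+ Σ₃ f ys) (sym (trans (+-identityʳ _) (Σ₁-const0 ys)))
  Σ₃-++ {f} s (x ∷ xs) ys = begin
    Σ₂ (f x) (xs ++ ys) + Σ₃ f (xs ++ ys)
      ≡⟨ cong₂ _+_ (Σ₂-++ (swapʳ s x) xs ys) (Σ₃-++ s xs ys) ⟩
    Σ₂ (f x) xs + Σ₁ (λ y → Σ₁ (f x y) xs) ys + Σ₂ (f x) ys
      + (Σ₃ f xs + Σ₁ (λ y → Σ₂ (f y) xs) ys + Σ₁ (λ x → Σ₂ (f x) ys) xs + Σ₃ f ys)
      ≡⟨ cong (λ k → Σ₂ (f x) xs + k + Σ₂ (f x) ys
      + (Σ₃ f xs + Σ₁ (λ y → Σ₂ (f y) xs) ys + Σ₁ (λ x → Σ₂ (f x) ys) xs + Σ₃ f ys))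
           (Σ₁-cong (λ y → Σ₁-cong (swapˡ s x y) xs) ys) ⟩
    Σ₂ (f x) xs + Σ₁ (λ y → Σ₁ (f y x) xs) ys + Σ₂ (f x) ys
      + (Σ₃ f xs + Σ₁ (λ y → Σ₂ (f y) xs) ys + Σ₁ (λ x → Σ₂ (f x) ys) xs + Σ₃ f ys)
      ≡⟨ shuffle (Σ₂ (f x) xs) _ _ _ _ _ _ ⟩
    Σ₂ (f x) xs + Σ₃ f xs
      + (Σ₁ (λ y → Σ₁ (f y x) xs) ys + Σ₁ (λ y → Σ₂ (f y) xs) ys)
      + (Σ₂ (f x) ys + Σ₁ (λ x → Σ₂ (f x) ys) xs) + Σ₃ f ys
      ≡⟨ cong (λ k → Σ₂ (f x) xs + Σ₃ f xs + k
                     + (Σ₂ (f x) ys + Σ₁ (λ x → Σ₂ (f x) ys) xs) + Σ₃ f ys)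
           (sym (Σ₁-+ (λ y → Σ₁ (f y x) xs) (λ y → Σ₂ (f y) xs) ys)) ⟩
    Σ₂ (f x) xs + Σ₃ f xs
      + Σ₁ (λ y → Σ₁ (f y x) xs + Σ₂ (f y) xs) ys
      + (Σ₂ (f x) ys + Σ₁ (λ x → Σ₂ (f x) ys) xs) + Σ₃ f ys ∎
    where
    open ≡-Reasoning
    shuffle : ∀ a b c d e g h →
      a + b + c + (d + e + g + h) ≡ a + d + (b + e) + (c + g) + h
    shuffle = solve-∀

  Σ₁-↭ : ∀ f {xs ys} → xs ↭ ys → Σ₁ f xs ≡ Σ₁ f ys
  Σ₁-↭ f reflₚ        = refl
  Σ₁-↭ f (prep x p)   = cong (f x +_) (Σ₁-↭ f p)
  Σ₁-↭ f (swap x y p) =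
    trans (cong (λ k → f x + (f y + k)) (Σ₁-↭ f p)) (lemma (f x) (f y) _)
    where
    lemma : ∀ a b c → a + (b + c) ≡ b + (a + c)
    lemma = solve-∀
  Σ₁-↭ f (transₚ p q) = trans (Σ₁-↭ f p) (Σ₁-↭ f q)

  Σ₂-↭ : ∀ {f} → Symmetric₂ f → ∀ {xs ys} → xs ↭ ys → Σ₂ f xs ≡ Σ₂ f ys
  Σ₂-↭     s reflₚ        = refl
  Σ₂-↭ {f} s (prep x p)   = cong₂ _+_ (Σ₁-↭ (f x) p) (Σ₂-↭ s p)
  Σ₂-↭ {f} s (swap {xs} {ys} x y p)
    rewrite s x y | Σ₁-↭ (f x) p | Σ₁-↭ (f y) p | Σ₂-↭ s p =
    lemma (f y x) (Σ₁ (f x) ys) (Σ₁ (f y) ys) (Σ₂ f ys)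
    where
    lemma : ∀ a b c d → a + b + (c + d) ≡ a + c + (b + d)
    lemma = solve-∀
  Σ₂-↭     s (transₚ p q) = trans (Σ₂-↭ s p) (Σ₂-↭ s q)

  Σ₃-↭ : ∀ {f} → Symmetric₃ f → ∀ {xs ys} → xs ↭ ys → Σ₃ f xs ≡ Σ₃ f ys
  Σ₃-↭     s reflₚ        = refl
  Σ₃-↭ {f} s (prep x p)   = cong₂ _+_ (Σ₂-↭ (swapʳ s x) p) (Σ₃-↭ s p)
  Σ₃-↭ {f} s (swap {xs} {ys} x y p)
    rewrite Σ₁-↭ (f x y) p | Σ₂-↭ (swapʳ s x) p | Σ₂-↭ (swapʳ s y) p | Σ₃-↭ s p
          | Σ₁-cong (swapˡ s x y) ys =
    lemma (Σ₁ (f y x) ys) (Σ₂ (f x) ys) (Σ₂ (f y) ys) (Σ₃ f ys)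
    where
    lemma : ∀ a b c d → a + b + (c + d) ≡ a + c + (b + d)
    lemma = solve-∀
  Σ₃-↭     s (transₚ p q) = trans (Σ₃-↭ s p) (Σ₃-↭ s q)

  -- The bounds below only ask for information on distinct positions of the
  -- list: xs ↭ t ∷ u ∷ r says that t and u are entries at two such positions.

  pick-tail : ∀ {x t : V} {xs r} → xs ↭ t ∷ r → x ∷ xs ↭ t ∷ x ∷ r
  pick-tail {x} {t} p = ↭-trans (prep x p) (swap x t reflₚ)

  pick-tail₂ : ∀ {x t u : V} {xs r} → xs ↭ t ∷ u ∷ r → x ∷ xs ↭ t ∷ u ∷ x ∷ r
  pick-tail₂ {x} {t} {u} p = ↭-trans (pick-tail p) (prep t (swap x u reflₚ))

  pick-tail₃ : ∀ {x t u w : V} {xs r} →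
    xs ↭ t ∷ u ∷ w ∷ r → x ∷ xs ↭ t ∷ u ∷ w ∷ x ∷ r
  pick-tail₃ {x} {t} {u} {w} p =
    ↭-trans (pick-tail₂ p) (prep t (prep u (swap x w reflₚ)))

  Σ₁-mono : ∀ {f g} xs → (∀ t r → xs ↭ t ∷ r → f t ≤ g t) → Σ₁ f xs ≤ Σ₁ g xs
  Σ₁-mono []       f≤g = z≤n
  Σ₁-mono (x ∷ xs) f≤g =
    +-mono-≤ (f≤g x xs reflₚ) (Σ₁-mono xs λ t r p → f≤g t _ (pick-tail p))

  Σ₂-mono : ∀ {f g} xs → (∀ t u r → xs ↭ t ∷ u ∷ r → f t u ≤ g t u) →
    Σ₂ f xs ≤ Σ₂ g xs
  Σ₂-mono []       f≤g = z≤n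
  Σ₂-mono (x ∷ xs) f≤g =
    +-mono-≤ (Σ₁-mono xs λ t r p → f≤g x t r (prep x p))
             (Σ₂-mono xs λ t u r p → f≤g t u _ (pick-tail₂ p))

  Σ₃-mono : ∀ {f g} xs → (∀ t u w r → xs ↭ t ∷ u ∷ w ∷ r → f t u w ≤ g t u w) →
    Σ₃ f xs ≤ Σ₃ g xs
  Σ₃-mono []       f≤g = z≤n
  Σ₃-mono (x ∷ xs) f≤g =
    +-mono-≤ (Σ₂-mono xs λ t u r p → f≤g x t u r (prep x p))
             (Σ₃-mono xs λ t u w r p → f≤g t u w _ (pick-tail₃ p))

  Σ₁-const : ∀ k xs → Σ₁ (λ _ → k) xs ≡ length xs * k
  Σ₁-const k []       = refl
  Σ₁-const k (x ∷ xs) = cong (k +_) (Σ₁-const k xs)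

  Σ₁-1 : ∀ xs → Σ₁ (λ _ → 1) xs ≡ length xs
  Σ₁-1 xs = trans (Σ₁-const 1 xs) (*-identityʳ _)

  Σ₂-1 : ∀ xs → Σ₂ (λ _ _ → 1) xs ≡ tri (length xs)
  Σ₂-1 []       = refl
  Σ₂-1 (x ∷ xs) = cong₂ _+_ (Σ₁-1 xs) (Σ₂-1 xs)

  Σ₁-≤ : ∀ {f} k xs → (∀ t r → xs ↭ t ∷ r → f t ≤ k) → Σ₁ f xs ≤ length xs * k
  Σ₁-≤ {f} k xs f≤k = subst (Σ₁ f xs ≤_) (Σ₁-const k xs) (Σ₁-mono xs f≤k)

  Σ₁-≤1 : ∀ {f} xs → (∀ t r → xs ↭ t ∷ r → f t ≤ 1) → Σ₁ f xs ≤ length xs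
  Σ₁-≤1 {f} xs f≤1 = subst (Σ₁ f xs ≤_) (Σ₁-1 xs) (Σ₁-mono xs f≤1)

  Σ₁-0 : ∀ {f} xs → (∀ t r → xs ↭ t ∷ r → f t ≤ 0) → Σ₁ f xs ≤ 0
  Σ₁-0 {f} xs f≤0 = subst (Σ₁ f xs ≤_) (Σ₁-const0 xs) (Σ₁-mono xs f≤0)

  Σ₂-≤tri : ∀ {f} xs → (∀ x y → f x y ≤ 1) → Σ₂ f xs ≤ tri (length xs)
  Σ₂-≤tri {f} xs f≤1 = subst (Σ₂ f xs ≤_) (Σ₂-1 xs) (Σ₂-mono xs λ t u _ _ → f≤1 t u)

  Σ₂-0 : ∀ {f} xs → (∀ t u r → xs ↭ t ∷ u ∷ r → f t u ≤ 0) → Σ₂ f xs ≤ 0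
  Σ₂-0 []       f≤0 = z≤n
  Σ₂-0 (x ∷ xs) f≤0 =
    +-mono-≤ (Σ₁-0 xs λ t r p → f≤0 x t r (prep x p))
             (Σ₂-0 xs λ t u r p → f≤0 t u _ (pick-tail₂ p))

  Σ₃-0 : ∀ {f} xs → (∀ t u w r → xs ↭ t ∷ u ∷ w ∷ r → f t u w ≤ 0) → Σ₃ f xs ≤ 0
  Σ₃-0 []       f≤0 = z≤n
  Σ₃-0 (x ∷ xs) f≤0 =
    +-mono-≤ (Σ₂-0 xs λ t u r p → f≤0 x t u r (prep x p))
             (Σ₃-0 xs λ t u w r p → f≤0 t u w _ (pick-tail₃ p))

  private
    cancel-≤ : ∀ {a b c d} → c ≤ d → b + d ≤ a + c → b ≤ a
    cancel-≤ {a} {b} {c} {d} c≤d b+d≤a+c =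
      +-cancelʳ-≤ d b a (≤-trans b+d≤a+c (+-monoʳ-≤ a c≤d))

  -- With `t` and `u` moved to the front, all other pairs satisfy `f ≤ g` and cancel from the
  -- reversed inequality of the totals. This turns an extremal edge count back into the presence of
  -- individual edges.
  Σ₂-squeeze : ∀ {f g} → Symmetric₂ f → Symmetric₂ g → ∀ xs →
    (∀ t u r → xs ↭ t ∷ u ∷ r → f t u ≤ g t u) → Σ₂ g xs ≤ Σ₂ f xs →
    ∀ t u r → xs ↭ t ∷ u ∷ r → g t u ≤ f t u
  Σ₂-squeeze {f} {g} sf sg xs f≤g Σg≤Σf t u r p = cancel-≤ others total
    where
    rest : (V → V → ℕ) → ℕ
    rest k = Σ₁ (k t) r + (Σ₁ (k u) r + Σ₂ k r)

    others : rest f ≤ rest g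
    others = +-mono-≤
      (Σ₁-mono r λ w s q → f≤g t w (u ∷ s)
        (↭-trans p (prep t (pick-tail q))))
      (Σ₂-mono (u ∷ r) λ w w′ s q → f≤g w w′ (t ∷ s)
        (↭-trans p (pick-tail₂ q)))

    total : g t u + rest g ≤ f t u + rest f
    total = subst₂ _≤_
      (trans (Σ₂-↭ sg p) (+-assoc (g t u) _ _))
      (trans (Σ₂-↭ sf p) (+-assoc (f t u) _ _)) Σg≤Σf

  -- The triples avoiding `t` cancel; those containing `t` form a sum over pairs, to which
  -- `Σ₂-squeeze` applies.
  Σ₃-squeeze : ∀ {f g} → Symmetric₃ f → Symmetric₃ g → ∀ xs →
    (∀ t u w r → xs ↭ t ∷ u ∷ w ∷ r → f t u w ≤ g t u w) → Σ₃ g xs ≤ Σ₃ f xs →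
    ∀ t u w r → xs ↭ t ∷ u ∷ w ∷ r → g t u w ≤ f t u w
  Σ₃-squeeze {f} {g} sf sg xs f≤g Σg≤Σf t u w r p =
    Σ₂-squeeze (swapʳ sf t) (swapʳ sg t) (u ∷ w ∷ r)
      (λ a b s q → f≤g t a b s (↭-trans p (prep t q)))
      (cancel-≤
        (Σ₃-mono (u ∷ w ∷ r) λ a b c s q → f≤g a b c (t ∷ s) (↭-trans p (pick-tail₃ q)))
        (subst₂ _≤_ (Σ₃-↭ sg p) (Σ₃-↭ sf p) Σg≤Σf))
      u w r reflₚ

-- Patterns on distinct entries of a list, and their decidability.

module _ {V : Set} where

  Unique-↭ : {xs ys : List V} → xs ↭ ys → Unique xs → Unique ys
  Unique-↭ p = Permₛ.Unique-resp-↭ (setoid V) (↭⇒↭ₛ p)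

  ∈⇒↭ : ∀ {x} {xs : List V} → x ∈ xs → Σ[ r ∈ List V ] xs ↭ x ∷ r
  ∈⇒↭ x∈xs with ys , zs , refl ← ∈-∃++ x∈xs = ys ++ zs , shift _ ys zs

  Fun : ℕ → Set
  Fun zero    = Bool
  Fun (suc k) = V → Fun k

  app : ∀ {k} → Fun k → Vec V k → Bool
  app b []       = b
  app f (x ∷ xs) = app (f x) xs

  -- Vertices are drawn from the list one after the other, each from the remainder of the previous
  -- draw. Distinctness is thus one of positions and needs no inequations, and stability under
  -- permuting or enlarging the list is immediate.
  Pick : ∀ k → Fun k → List V → Set
  Pick zero    b xs = T b
  Pick (suc k) f xs = Σ[ x ∈ V ] Σ[ r ∈ List V ] (xs ↭ x ∷ r × Pick k (f x) r)

  Pick-↭ : ∀ k {f xs ys} → xs ↭ ys → Pick k f xs → Pick k f ys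
  Pick-↭ zero    p b               = b
  Pick-↭ (suc k) p (x , r , q , b) = x , r , ↭-trans (↭-sym p) q , b

  Pick-∷ : ∀ k {f x xs} → Pick k f xs → Pick k f (x ∷ xs)
  Pick-∷ zero    b               = b
  Pick-∷ (suc k) (y , r , p , b) = y , _ , pick-tail p , Pick-∷ k b

  private
    -- It is enough to try each position with one remainder: any other remainder for the same entry
    -- is a permutation of it, and `P` respects permutations. This also covers an entry that occurs
    -- repeatedly.
    select? : {P : V → List V → Set} → (∀ x r → Dec (P x r)) →
      (∀ {x r s} → r ↭ s → P x r → P x s) →
      ∀ xs → Dec (Σ[ x ∈ V ] Σ[ r ∈ List V ] (xs ↭ x ∷ r × P x r))
    select? P? resp [] = no λ (x , r , p , _) → 0≢1+n (↭-length p)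
    select? {P} P? resp (x ∷ xs) with P? x xs
    ... | yes Px = yes (x , xs , reflₚ , Px)
    ... | no ¬Px with select? (λ y r → P? y (x ∷ r)) (resp ∘ prep x) xs
    ...   | yes (y , r , p , Py) = yes (y , x ∷ r , pick-tail p , Py)
    ...   | no ¬Py = no none
      where
      none : ¬ (Σ[ y ∈ V ] Σ[ r ∈ List V ] (x ∷ xs ↭ y ∷ r × P y r))
      none (y , r , p , Py) with ∈-resp-↭ (↭-sym p) (here refl)
      ... | here refl = ¬Px (resp (↭-sym (drop-∷ p)) Py)
      ... | there y∈xs with s , q ← ∈⇒↭ y∈xs =
        ¬Py (y , s , q , resp (drop-∷ (↭-trans (↭-sym p) (pick-tail q))) Py)

  pick? : ∀ k f xs → Dec (Pick k f xs)
  pick? zero    b xs = T? b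
  pick? (suc k) f xs = select? (λ x r → pick? k (f x) r) (Pick-↭ k) xs

  cover : ∀ (ys : List V) {xs} → Unique ys → All (_∈ xs) ys → Σ[ r ∈ List V ] xs ↭ ys ++ r
  cover []       u          m          = _ , reflₚ
  cover (y ∷ ys) (y∉ys ∷ u) (y∈xs ∷ m) with r , p ← ∈⇒↭ y∈xs =
    let s , q = cover ys u (All.zipWith strengthen (y∉ys , m)) in s , ↭-trans p (prep y q)
    where
    strengthen : ∀ {z} → ¬ (y ≡ z) × z ∈ _ → z ∈ r
    strengthen (y≢z , z∈xs) with ∈-resp-↭ p z∈xs
    ... | here z≡y  = contradiction (sym z≡y) y≢z
    ... | there z∈r = z∈r

  pick : ∀ {k f xs} (ys : Vec V k) → Unique (toList ys) → All (_∈ xs) (toList ys) →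
    T (app f ys) → Pick k f xs
  pick {k} ys u m b with r , p ← cover (toList ys) u m = Pick-↭ k (↭-sym p) (front ys b)
    where
    front : ∀ {k f} (ys : Vec V k) → T (app f ys) → Pick k f (toList ys ++ r)
    front []       b = b
    front (y ∷ ys) b = y , _ , reflₚ , front ys b

  unpick : ∀ k {f xs} → Pick k f xs →
    Σ[ ys ∈ Vec V k ] Σ[ r ∈ List V ] (xs ↭ toList ys ++ r × T (app f ys))
  unpick zero    b               = [] , _ , reflₚ , b
  unpick (suc k) (x , r , p , b) with ys , s , q , c ← unpick k b =
    x ∷ ys , s , ↭-trans p (prep x q) , c

-- Local search.  A triple (i , j , k) stands for the i-th, j-th and k-th entry of a
-- list of distinct vertices.
Tri : Set
Tri = ℕ × ℕ × ℕ

-- A canonical order of the indices, so that a candidate and an excluded triple can be compared by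
-- `==`.
sorted : ℕ → ℕ → ℕ → Tri
sorted i j k =
  if i <ᵇ j
  then (if j <ᵇ k then (i , j , k) else if i <ᵇ k then (i , k , j) else (k , i , j))
  else (if i <ᵇ k then (j , i , k) else if j <ᵇ k then (j , k , i) else (k , j , i))

-- Codes for the sums to be bounded, shaped so that their interpretation unfolds to the sums in the
-- counting lemmas; `c∅` matches the final zero of `meet`, `meet₁` and `meet₂`.
data Sum : Set where
  c₃  : List ℕ → Sum
  c₂  : ℕ → List ℕ → Sum
  c₁  : ℕ → ℕ → List ℕ → Sum
  c₀  : ℕ → ℕ → ℕ → Sum
  c∅  : Sum
  _⊕_ : Sum → Sum → Sum

infixr 6 _⊕_

triples₁ : ℕ → ℕ → List ℕ → List Tri
triples₁ i j []       = []
triples₁ i j (k ∷ ks) = sorted i j k ∷ triples₁ i j ks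

triples₂ : ℕ → List ℕ → List Tri
triples₂ i []       = []
triples₂ i (j ∷ js) = triples₁ i j js ++ triples₂ i js

triples₃ : List ℕ → List Tri
triples₃ []       = []
triples₃ (i ∷ is) = triples₂ i is ++ triples₃ is

triples : Sum → List Tri
triples (c₃ is)     = triples₃ is
triples (c₂ i js)   = triples₂ i js
triples (c₁ i j ks) = triples₁ i j ks
triples (c₀ i j k)  = sorted i j k ∷ []
triples c∅          = []
triples (s ⊕ t)     = triples s ++ triples t

split : ℕ → Tri → Maybe (ℕ × ℕ)
split x (i , j , k) =
  if x ≡ᵇ i then just (j , k) else
  if x ≡ᵇ j then just (i , k) else
  if x ≡ᵇ k then just (i , j) else nothing

_==_ : Tri → Tri → Bool
(i , j , k) == (i′ , j′ , k′) = (i ≡ᵇ i′) ∧ (j ≡ᵇ j′) ∧ (k ≡ᵇ k′)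

fresh : ℕ → List ℕ → Bool
fresh i []       = true
fresh i (j ∷ js) = not (i ≡ᵇ j) ∧ fresh i js

-- Which forbidden patterns, besides the path and the triangle, the search may use.
record Mode : Set where
  constructor mode
  field
    double matching hinge : Bool

open Mode public

module Search (μ : Mode) (n : ℕ) where

  distinct : List ℕ → Bool
  distinct []       = true
  distinct (i ∷ is) = (i <ᵇ n) ∧ fresh i is ∧ distinct is

  -- The edges xyz, xsb and yst then form a loose triangle with corners x, y and s.
  closes : ℕ → ℕ → ℕ → ℕ → ℕ → ℕ → Bool
  closes x y z s b t = distinct (x ∷ y ∷ s ∷ t ∷ b ∷ z ∷ [])

  -- The edge xyz is touched by xab at x and by yst at y. If the pairs ab and st are disjoint, the
  -- three edges form a path with xyz in the middle; if they share one vertex, a triangle; if they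
  -- coincide, a double.
  clash : ℕ → ℕ → ℕ → ℕ × ℕ → ℕ × ℕ → Bool
  clash x y z (a , b) (s , t) =
      distinct (a ∷ b ∷ x ∷ z ∷ y ∷ s ∷ t ∷ [])
    ∨ ((a ≡ᵇ s) ∧ closes x y z a b t)
    ∨ ((a ≡ᵇ t) ∧ closes x y z a b s)
    ∨ ((b ≡ᵇ s) ∧ closes x y z b a t)
    ∨ ((b ≡ᵇ t) ∧ closes x y z b a s)
    -- Equal pairs appear in the same order, since `split` keeps the increasing order of a sorted
    -- triple.
    ∨ (double μ ∧ (a ≡ᵇ s) ∧ (b ≡ᵇ t) ∧ distinct (x ∷ y ∷ z ∷ a ∷ b ∷ []))

  both : (ℕ × ℕ → ℕ × ℕ → Bool) → Maybe (ℕ × ℕ) → Maybe (ℕ × ℕ) → Bool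
  both p (just ab) (just st) = p ab st
  both p (just ab) nothing   = false
  both p nothing   _         = false

  orders : Tri → List Tri
  orders (i , j , k) =
    (i , j , k) ∷ (i , k , j) ∷ (j , i , k) ∷ (j , k , i) ∷ (k , i , j) ∷ (k , j , i) ∷ []

  centreAt : Tri → Tri → Tri → Bool
  centreAt f g (x , y , z) = both (clash x y z) (split x f) (split y g)

  centre : Tri → Tri → Tri → Bool
  centre e f g = any (centreAt f g) (orders e)

  apart : Tri → Tri → Bool
  apart (i , j , k) (i′ , j′ , k′) = distinct (i ∷ j ∷ k ∷ i′ ∷ j′ ∷ k′ ∷ [])

  hingeAt : Tri → Tri → Tri → Bool
  hingeAt (i , j , k) g (x , y , z) =
    both (λ (a , b) (c , d) → distinct (x ∷ a ∷ b ∷ c ∷ d ∷ i ∷ j ∷ k ∷ []))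
         (just (y , z)) (split x g)

  hinged : Tri → Tri → Tri → Bool
  hinged e f g = any (hingeAt e g) (orders f)

  bad : Tri → Tri → Tri → Bool
  bad e f g =
      centre e f g ∨ centre f e g ∨ centre g e f
    ∨ (matching μ ∧ (apart e f ∨ apart e g ∨ apart f g))
    ∨ (hinge μ ∧ (hinged e f g ∨ hinged f e g ∨ hinged g e f))

  conflict : List Tri → Tri → Bool
  conflict es t = any (λ e → any (bad t e) es) es

  -- Only conflicts with the newly added `t` are tested; those among earlier edges were removed when
  -- these were added. As `t` itself belongs to the list tested, conflicts between just two edges,
  -- such as a matching, are found as well.
  survives : List Tri → Tri → Tri → Bool
  survives es t r = not (any (bad r t) es)

  keep : {A : Set} → (A → Bool) → List A → List A
  keep p []       = []
  keep p (x ∷ xs) = if p x then x ∷ keep p xs else keep p xs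

  mutual
    -- Branch and bound: `es` are the edges known to be present, `cs` the candidates still undecided
    -- and `acc` the number of candidates already taken. A branch closes once taking all remaining
    -- candidates would stay within `K`. Every branching consumes a candidate, so `length cs` is
    -- enough fuel.
    search : ℕ → List Tri → List Tri → ℕ → ℕ → Bool
    search m es cs acc K = (acc + length cs ≤ᵇ K) ∨ branch m es cs acc K

    branch : ℕ → List Tri → List Tri → ℕ → ℕ → Bool
    branch zero    es cs       acc K = false
    branch (suc m) es []       acc K = false
    branch (suc m) es (t ∷ cs) acc K =
      search m es cs acc K ∧
      (conflict es t ∨ search m (t ∷ es) (keep (survives (t ∷ es) t) cs) (suc acc) K)

  assume : Tri → (List Tri → List Tri → Bool) → List Tri → List Tri → Bool
  assume f k es cs = conflict es f ∨ k (f ∷ es) (keep (survives (f ∷ es) f) cs)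

  -- A sum known to be positive contains some edge, but not a known one; the search has to succeed
  -- for each choice.
  run : List Tri → List Sum → ℕ → List Tri → List Tri → Bool
  run (f ∷ fs) as       K es cs = assume f (run fs as K) es cs
  run []       (a ∷ as) K es cs = all (λ f → assume f (run [] as K) es cs) (triples a)
  run []       []       K es cs = search (length cs) es cs 0 K

  check : List Tri → List Sum → List Sum → Sum → ℕ → Bool
  check facts nots alts c K =
    run facts alts K []
      (keep (λ r → not (any (λ a → any (r ==_) (triples a)) nots)) (triples c))

bit : Bool → ℕ
bit false = 0
bit true  = 1

bit≤1 : ∀ b → bit b ≤ 1
bit≤1 false = z≤n
bit≤1 true  = s≤s z≤n

bit⁺ : ∀ {b} → T b → 1 ≤ bit b
bit⁺ {true} _ = s≤s z≤n

bit⁻ : ∀ {b} → ¬ T b → bit b ≤ 0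
bit⁻ {false} _  = z≤n
bit⁻ {true}  ¬b = contradiction _ ¬b

bit-T : ∀ {b} → 1 ≤ bit b → T b
bit-T {true} _ = _

bit-≤ : ∀ {b} → bit b ≤ 0 → ¬ T b
bit-≤ {false} _ ()

∨-elim : ∀ {a b} {A : Set} → T (a ∨ b) → (T a → A) → (T b → A) → A
∨-elim {true}  t f g = f _
∨-elim {false} t f g = g t

module _ {V : Set} where

  -- Being total, it reduces on a list with a known prefix and a numeral index, so that sums over
  -- indices unfold to sums over named vertices. The indices accepted by `distinct` never reach the
  -- default.
  nth : V → List V → ℕ → V
  nth d []       _       = d
  nth d (x ∷ xs) zero    = x
  nth d (x ∷ xs) (suc i) = nth d xs i

  nth-∈ : ∀ d xs {i} → i < length xs → nth d xs i ∈ xs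
  nth-∈ d (x ∷ xs) {zero}  i< = here refl
  nth-∈ d (x ∷ xs) {suc i} i< = there (nth-∈ d xs (s≤s⁻¹ i<))

  nth-injective : ∀ d {xs} → Unique xs → ∀ {i j} → i < length xs → j < length xs →
    nth d xs i ≡ nth d xs j → i ≡ j
  nth-injective d (x∉ ∷ u) {zero}  {zero}  i< j< eq = refl
  nth-injective d {x ∷ xs} (x∉ ∷ u) {zero}  {suc j} i< j< eq =
    contradiction eq (All.lookup x∉ (nth-∈ d xs (s≤s⁻¹ j<)))
  nth-injective d {x ∷ xs} (x∉ ∷ u) {suc i} {zero}  i< j< eq =
    contradiction (sym eq) (All.lookup x∉ (nth-∈ d xs (s≤s⁻¹ i<)))
  nth-injective d (x∉ ∷ u) {suc i} {suc j} i< j< eq =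
    cong suc (nth-injective d u (s≤s⁻¹ i<) (s≤s⁻¹ j<) eq)

-- The bound for all {P , C}-free graphs; below 6 it is the number of all triples.
F : ℕ → ℕ
F 0 = 0
F 1 = 0
F 2 = 0
F 3 = 1
F 4 = 4
F 5 = 10
F (suc n@(suc (suc (suc (suc (suc _)))))) = tri n

-- For n ≥ 7 the maximum over graphs with a matching, lowered by one from n = 11 on,
-- where only the comet attains it.  At n = 6 the value 10 allows for K₅.
G : ℕ → ℕ
G 8  = 12
G 9  = 14
G 10 = 20
G (suc (suc (suc (suc n@(suc (suc (suc (suc (suc (suc (suc _))))))))))) = 3 + tri n
G _  = 10

-- Arithmetic closing the individual cases.

slack : ∀ {a b} s → b ≡ a + s → a ≤ b
slack {a} s eq = subst (a ≤_) (sym eq) (m≤m+n a s)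

tri-+ : ∀ m n → tri (m + n) ≡ tri m + tri n + m * n
tri-+ zero    n = sym (+-identityʳ _)
tri-+ (suc m) n = trans (cong (m + n +_) (tri-+ m n)) (ring m n (tri m) (tri n))
  where
  ring : ∀ m n s t → m + n + (s + t + m * n) ≡ m + s + t + (n + m * n)
  ring = solve-∀

-- The left side is 2n - 4 for n = 6 + r. It equals `G` for n = 7, 8 and 9.
8+2r≤G : ∀ r → 8 + 2 * r ≤ G (6 + r)
8+2r≤G 0 = ≤ᵇ⇒≤ 8 10 _
8+2r≤G 1 = ≤ᵇ⇒≤ 10 10 _
8+2r≤G 2 = ≤ᵇ⇒≤ 12 12 _
8+2r≤G 3 = ≤ᵇ⇒≤ 14 14 _
8+2r≤G 4 = ≤ᵇ⇒≤ 16 20 _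
8+2r≤G (suc (suc (suc (suc (suc k))))) = slack (6 + 5 * k + tri k) (ring k (tri k))
  where
  ring : ∀ k t → 3 + (6 + k + (5 + k + (4 + k + (3 + k + (2 + k + (1 + k + (k + t)))))))
    ≡ 8 + 2 * (5 + k) + (6 + 5 * k + t)
  ring = solve-∀

private
  F≤m : ∀ m → m ≤ 4 → F m ≤ m
  F≤m 0 _ = z≤n
  F≤m 1 _ = z≤n
  F≤m 2 _ = z≤n
  F≤m 3 _ = ≤ᵇ⇒≤ 1 3 _
  F≤m 4 _ = ≤-refl
  F≤m (suc (suc (suc (suc (suc m))))) (s≤s (s≤s (s≤s (s≤s ()))))

-- The count made in `peel`: a six-vertex core with eight edges and `m + j` vertices outside, each
-- with one edge into the core and `j` of them with a second one. Those `j` lie in no edge avoiding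
-- the core, which leaves `F m` for such edges.
8+m+2j+F≤G : ∀ m j → 8 + (m + j) + j + F m ≤ G (6 + (m + j))
8+m+2j+F≤G m j with m ≤? 4
... | yes m≤4 = ≤-trans (+-monoʳ-≤ (8 + (m + j) + j) (F≤m m m≤4))
  (≤-trans (≤-reflexive (ring m j)) (8+2r≤G (m + j)))
  where
  ring : ∀ m j → 8 + (m + j) + j + m ≡ 8 + 2 * (m + j)
  ring = solve-∀
8+m+2j+F≤G 0 j | no m≰4 = contradiction z≤n m≰4
8+m+2j+F≤G 1 j | no m≰4 = contradiction (≤ᵇ⇒≤ 1 4 _) m≰4
8+m+2j+F≤G 2 j | no m≰4 = contradiction (≤ᵇ⇒≤ 2 4 _) m≰4
8+m+2j+F≤G 3 j | no m≰4 = contradiction (≤ᵇ⇒≤ 3 4 _) m≰4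
8+m+2j+F≤G 4 j | no m≰4 = contradiction (≤ᵇ⇒≤ 4 4 _) m≰4
8+m+2j+F≤G 5 j | no _ = slack (1 + 5 * j + tri j) (ring j (tri j))
  where
  ring : ∀ j t → 3 + (6 + j + (5 + j + (4 + j + (3 + j + (2 + j + (1 + j + (j + t)))))))
    ≡ 8 + (5 + j) + j + 10 + (1 + 5 * j + t)
  ring = solve-∀
8+m+2j+F≤G (suc (suc (suc (suc (suc (suc k)))))) j | no _ =
  slack (7 + 2 * k + 6 * j + tri j + k * j) (trans
    (cong (λ t → 3 + (7 + (k + j) + (6 + (k + j) + (5 + (k + j) + (4 + (k + j)
      + (3 + (k + j) + (2 + (k + j) + (1 + (k + j) + (k + j + t)))))))))
      (tri-+ k j))
    (ring k j (tri k) (tri j)))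
  where
  ring : ∀ k j s t → 3 + (7 + (k + j) + (6 + (k + j) + (5 + (k + j) + (4 + (k + j)
      + (3 + (k + j) + (2 + (k + j) + (1 + (k + j) + (k + j + (s + t + k * j)))))))))
    ≡ 8 + (6 + k + j) + j + (4 + k + (3 + k + (2 + k + (1 + k + (k + s)))))
      + (7 + 2 * k + 6 * j + t + k * j)
  ring = solve-∀

-- A five-vertex core with four edges, and one edge from each of the `m` vertices outside into the
-- core.
4+m+F≤G : ∀ m → 1 ≤ m → 4 + m + F m ≤ G (5 + m)
4+m+F≤G 1 _ = ≤ᵇ⇒≤ 5 10 _
4+m+F≤G 2 _ = ≤ᵇ⇒≤ 6 10 _
4+m+F≤G 3 _ = ≤ᵇ⇒≤ 8 12 _
4+m+F≤G 4 _ = ≤ᵇ⇒≤ 12 14 _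
4+m+F≤G 5 _ = ≤ᵇ⇒≤ 19 20 _
4+m+F≤G (suc (suc (suc (suc (suc (suc k)))))) _ = slack (4 + k) (ring k (tri (5 + k)))
  where
  ring : ∀ k t → 3 + (6 + k + (5 + k + t)) ≡ 4 + (6 + k) + t + (4 + k)
  ring = solve-∀

-- A complete five-vertex core that no edge leaves. Equality at `m = 5` is the pair of disjoint
-- cliques, the extremal graph on ten vertices.
10+F≤G : ∀ m → 1 ≤ m → 10 + F m ≤ G (5 + m)
10+F≤G 1 _ = ≤ᵇ⇒≤ 10 10 _
10+F≤G 2 _ = ≤ᵇ⇒≤ 10 10 _
10+F≤G 3 _ = ≤ᵇ⇒≤ 11 12 _
10+F≤G 4 _ = ≤ᵇ⇒≤ 14 14 _
10+F≤G 5 _ = ≤ᵇ⇒≤ 20 20 _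
10+F≤G (suc (suc (suc (suc (suc (suc k)))))) _ = slack (4 + 2 * k) (ring k (tri (5 + k)))
  where
  ring : ∀ k t → 3 + (6 + k + (5 + k + t)) ≡ 10 + t + (4 + 2 * k)
  ring = solve-∀

pos : ℕ → Bool
pos zero    = false
pos (suc _) = true

pos⁺ : ∀ {k} → T (pos k) → 1 ≤ k
pos⁺ {suc k} _ = s≤s z≤n

pos⁻ : ∀ {k} → ¬ T (pos k) → k ≤ 0
pos⁻ {zero}  _  = z≤n
pos⁻ {suc k} ¬p = contradiction _ ¬p

n≤0⊎1≤n : ∀ n → n ≤ 0 ⊎ 1 ≤ n
n≤0⊎1≤n zero    = inj₁ z≤n
n≤0⊎1≤n (suc n) = inj₂ (s≤s z≤n)

find : ∀ {V : Set} (f : V → ℕ) xs →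
  (Σ[ t ∈ V ] Σ[ r ∈ List V ] (xs ↭ t ∷ r × 1 ≤ f t)) ⊎ (∀ t r → xs ↭ t ∷ r → f t ≤ 0)
find f xs with pick? 1 (pos ∘ f) xs
... | yes (t , r , p , b) = inj₁ (t , r , p , pos⁺ b)
... | no none             = inj₂ λ t r p → pos⁻ λ b → none (t , r , p , b)

partition : ∀ {V : Set} (p : V → Bool) us → Σ[ xs ∈ List V ] Σ[ ys ∈ List V ]
  (us ↭ xs ++ ys × All (T ∘ p) xs × All (¬_ ∘ T ∘ p) ys)
partition p [] = [] , [] , reflₚ , [] , []
partition p (u ∷ us) with xs , ys , q , pxs , pys ← partition p us | T? (p u)
... | yes pu = u ∷ xs , ys , prep u q , pu ∷ pxs , pys
... | no ¬pu = xs , u ∷ ys , ↭-trans (prep u q) (↭-sym (shift u xs ys)) , pxs , ¬pu ∷ pys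

-- Among any three entries one has d ≤ 2; remove it.
Σ₁-≤2+2n : ∀ {V : Set} (d : V → ℕ) k us → length us ≡ 2 + k →
  (∀ t u r → us ↭ t ∷ u ∷ r → d t + d u ≤ 6) →
  (∀ t u s r → us ↭ t ∷ u ∷ s ∷ r → d t + (d u + d s) ≤ 8) →
  Σ₁ d us ≤ 2 + 2 * (2 + k)
Σ₁-≤2+2n d zero (t ∷ u ∷ []) refl pair triple =
  subst (λ k → d t + k ≤ 6) (sym (+-identityʳ (d u))) (pair t u [] reflₚ)
Σ₁-≤2+2n {V} d (suc k) us@(t ∷ u ∷ s ∷ r) eq pair triple = go (d t ≤? 2) (d u ≤? 2) (d s ≤? 2)
  where
  front : ∀ {x xs} → us ↭ x ∷ xs → d x ≤ 2 → Σ₁ d us ≤ 2 + 2 * (3 + k)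
  front {x} {xs} π x≤2 = begin
    Σ₁ d us                ≡⟨ Σ₁-↭ d π ⟩
    d x + Σ₁ d xs          ≤⟨ +-mono-≤ x≤2 (Σ₁-≤2+2n d k xs
      (suc-injective (trans (sym (↭-length π)) eq))
      (λ t u r ρ → pair t u (x ∷ r) (↭-trans π (pick-tail₂ ρ)))
      (λ t u s r ρ → triple t u s (x ∷ r) (↭-trans π (pick-tail₃ ρ)))) ⟩
    2 + (2 + 2 * (2 + k))  ≡⟨ cong (2 +_) (sym (*-distribˡ-+ 2 1 (2 + k))) ⟩
    2 + 2 * (3 + k)        ∎
    where open ≤-Reasoning

  go : Dec (d t ≤ 2) → Dec (d u ≤ 2) → Dec (d s ≤ 2) → Σ₁ d us ≤ 2 + 2 * (3 + k)
  go (yes t≤2) _         _         = front reflₚ t≤2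
  go (no _)    (yes u≤2) _         = front (swap t u reflₚ) u≤2
  go (no _)    (no _)    (yes s≤2) = front (pick-tail (swap u s reflₚ)) s≤2
  go (no t≰2)  (no u≰2)  (no s≰2)  = contradiction (triple t u s r reflₚ)
    (<⇒≱ (+-mono-≤ (≰⇒> t≰2) (+-mono-≤ (≰⇒> u≰2) (≰⇒> s≰2))))

G≤F : ∀ k → G (6 + k) ≤ F (6 + k)
G≤F 0 = ≤-refl
G≤F 1 = ≤ᵇ⇒≤ 10 15 _
G≤F 2 = ≤ᵇ⇒≤ 12 21 _
G≤F 3 = ≤ᵇ⇒≤ 14 28 _
G≤F 4 = ≤ᵇ⇒≤ 20 36 _
G≤F (suc (suc (suc (suc (suc k))))) = +-mono-≤ {3} {9 + k} (s≤s (s≤s (s≤s z≤n)))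
  (≤-trans (m≤n+m (tri (7 + k)) (7 + k)) (m≤n+m (tri (8 + k)) (8 + k)))

comet≤F : ∀ k → 4 + tri (4 + k) ≤ F (8 + k)
comet≤F k = slack (11 + 3 * k) (ring k (tri (4 + k)))
  where
  ring : ∀ k t → 6 + k + (5 + k + (4 + k + t)) ≡ 4 + t + (11 + 3 * k)
  ring = solve-∀

-- The forbidden patterns and the soundness of the search.

module Hypergraph {V : Set} (h : V → V → V → Bool)
  (h-swapˡ : ∀ x y z → h x y z ≡ h y x z)
  (h-swapʳ : ∀ x y z → h x y z ≡ h x z y) where
  w : V → V → V → ℕ
  w x y z = bit (h x y z)

  w-sym : Symmetric₃ w
  w-sym = record
    { swapˡ = λ x y z → cong bit (h-swapˡ x y z)
    ; swapʳ = λ x y z → cong bit (h-swapʳ x y z)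
    }

  pathᵖ : Fun {V} 7
  pathᵖ a b c d e f g = h a b c ∧ h c d e ∧ h e f g

  triangleᵖ : Fun {V} 6
  triangleᵖ x₁ x₂ x₃ y₁ y₂ y₃ = h x₁ y₃ x₂ ∧ h x₂ y₁ x₃ ∧ h x₃ y₂ x₁

  doubleᵖ : Fun {V} 5
  doubleᵖ a b c p q = h a b c ∧ h a p q ∧ h b p q

  matchingᵖ : Fun {V} 6
  matchingᵖ a b c d e f = h a b c ∧ h d e f

  hingeᵖ : Fun {V} 8
  hingeᵖ v a b c d x y z = h v a b ∧ h v c d ∧ h x y z

  -- The edge function stays fixed and only the vertex list varies, so deleting a vertex means
  -- passing to the tail of a list.
  record Avoids (μ : Mode) (M : List V) : Set where
    field
      unique      : Unique M
      ¬path       : ¬ Pick 7 pathᵖ M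
      ¬triangle   : ¬ Pick 6 triangleᵖ M
      ¬double     : T (double μ) → ¬ Pick 5 doubleᵖ M
      ¬matching   : T (matching μ) → ¬ Pick 6 matchingᵖ M
      ¬hinge      : T (hinge μ) → ¬ Pick 8 hingeᵖ M

  Avoids-↭ : ∀ {μ M N} → M ↭ N → Avoids μ M → Avoids μ N
  Avoids-↭ p A = record
    { unique    = Unique-↭ p unique
    ; ¬path     = ¬path ∘ Pick-↭ 7 (↭-sym p)
    ; ¬triangle = ¬triangle ∘ Pick-↭ 6 (↭-sym p)
    ; ¬double   = λ t → ¬double t ∘ Pick-↭ 5 (↭-sym p)
    ; ¬matching = λ t → ¬matching t ∘ Pick-↭ 6 (↭-sym p)
    ; ¬hinge    = λ t → ¬hinge t ∘ Pick-↭ 8 (↭-sym p)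
    }
    where open Avoids A

  Avoids-tail : ∀ {μ x M} → Avoids μ (x ∷ M) → Avoids μ M
  Avoids-tail A = record
    { unique    = AllPairs.tail unique
    ; ¬path     = ¬path ∘ Pick-∷ 7
    ; ¬triangle = ¬triangle ∘ Pick-∷ 6
    ; ¬double   = λ t → ¬double t ∘ Pick-∷ 5
    ; ¬matching = λ t → ¬matching t ∘ Pick-∷ 6
    ; ¬hinge    = λ t → ¬hinge t ∘ Pick-∷ 8
    }
    where open Avoids A

  module Local {μ d M} (A : Avoids μ (d ∷ M)) (n : ℕ) (n≤ : n ≤ length (d ∷ M)) where

    open Search μ n
    open Avoids A

    v : ℕ → V
    v = nth d (d ∷ M)

    ρ : Tri → Bool
    ρ (i , j , k) = h (v i) (v j) (v k)

    ⟦_⟧ : Sum → ℕ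
    ⟦ c₃ is ⟧     = Σ₃ w (map v is)
    ⟦ c₂ i js ⟧   = Σ₂ (w (v i)) (map v js)
    ⟦ c₁ i j ks ⟧ = Σ₁ (w (v i) (v j)) (map v ks)
    ⟦ c₀ i j k ⟧  = w (v i) (v j) (v k)
    ⟦ c∅ ⟧          = 0
    ⟦ s ⊕ t ⟧     = ⟦ s ⟧ + ⟦ t ⟧

    val : List Tri → ℕ
    val = Σ₁ (bit ∘ ρ)

    ρ-sorted : ∀ i j k → ρ (sorted i j k) ≡ h (v i) (v j) (v k)
    ρ-sorted i j k with i <ᵇ j
    ... | true with j <ᵇ k
    ...   | true = refl
    ...   | false with i <ᵇ k
    ...     | true  = h-swapʳ _ _ _
    ...     | false = trans (h-swapˡ _ _ _) (h-swapʳ _ _ _)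
    ρ-sorted i j k | false with i <ᵇ k
    ...   | true = h-swapˡ _ _ _
    ...   | false with j <ᵇ k
    ...     | true  = trans (h-swapʳ _ _ _) (h-swapˡ _ _ _)
    ...     | false = trans (h-swapˡ _ _ _) (trans (h-swapʳ _ _ _) (h-swapˡ _ _ _))

    val₁ : ∀ i j ks → val (triples₁ i j ks) ≡ ⟦ c₁ i j ks ⟧
    val₁ i j []       = refl
    val₁ i j (k ∷ ks) = cong₂ _+_ (cong bit (ρ-sorted i j k)) (val₁ i j ks)

    val₂ : ∀ i js → val (triples₂ i js) ≡ ⟦ c₂ i js ⟧
    val₂ i []       = refl
    val₂ i (j ∷ js) =
      trans (Σ₁-++ _ (triples₁ i j js) _) (cong₂ _+_ (val₁ i j js) (val₂ i js))

    val₃ : ∀ is → val (triples₃ is) ≡ ⟦ c₃ is ⟧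
    val₃ []       = refl
    val₃ (i ∷ is) =
      trans (Σ₁-++ _ (triples₂ i is) _) (cong₂ _+_ (val₂ i is) (val₃ is))

    val-triples : ∀ s → val (triples s) ≡ ⟦ s ⟧
    val-triples (c₃ is)     = val₃ is
    val-triples (c₂ i js)   = val₂ i js
    val-triples (c₁ i j ks) = val₁ i j ks
    val-triples (c₀ i j k)  =
      trans (+-identityʳ _) (cong bit (ρ-sorted i j k))
    val-triples c∅          = refl
    val-triples (s ⊕ t)     =
      trans (Σ₁-++ _ (triples s) _) (cong₂ _+_ (val-triples s) (val-triples t))

    val-positive : ∀ ts → 1 ≤ val ts → Any (T ∘ ρ) ts
    val-positive (t ∷ ts) p with ρ t in eq
    ... | true  = here (from T-≡ eq)
    ... | false = there (val-positive ts p)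

    val-zero : ∀ ts → val ts ≤ 0 → All (¬_ ∘ T ∘ ρ) ts
    val-zero []       p = []
    val-zero (t ∷ ts) p =
      bit-≤ (≤-trans (m≤m+n _ _) p) ∷ val-zero ts (≤-trans (m≤n+m _ (bit (ρ t))) p)

    fresh-sound : ∀ {i} js → T (fresh i js) → All (i ≢_) js
    fresh-sound []           _ = []
    fresh-sound {i} (j ∷ js) t with i ≡ᵇ j in eq
    ... | false =
      (λ i≡j → subst T eq (≡⇒≡ᵇ i j i≡j)) ∷ fresh-sound js t

    distinct-< : ∀ is → T (distinct is) → All (_< length (d ∷ M)) is
    distinct-< []       _ = []
    distinct-< (i ∷ is) t with i< , t′ ← to T-∧ t =
      ≤-trans (<ᵇ⇒< i n i<) n≤ ∷ distinct-< is (proj₂ (to (T-∧ {fresh i is}) t′))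

    distinct-unique : ∀ is → T (distinct is) → Unique (map v is)
    distinct-unique []       _ = []
    distinct-unique (i ∷ is) t with i< , t′ ← to T-∧ t
      with fr , ds ← to (T-∧ {fresh i is}) t′ =
      All.map⁺ (All.zipWith
        (λ (i≢j , j<) eq → i≢j (nth-injective d unique (≤-trans (<ᵇ⇒< i n i<) n≤) j< eq))
        (fresh-sound is fr , distinct-< is ds))
      ∷ distinct-unique is ds

    picked : ∀ {k f} (is : Vec ℕ k) → T (distinct (toList is)) →
      T (app f (Vec.map v is)) → Pick k f (d ∷ M)
    picked is ds = pick (Vec.map v is)
      (subst Unique (sym (eq is)) (distinct-unique _ ds))
      (subst (All (_∈ d ∷ M)) (sym (eq is))
        (All.map⁺ (All.map (nth-∈ d (d ∷ M)) (distinct-< _ ds))))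
      where
      eq : ∀ {k} (is : Vec ℕ k) → toList (Vec.map v is) ≡ map v (toList is)
      eq []       = refl
      eq (i ∷ is) = cong (v i ∷_) (eq is)

    split-sound : ∀ x t {a b} → split x t ≡ just (a , b) → T (ρ t) → T (h (v x) (v a) (v b))
    split-sound x (i , j , k) eq t with x ≡ᵇ i in xi
    split-sound x (i , j , k) refl t | true rewrite ≡ᵇ⇒≡ x i (from T-≡ xi) = t
    split-sound x (i , j , k) eq t | false with x ≡ᵇ j in xj
    split-sound x (i , j , k) refl t | false | true
      rewrite ≡ᵇ⇒≡ x j (from T-≡ xj) = subst T (h-swapˡ _ _ _) t
    split-sound x (i , j , k) eq t | false | false with x ≡ᵇ k in xk
    split-sound x (i , j , k) refl t | false | false | true
      rewrite ≡ᵇ⇒≡ x k (from T-≡ xk) =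
      subst T (trans (h-swapʳ _ _ _) (h-swapˡ _ _ _)) t

    infixr 4 _&_
    _&_ : ∀ {a b} → T a → T b → T (a ∧ b)
    p & q = from T-∧ (p , q)

    closes-sound : ∀ x y z s b t → T (closes x y z s b t) →
      T (h (v x) (v y) (v z)) → T (h (v x) (v s) (v b)) → T (h (v y) (v s) (v t)) → Absurd
    closes-sound x y z s b t ds e f g =
      ¬triangle (picked (x ∷ y ∷ s ∷ t ∷ b ∷ z ∷ []) ds
        (subst T (h-swapʳ _ _ _) e
         & subst T (h-swapʳ _ _ _) g
         & subst T (trans (h-swapˡ _ _ _) (h-swapʳ _ _ _)) f))

    clash-sound : ∀ x y z ab st → T (clash x y z ab st) →
      T (h (v x) (v y) (v z)) →
      T (h (v x) (v (proj₁ ab)) (v (proj₂ ab))) →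
      T (h (v y) (v (proj₁ st)) (v (proj₂ st))) → Absurd
    clash-sound x y z (a , b) (s , t) c e f g =
      ∨-elim c
        (λ ds → ¬path (picked (a ∷ b ∷ x ∷ z ∷ y ∷ s ∷ t ∷ []) ds
          (subst T (trans (h-swapˡ _ _ _) (h-swapʳ _ _ _)) f
           & subst T (h-swapʳ _ _ _) e & g))) λ c → ∨-elim c
        (λ p → let eq , ds = to (T-∧ {a ≡ᵇ s}) p in
          closes-sound x y z a b t ds e f
            (subst (λ k → T (h (v y) (v k) (v t))) (sym (≡ᵇ⇒≡ a s eq)) g)) λ c → ∨-elim c
        (λ p → let eq , ds = to (T-∧ {a ≡ᵇ t}) p in
          closes-sound x y z a b s ds e f
            (subst (λ k → T (h (v y) (v k) (v s))) (sym (≡ᵇ⇒≡ a t eq))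
              (subst T (h-swapʳ _ _ _) g))) λ c → ∨-elim c
        (λ p → let eq , ds = to (T-∧ {b ≡ᵇ s}) p in
          closes-sound x y z b a t ds e (subst T (h-swapʳ _ _ _) f)
            (subst (λ k → T (h (v y) (v k) (v t))) (sym (≡ᵇ⇒≡ b s eq)) g)) λ c → ∨-elim c
        (λ p → let eq , ds = to (T-∧ {b ≡ᵇ t}) p in
          closes-sound x y z b a s ds e (subst T (h-swapʳ _ _ _) f)
            (subst (λ k → T (h (v y) (v k) (v s))) (sym (≡ᵇ⇒≡ b t eq))
              (subst T (h-swapʳ _ _ _) g)))
        (λ p → let nd , p₁ = to (T-∧ {double μ}) p
                   as , p₂ = to (T-∧ {a ≡ᵇ s}) p₁
                   bt , ds = to (T-∧ {b ≡ᵇ t}) p₂ in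
          ¬double nd (picked (x ∷ y ∷ z ∷ a ∷ b ∷ []) ds
            (e & f & subst₂ (λ k l → T (h (v y) (v k) (v l)))
                       (sym (≡ᵇ⇒≡ a s as)) (sym (≡ᵇ⇒≡ b t bt)) g)))

    both-sound : ∀ p m m′ → T (both p m m′) →
      Σ[ ab ∈ _ ] Σ[ st ∈ _ ] (m ≡ just ab × m′ ≡ just st × T (p ab st))
    both-sound p (just ab) (just st) t = ab , st , refl , refl , t

    centreAt-sound : ∀ f g e → T (centreAt f g e) → T (ρ e) → T (ρ f) → T (ρ g) → Absurd
    centreAt-sound f g (x , y , z) c te tf tg
      with ab , st , eq , eq′ , cl ← both-sound (clash x y z) (split x f) (split y g) c =
      clash-sound x y z ab st cl te (split-sound x f eq tf) (split-sound y g eq′ tg)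

    orders-sound : ∀ e → T (ρ e) → All (T ∘ ρ) (orders e)
    orders-sound e t =
      t ∷ subst T (h-swapʳ _ _ _) t ∷ subst T (h-swapˡ _ _ _) t
      ∷ subst T (trans (h-swapˡ _ _ _) (h-swapʳ _ _ _)) t
      ∷ subst T (trans (h-swapʳ _ _ _) (h-swapˡ _ _ _)) t
      ∷ subst T (trans (h-swapˡ _ _ _) (trans (h-swapʳ _ _ _) (h-swapˡ _ _ _))) t ∷ []

    any-sound : ∀ {A : Set} {P : A → Set} (p : A → Bool) {xs} →
      All P xs → (∀ x → T (p x) → P x → Absurd) → T (any p xs) → Absurd
    any-sound p {xs} ps refute t =
      All.lookupWith (λ Px px → refute _ px Px) ps (Any.any⁻ p xs t)

    centre-sound : ∀ e f g → T (centre e f g) → T (ρ e) → T (ρ f) → T (ρ g) → Absurd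
    centre-sound e f g c te tf tg =
      any-sound (centreAt f g) (orders-sound e te)
        (λ o co to′ → centreAt-sound f g o co to′ tf tg) c

    apart-sound : ∀ e f → T (matching μ) → T (apart e f) → T (ρ e) → T (ρ f) → Absurd
    apart-sound (i , j , k) (i′ , j′ , k′) m ds te tf =
      ¬matching m (picked (i ∷ j ∷ k ∷ i′ ∷ j′ ∷ k′ ∷ []) ds (te & tf))

    hinged-sound : ∀ e f g → T (hinge μ) → T (hinged e f g) →
      T (ρ e) → T (ρ f) → T (ρ g) → Absurd
    hinged-sound e@(i , j , k) f g m c te tf tg =
      any-sound (hingeAt e g) (orders-sound f tf) at c
      where
      at : ∀ o → T (hingeAt e g o) → T (ρ o) → Absurd
      at (x , y , z) t to′
        with ab , cd , refl , eq′ , ds ← both-sound _ (just (y , z)) (split x g) t =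
        ¬hinge m (picked (x ∷ y ∷ z ∷ proj₁ cd ∷ proj₂ cd ∷ i ∷ j ∷ k ∷ []) ds
          (to′ & split-sound x g eq′ tg & te))

    bad-sound : ∀ e f g → T (bad e f g) → T (ρ e) → T (ρ f) → T (ρ g) → Absurd
    bad-sound e f g b te tf tg =
      ∨-elim b (λ c → centre-sound e f g c te tf tg) λ b →
      ∨-elim b (λ c → centre-sound f e g c tf te tg) λ b →
      ∨-elim b (λ c → centre-sound g e f c tg te tf) λ b →
      ∨-elim b
        (λ c → let m , c = to (T-∧ {matching μ}) c in
          ∨-elim c (λ c → apart-sound e f m c te tf) λ c →
          ∨-elim c (λ c → apart-sound e g m c te tg) λ c →
          apart-sound f g m c tf tg)
        (λ c → let m , c = to (T-∧ {hinge μ}) c in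
          ∨-elim c (λ c → hinged-sound e f g m c te tf tg) λ c →
          ∨-elim c (λ c → hinged-sound f e g m c tf te tg) λ c →
          hinged-sound g e f m c tg te tf)

    Present : List Tri → Set
    Present = All (T ∘ ρ)

    conflict-sound : ∀ {es} t → Present es → T (conflict es t) → T (ρ t) → Absurd
    conflict-sound {es} t ps c tt =
      any-sound (λ e → any (bad t e) es) ps
        (λ e c pe → any-sound (bad t e) ps (λ f b pf → bad-sound t e f b tt pe pf) c) c

    keep-sound : ∀ p cs → (∀ r → T (not (p r)) → ¬ T (ρ r)) → val cs ≤ val (keep p cs)
    keep-sound p []       dead = z≤n
    keep-sound p (r ∷ cs) dead with p r in eq
    ... | true  = +-monoʳ-≤ (bit (ρ r)) (keep-sound p cs dead)
    ... | false = +-mono-≤ (bit⁻ (dead r (subst (T ∘ not) (sym eq) _))) (keep-sound p cs dead)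

    survives-sound : ∀ {es} t → Present es → T (ρ t) →
      ∀ r → T (not (survives es t r)) → ¬ T (ρ r)
    survives-sound {es} t ps tt r dead tr with any (bad r t) es in eq
    ... | true =
      any-sound (bad r t) ps (λ f b pf → bad-sound r t f b tr tt pf) (from T-≡ eq)

    length-bound : ∀ cs → val cs ≤ length cs
    length-bound cs = Σ₁-≤1 cs λ t _ _ → bit≤1 (ρ t)

    mutual
      search-sound : ∀ m {es} cs acc K → Present es → T (search m es cs acc K) →
        acc + val cs ≤ K
      search-sound m cs acc K ps s = ∨-elim s
        (λ b → ≤-trans (+-monoʳ-≤ acc (length-bound cs)) (≤ᵇ⇒≤ (acc + length cs) K b))
        (branch-sound m cs acc K ps)

      branch-sound : ∀ m {es} cs acc K → Present es → T (branch m es cs acc K) →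
        acc + val cs ≤ K
      branch-sound (suc m) {es} (t ∷ cs) acc K ps s with ρ t in eq
      ... | false = search-sound m cs acc K ps (proj₁ (to (T-∧ {search m es cs acc K}) s))
      ... | true  = ∨-elim (proj₂ (to (T-∧ {search m es cs acc K}) s))
        (λ c → ⊥-elim (conflict-sound t ps c tt))
        (λ s → ≤-trans (≤-reflexive (+-suc acc (val cs)))
          (≤-trans (s≤s (+-monoʳ-≤ acc (keep-sound _ cs (survives-sound t (tt ∷ ps) tt))))
            (search-sound m _ (suc acc) K (tt ∷ ps) s)))
        where tt = from T-≡ eq

    assume-sound : ∀ f k {es} cs K → Present es →
      (∀ {es} cs → Present es → T (k es cs) → val cs ≤ K) →
      T (assume f k es cs) → T (ρ f) → val cs ≤ K
    assume-sound f k cs K ps k-sound a tf = ∨-elim a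
      (λ c → ⊥-elim (conflict-sound f ps c tf))
      (λ s → ≤-trans (keep-sound _ cs (survives-sound f (tf ∷ ps) tf))
               (k-sound _ (tf ∷ ps) s))

    run-sound : ∀ fs as K {es} cs → Present es → Present fs →
      All (λ a → 1 ≤ ⟦ a ⟧) as → T (run fs as K es cs) → val cs ≤ K
    run-sound (f ∷ fs) as K cs ps (tf ∷ tfs) alts r =
      assume-sound f (run fs as K) cs K ps
        (λ cs ps → run-sound fs as K cs ps tfs alts) r tf
    run-sound [] (a ∷ as) K {es} cs ps [] (1≤a ∷ alts) r =
      All.lookupWith {R = λ _ → val cs ≤ K}
        (λ {f} r tf → assume-sound f (run [] as K) cs K ps
          (λ cs ps → run-sound [] as K cs ps [] alts) r tf)
        (All.all⁺ (λ f → assume f (run [] as K) es cs) (triples a) r)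
        (val-positive (triples a) (subst (1 ≤_) (sym (val-triples a)) 1≤a))
    run-sound [] [] K cs ps [] [] r = search-sound (length cs) cs 0 K ps r

    ==-sound : ∀ r s → T (r == s) → r ≡ s
    ==-sound (i , j , k) (i′ , j′ , k′) t
      with a , t ← to (T-∧ {i ≡ᵇ i′}) t
      with b , c ← to (T-∧ {j ≡ᵇ j′}) t =
      cong₂ _,_ (≡ᵇ⇒≡ i i′ a) (cong₂ _,_ (≡ᵇ⇒≡ j j′ b) (≡ᵇ⇒≡ k k′ c))

    nots-sound : ∀ nots → All (λ a → ⟦ a ⟧ ≤ 0) nots → ∀ r →
      T (any (λ a → any (r ==_) (triples a)) nots) → ¬ T (ρ r)
    nots-sound nots none r t tr =
      any-sound (λ a → any (r ==_) (triples a)) none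
        (λ a t a≤0 → any-sound (r ==_)
          (val-zero (triples a) (subst (_≤ 0) (sym (val-triples a)) a≤0))
          (λ s r≡s ¬ts → ¬ts (subst (T ∘ ρ) (==-sound r s r≡s) tr)) t) t

    check-sound : ∀ facts nots alts c K → T (check facts nots alts c K) →
      Present facts → All (λ a → ⟦ a ⟧ ≤ 0) nots → All (λ a → 1 ≤ ⟦ a ⟧) alts → ⟦ c ⟧ ≤ K
    check-sound facts nots alts c K t ps none some =
      subst (_≤ K) (val-triples c)
        (≤-trans (keep-sound _ (triples c) dead) (run-sound facts alts K _ [] ps some t))
      where
      dead : ∀ r → T (not (not (any (λ a → any (r ==_) (triples a)) nots))) → ¬ T (ρ r)
      dead r t with any (λ a → any (r ==_) (triples a)) nots in eq
      ... | true = nots-sound nots none r (from T-≡ eq)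

  -- A bound on a sum over finitely many named vertices, established by evaluation:
  -- facts are edges, the sums in nots vanish and those in alts do not.
  search-bound : ∀ n {μ d M} (A : Avoids μ (d ∷ M)) {n≤ : T (n ≤ᵇ length (d ∷ M))} →
    let open Local A n (≤ᵇ⇒≤ n _ n≤) in
    ∀ facts nots alts c K {_ : T (Search.check μ n facts nots alts c K)} →
    Present facts → All (λ a → ⟦ a ⟧ ≤ 0) nots → All (λ a → 1 ≤ ⟦ a ⟧) alts → ⟦ c ⟧ ≤ K
  search-bound n A {n≤} facts nots alts c K {t} = check-sound facts nots alts c K t
    where open Local A n (≤ᵇ⇒≤ n _ n≤)

  -- Counting edges by their vertices in a core.

  plain nodouble star spread : Mode
  plain    = mode false false false
  nodouble = mode true false false
  star     = mode true true false
  spread   = mode true false true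

  weaken : ∀ {μ M} → Avoids μ M → Avoids plain M
  weaken A = record
    { unique = unique ; ¬path = ¬path ; ¬triangle = ¬triangle
    ; ¬double = λ () ; ¬matching = λ () ; ¬hinge = λ () }
    where open Avoids A

  Avoids-++ʳ : ∀ {μ} xs {ys} → Avoids μ (xs ++ ys) → Avoids μ ys
  Avoids-++ʳ []       A = A
  Avoids-++ʳ (x ∷ xs) A = Avoids-++ʳ xs (Avoids-tail A)

  w₃ : ∀ q t u → w q t u ≡ w t u q
  w₃ q t u = trans (swapˡ w-sym q t u) (swapʳ w-sym t q u)

  cross-0 : ∀ Q us → (∀ t u r → us ↭ t ∷ u ∷ r → Σ₁ (w t u) Q ≤ 0) →
    Σ₁ (λ q → Σ₂ (w q) us) Q ≤ 0
  cross-0 []      us none = z≤n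
  cross-0 (q ∷ Q) us none = +-mono-≤
    (Σ₂-0 us λ t u r p → subst (_≤ 0) (sym (w₃ q t u)) (m+n≤o⇒m≤o _ (none t u r p)))
    (cross-0 Q us λ t u r p → m+n≤o⇒n≤o (w t u q) (none t u r p))

  -- `A`, `B` and `C` bound the edges with three, two and no vertices in the core `Q`; the
  -- hypothesis on pairs says that no edge has exactly one.
  assemble : ∀ Q us {A B C} → Σ₃ w Q ≤ A → Σ₁ (λ t → Σ₂ (w t) Q) us ≤ B →
    (∀ t u r → us ↭ t ∷ u ∷ r → Σ₁ (w t u) Q ≤ 0) → Σ₃ w us ≤ C →
    Σ₃ w (Q ++ us) ≤ A + B + C
  assemble Q us {A} {B} {C} a b none c = subst (_≤ A + B + C) (sym (Σ₃-++ w-sym Q us))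
    (+-mono-≤
      (≤-trans (+-mono-≤ (+-mono-≤ a b) (cross-0 Q us none)) (≤-reflexive (+-identityʳ (A + B))))
      c)

  dead-prefix : ∀ {P : V → Set} xs ys → All P xs →
    (∀ t u s r → xs ++ ys ↭ t ∷ u ∷ s ∷ r → P t → w t u s ≤ 0) →
    Σ₃ w (xs ++ ys) ≤ Σ₃ w ys
  dead-prefix []       ys []         dead = ≤-refl
  dead-prefix (x ∷ xs) ys (px ∷ pxs) dead = +-mono-≤
    (Σ₂-0 (xs ++ ys) λ u s r p → dead x u s r (prep x p) px)
    (dead-prefix xs ys pxs λ t u s r p → dead t u s _ (pick-tail₃ p))

  -- A vertex marked by `p` may send a second edge into the core, but lies in no edge avoiding the
  -- core. The induction hypothesis is therefore spent on the unmarked vertices alone, and the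
  -- marked ones are cheap: two edges each.
  peel : ∀ {μ} Q us (p : V → Bool) → Avoids μ (Q ++ us) → Σ₃ w Q ≤ 8 →
    (∀ t r → us ↭ t ∷ r → Σ₂ (w t) Q ≤ 1 + bit (p t)) →
    (∀ t u r → us ↭ t ∷ u ∷ r → Σ₁ (w t u) Q ≤ 0) →
    (∀ t u s r → us ↭ t ∷ u ∷ s ∷ r → T (p t) → w t u s ≤ 0) →
    (∀ ys → length ys ≤ length us → Avoids μ ys → Σ₃ w ys ≤ F (length ys)) →
    Σ₃ w (Q ++ us) ≤ G (6 + length us)
  peel Q us p A inner single pair dead ih
    with xs , ys , q , pxs , pys ← partition p us =
    ≤-trans (assemble Q us inner singles pair outer)
      (subst (λ k → 8 + (m + j + j) + F m ≤ G (6 + k)) (trans (+-comm m j) (sym len))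
        (8+m+2j+F≤G m j))
    where
    m = length ys
    j = length xs

    len : length us ≡ j + m
    len = trans (↭-length q) (length-++ xs)

    outer : Σ₃ w us ≤ F m
    outer = ≤-trans (≤-reflexive (Σ₃-↭ w-sym q))
      (≤-trans (dead-prefix xs ys pxs λ t u s r q′ → dead t u s r (↭-trans q q′))
        (ih ys (subst (m ≤_) (sym len) (m≤n+m m j))
          (Avoids-++ʳ xs (Avoids-↭ q (Avoids-++ʳ Q A)))))

    bits : Σ₁ (bit ∘ p) us ≤ j
    bits = begin
      Σ₁ (bit ∘ p) us                  ≡⟨ Σ₁-↭ _ q ⟩
      Σ₁ (bit ∘ p) (xs ++ ys)          ≡⟨ Σ₁-++ _ xs ys ⟩
      Σ₁ (bit ∘ p) xs + Σ₁ (bit ∘ p) ys ≤⟨ +-mono-≤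
        (Σ₁-≤1 xs λ t _ _ → bit≤1 (p t))
        (Σ₁-0 ys λ t r q′ → bit⁻ (All.lookup pys (∈-resp-↭ (↭-sym q′) (here refl)))) ⟩
      j + 0                            ≡⟨ +-identityʳ j ⟩
      j                                ∎
      where open ≤-Reasoning

    singles : Σ₁ (λ t → Σ₂ (w t) Q) us ≤ m + j + j
    singles = begin
      Σ₁ (λ t → Σ₂ (w t) Q) us           ≤⟨ Σ₁-mono us single ⟩
      Σ₁ (λ t → 1 + bit (p t)) us        ≡⟨ Σ₁-+ (λ _ → 1) (bit ∘ p) us ⟩
      Σ₁ (λ _ → 1) us + Σ₁ (bit ∘ p) us  ≤⟨ +-mono-≤ (≤-reflexive (Σ₁-1 us)) bits ⟩
      length us + j                      ≡⟨ cong (_+ j) (trans len (+-comm j m)) ⟩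
      m + j + j                          ∎
      where open ≤-Reasoning

  -- Graphs with a double.

  -- An edge with exactly one vertex outside the core {a, b, c, p, q} contains either two of a, b, c
  -- (`outer`) or both p and q (`page`): with one vertex from each group it would close a triangle
  -- with abc and one of apq, bpq. The cases depend on whether such edges exist and on the `inner`
  -- edges, those with two vertices among a, b, c and one of p, q.
  double-bound : ∀ {a b c p q us} → Avoids plain (a ∷ b ∷ c ∷ p ∷ q ∷ us) →
    T (h a b c) → T (h a p q) → T (h b p q) → 1 ≤ length us →
    (∀ ys → length ys ≤ length us → Avoids plain ys → Σ₃ w ys ≤ F (length ys)) →
    Σ₃ w (a ∷ b ∷ c ∷ p ∷ q ∷ us) ≤ G (5 + length us)
  double-bound {a} {b} {c} {p} {q} {us} A abc apq bpq 1≤us ih = cases (find outer us)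
    where
    Q : List V
    Q = a ∷ b ∷ c ∷ p ∷ q ∷ []

    double-facts : List Tri
    double-facts = (0 , 1 , 2) ∷ (0 , 3 , 4) ∷ (1 , 3 , 4) ∷ []

    Q₅ Q₆ : List ℕ
    Q₅ = 0 ∷ 1 ∷ 2 ∷ 3 ∷ 4 ∷ []
    Q₆ = 0 ∷ 1 ∷ 2 ∷ 3 ∷ 4 ∷ 5 ∷ []

    outer : V → ℕ
    outer t = w a b t + (w a c t + w b c t)

    outer′ : ℕ → Sum
    outer′ t = c₀ 0 1 t ⊕ c₀ 0 2 t ⊕ c₀ 1 2 t

    page : V → ℕ
    page t = w p q t

    inner : ℕ
    inner = w a b p + (w a b q + (w a c p + (w a c q + (w b c p + w b c q))))

    inner′ : Sum
    inner′ = c₀ 0 1 3 ⊕ c₀ 0 1 4 ⊕ c₀ 0 2 3 ⊕ c₀ 0 2 4 ⊕ c₀ 1 2 3 ⊕ c₀ 1 2 4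

    A↭ : ∀ {vs} → us ↭ vs → Avoids plain (Q ++ vs)
    A↭ π = Avoids-↭ (++⁺ˡ Q π) A

    with-vertex : ∀ {x r} → us ↭ x ∷ r →
      Σ₃ w (Q ++ x ∷ r) ≤ G (6 + length r) → Σ₃ w (Q ++ us) ≤ G (5 + length us)
    with-vertex {r = r} π = subst₂ _≤_ (sym (Σ₃-↭ w-sym (++⁺ˡ Q π)))
      (cong (λ k → G (5 + k)) (sym (↭-length π)))

    shorter : ∀ {x r} → us ↭ x ∷ r →
      ∀ ys → length ys ≤ length r → Avoids plain ys → Σ₃ w ys ≤ F (length ys)
    shorter {x} {r} π ys le =
      ih ys (subst (length ys ≤_) (sym (↭-length π)) (m≤n⇒m≤1+n le))

    -- The vertex `x` joins the core. A further vertex sends at most one edge into these six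
    -- vertices, or two if it is itself `outer`; in the latter case it lies in no edge avoiding the
    -- core, as `peel` demands.
    with-outer : ∀ x r → us ↭ x ∷ r → 1 ≤ outer x → Σ₃ w (Q ++ us) ≤ G (5 + length us)
    with-outer x r π ox = with-vertex π (peel (Q ++ x ∷ []) r (pos ∘ outer) (A↭ π)
      (search-bound 6 (A↭ π) double-facts [] (outer′ 5 ∷ []) (c₃ Q₆) 8
        (abc ∷ apq ∷ bpq ∷ []) [] (ox ∷ []))
      single
      (λ t u s ρ → search-bound 8 (A↭ (↭-trans π (prep x ρ)))
        double-facts [] (outer′ 5 ∷ []) (c₁ 6 7 Q₆) 0
        (abc ∷ apq ∷ bpq ∷ []) [] (ox ∷ []))
      (λ t u s r′ ρ ot → search-bound 9 (A↭ (↭-trans π (prep x ρ)))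
        double-facts [] (outer′ 6 ∷ []) (c₀ 6 7 8) 0
        (abc ∷ apq ∷ bpq ∷ []) [] (pos⁺ ot ∷ []))
      (shorter π))
      where
      single : ∀ t s → r ↭ t ∷ s → Σ₂ (w t) (Q ++ x ∷ []) ≤ 1 + bit (pos (outer t))
      single t s ρ with outer t in eq
      ... | zero  = search-bound 7 (A↭ (↭-trans π (prep x ρ)))
        double-facts (outer′ 6 ∷ []) (outer′ 5 ∷ []) (c₂ 6 Q₆) 1
        (abc ∷ apq ∷ bpq ∷ []) (≤-reflexive eq ∷ []) (ox ∷ [])
      ... | suc _ = search-bound 7 (A↭ (↭-trans π (prep x ρ)))
        double-facts [] (outer′ 5 ∷ []) (c₂ 6 Q₆) 2
        (abc ∷ apq ∷ bpq ∷ []) [] (ox ∷ [])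

    module _ (no-outer : ∀ t r → us ↭ t ∷ r → outer t ≤ 0) where

      no-outer₁ : ∀ {x r t s} → us ↭ x ∷ r → r ↭ t ∷ s → outer t ≤ 0
      no-outer₁ {x} π ρ = no-outer _ _ (↭-trans π (pick-tail ρ))

      no-outer₂ : ∀ {x r t u s} → us ↭ x ∷ r → r ↭ t ∷ u ∷ s → outer u ≤ 0
      no-outer₂ {x} π ρ = no-outer₁ π (↭-trans ρ (swap _ _ reflₚ))

      -- A page together with an inner edge keeps the core enlarged by `y` at eight edges, so that
      -- `peel` applies again, now with the page vertices marked.
      with-inner : ∀ y r → us ↭ y ∷ r → 1 ≤ page y → 1 ≤ inner →
        Σ₃ w (Q ++ us) ≤ G (5 + length us)
      with-inner y r π py in₀ = with-vertex π (peel (Q ++ y ∷ []) r (pos ∘ page) (A↭ π)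
        (search-bound 6 (A↭ π) double-facts (outer′ 5 ∷ []) (c₀ 3 4 5 ∷ inner′ ∷ []) (c₃ Q₆) 8
          (abc ∷ apq ∷ bpq ∷ []) (no-outer y r π ∷ []) (py ∷ in₀ ∷ []))
        (λ t s ρ → ≤-trans
          (search-bound 7 (A↭ (↭-trans π (prep y ρ))) double-facts
            (outer′ 5 ∷ outer′ 6 ∷ []) (c₀ 3 4 5 ∷ inner′ ∷ []) (c₂ 6 Q₆) 1
            (abc ∷ apq ∷ bpq ∷ []) (no-outer y r π ∷ no-outer₁ π ρ ∷ []) (py ∷ in₀ ∷ []))
          (m≤m+n 1 _))
        (λ t u s ρ → search-bound 8 (A↭ (↭-trans π (prep y ρ))) double-facts
          (outer′ 5 ∷ outer′ 6 ∷ outer′ 7 ∷ []) (c₀ 3 4 5 ∷ inner′ ∷ []) (c₁ 6 7 Q₆) 0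
          (abc ∷ apq ∷ bpq ∷ [])
          (no-outer y r π ∷ no-outer₁ π ρ ∷ no-outer₂ π ρ ∷ []) (py ∷ in₀ ∷ []))
        (λ t u s r′ ρ pt → search-bound 9 (A↭ (↭-trans π (prep y ρ))) double-facts
          (outer′ 6 ∷ []) (c₀ 3 4 6 ∷ inner′ ∷ []) (c₀ 6 7 8) 0
          (abc ∷ apq ∷ bpq ∷ [])
          (no-outer₁ π ρ ∷ []) (pos⁺ pt ∷ in₀ ∷ []))
        (shorter π))

      pairs : ∀ t u r → us ↭ t ∷ u ∷ r → Σ₁ (w t u) Q ≤ 0
      pairs t u r π = search-bound 7 (A↭ π) double-facts (outer′ 5 ∷ outer′ 6 ∷ []) []
        (c₁ 5 6 Q₅) 0 (abc ∷ apq ∷ bpq ∷ [])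
        (no-outer t _ π ∷ no-outer u _ (↭-trans π (swap t u reflₚ)) ∷ []) []

      rest : Σ₃ w us ≤ F (length us)
      rest = ih us ≤-refl (Avoids-++ʳ Q A)

      -- Without the six inner triples only abc, apq, bpq and cpq remain inside the core, and an
      -- outside vertex can meet the core only in its page.
      without-inner : inner ≤ 0 → Σ₃ w (Q ++ us) ≤ G (5 + length us)
      without-inner in₀ = ≤-trans
        (assemble Q us
          (search-bound 5 A double-facts (inner′ ∷ []) [] (c₃ Q₅) 4
            (abc ∷ apq ∷ bpq ∷ []) (in₀ ∷ []) [])
          (Σ₁-≤1 us λ t r π → search-bound 6 (A↭ π) double-facts (outer′ 5 ∷ []) []
            (c₂ 5 Q₅) 1 (abc ∷ apq ∷ bpq ∷ []) (no-outer t r π ∷ []) [])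
          pairs rest)
        (4+m+F≤G (length us) 1≤us)

      -- No edge leaves the core, which may then contain all of its ten triples.
      without-page : (∀ t r → us ↭ t ∷ r → page t ≤ 0) →
        Σ₃ w (Q ++ us) ≤ G (5 + length us)
      without-page no-page = ≤-trans
        (assemble Q us
          (search-bound 5 A [] [] [] (c₃ Q₅) 10 [] [] [])
          (Σ₁-0 us λ t r π → search-bound 6 (A↭ π) double-facts
            (outer′ 5 ∷ c₀ 3 4 5 ∷ []) []
            (c₂ 5 Q₅) 0 (abc ∷ apq ∷ bpq ∷ []) (no-outer t r π ∷ no-page t r π ∷ []) [])
          pairs rest)
        (10+F≤G (length us) 1≤us)

      no-outer-cases : Σ₃ w (Q ++ us) ≤ G (5 + length us)
      no-outer-cases with find page us
      ... | inj₂ no-page = without-page no-page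
      ... | inj₁ (y , r , π , py) with n≤0⊎1≤n inner
      ...   | inj₁ in₀ = without-inner in₀
      ...   | inj₂ in₁ = with-inner y r π py in₁

    cases : (Σ[ t ∈ V ] Σ[ r ∈ List V ] (us ↭ t ∷ r × 1 ≤ outer t))
      ⊎ (∀ t r → us ↭ t ∷ r → outer t ≤ 0) → Σ₃ w (Q ++ us) ≤ G (5 + length us)
    cases (inj₁ (x , r , π , ox)) = with-outer x r π ox
    cases (inj₂ no-outer)         = no-outer-cases no-outer

  -- The edges of E ++ Q that meet E, and those of E ++ Q ++ (t ∷ u ∷ []) that
  -- meet E and contain exactly the vertices t, respectively t and u, outside E ++ Q.
  meet : List V → List V → ℕ
  meet []      Q = 0
  meet (x ∷ E) Q = Σ₂ (w x) (E ++ Q) + meet E Q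

  meet₁ : List V → List V → V → ℕ
  meet₁ []      Q t = 0
  meet₁ (x ∷ E) Q t = Σ₁ (w x t) (E ++ Q) + meet₁ E Q t

  meet₂ : List V → V → V → ℕ
  meet₂ []      t u = 0
  meet₂ (x ∷ E) t u = w x t u + meet₂ E t u

  Σ₃-meet : ∀ E Q → Σ₃ w (E ++ Q) ≡ meet E Q + Σ₃ w Q
  Σ₃-meet []      Q = refl
  Σ₃-meet (x ∷ E) Q =
    trans (cong (Σ₂ (w x) (E ++ Q) +_) (Σ₃-meet E Q)) (sym (+-assoc (Σ₂ (w x) (E ++ Q)) _ _))

  meet-++ : ∀ E Q us → (∀ t u r → us ↭ t ∷ u ∷ r → meet₂ E t u ≤ 0) →
    meet E (Q ++ us) ≤ meet E Q + Σ₁ (meet₁ E Q) us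
  meet-++ []      Q us pairs = z≤n
  meet-++ (x ∷ E) Q us pairs = begin
    Σ₂ (w x) (E ++ (Q ++ us)) + meet E (Q ++ us)
      ≡⟨ cong (λ l → Σ₂ (w x) l + meet E (Q ++ us)) (++-assoc E Q us) ⟨
    Σ₂ (w x) ((E ++ Q) ++ us) + meet E (Q ++ us)
      ≡⟨ cong (_+ meet E (Q ++ us)) (Σ₂-++ (swapʳ w-sym x) (E ++ Q) us) ⟩
    s + Σ₁ (λ t → Σ₁ (w x t) (E ++ Q)) us + Σ₂ (w x) us + meet E (Q ++ us)
      ≤⟨ +-mono-≤ (+-monoʳ-≤ (s + Σ₁ (λ t → Σ₁ (w x t) (E ++ Q)) us)
           (Σ₂-0 us λ t u r p → m+n≤o⇒m≤o _ (pairs t u r p)))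
           (meet-++ E Q us λ t u r p → m+n≤o⇒n≤o (w x t u) (pairs t u r p)) ⟩
    s + Σ₁ (λ t → Σ₁ (w x t) (E ++ Q)) us + 0 + (meet E Q + Σ₁ (meet₁ E Q) us)
      ≡⟨ ring s (Σ₁ (λ t → Σ₁ (w x t) (E ++ Q)) us) (meet E Q) _ ⟩
    s + meet E Q + (Σ₁ (λ t → Σ₁ (w x t) (E ++ Q)) us + Σ₁ (meet₁ E Q) us)
      ≡⟨ cong (s + meet E Q +_) (Σ₁-+ (λ t → Σ₁ (w x t) (E ++ Q)) (meet₁ E Q) us) ⟨
    s + meet E Q + Σ₁ (meet₁ (x ∷ E) Q) us ∎
    where
    open ≤-Reasoning
    s = Σ₂ (w x) (E ++ Q)
    ring : ∀ a b c d → a + b + 0 + (c + d) ≡ a + c + (b + d)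
    ring = solve-∀

  meet-bound : ∀ {K k} E Q us → meet E Q ≤ K →
    (∀ t r → us ↭ t ∷ r → meet₁ E Q t ≤ k) →
    (∀ t u r → us ↭ t ∷ u ∷ r → meet₂ E t u ≤ 0) →
    meet E (Q ++ us) ≤ K + length us * k
  meet-bound {k = k} E Q us inner single pairs =
    ≤-trans (meet-++ E Q us pairs) (+-mono-≤ inner (Σ₁-≤ k us single))

  -- Deletion of the vertices `E`. `Q` holds those remaining vertices that have to be named; each
  -- other vertex accounts for at most `k` of the lost edges.
  remove : ∀ {K k} E Q us → meet E Q ≤ K →
    (∀ t r → us ↭ t ∷ r → meet₁ E Q t ≤ k) →
    (∀ t u r → us ↭ t ∷ u ∷ r → meet₂ E t u ≤ 0) →
    Σ₃ w (E ++ (Q ++ us)) ≤ K + length us * k + Σ₃ w (Q ++ us)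
  remove E Q us inner single pairs =
    ≤-trans (≤-reflexive (Σ₃-meet E (Q ++ us)))
      (+-monoˡ-≤ _ (meet-bound E Q us inner single pairs))

  w≤1 : ∀ x y z → w x y z ≤ 1
  w≤1 x y z = bit≤1 (h x y z)

  -- Graphs without a matching.

  touchᵖ : Fun {V} 5
  touchᵖ v a b c d = h v a b ∧ h v c d

  edgeᵖ : Fun {V} 3
  edgeᵖ a b c = h a b c

  -- If two edges touch at `v`, no edge avoids `v`, and the pairs of other vertices bound the count.
  -- If no two edges touch, then, there being no matching, all edges meet a given one in at least
  -- two vertices: at most three further edges for each vertex outside it.
  star-bound : ∀ {M} → Avoids star M → 6 ≤ length M → Σ₃ w M ≤ tri (length M ∸ 1)
  star-bound {M} A 6≤M with pick? 5 touchᵖ M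
  ... | yes t
    with (v ∷ a ∷ b ∷ c ∷ d ∷ []) , us , π , e ← unpick 5 t
    with vab , vcd ← to (T-∧ {h v a b}) e = begin
      Σ₃ w M                            ≡⟨ Σ₃-↭ w-sym π ⟩
      Σ₂ (w v) R + Σ₃ w R               ≤⟨ +-mono-≤ (Σ₂-≤tri R (w≤1 v)) off ⟩
      tri (length R) + 0                ≡⟨ +-identityʳ _ ⟩
      tri (length R)                    ≡⟨ cong (λ k → tri (k ∸ 1)) (↭-length π) ⟨
      tri (length M ∸ 1)                ∎
    where
    open ≤-Reasoning

    R : List V
    R = a ∷ b ∷ c ∷ d ∷ us

    facts : List Tri
    facts = (0 , 1 , 2) ∷ (0 , 3 , 4) ∷ []

    four : List ℕ
    four = 1 ∷ 2 ∷ 3 ∷ 4 ∷ []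

    B : ∀ {vs} → us ↭ vs → Avoids star (v ∷ a ∷ b ∷ c ∷ d ∷ vs)
    B ρ = Avoids-↭ (↭-trans π (++⁺ˡ (v ∷ a ∷ b ∷ c ∷ d ∷ []) ρ)) A

    off : Σ₃ w R ≤ 0
    off = assemble (a ∷ b ∷ c ∷ d ∷ []) us
      (search-bound 5 (B reflₚ) facts [] [] (c₃ four) 0 (vab ∷ vcd ∷ []) [] [])
      (Σ₁-0 us λ t r ρ →
        search-bound 6 (B ρ) facts [] [] (c₂ 5 four) 0 (vab ∷ vcd ∷ []) [] [])
      (λ t u r ρ → search-bound 7 (B ρ) facts [] [] (c₁ 5 6 four) 0 (vab ∷ vcd ∷ []) [] [])
      (Σ₃-0 us λ t u s r ρ →
        search-bound 8 (B ρ) facts [] [] (c₀ 5 6 7) 0 (vab ∷ vcd ∷ []) [] [])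
  ... | no ¬touch with pick? 3 edgeᵖ M
  ...   | no ¬edge = ≤-trans
    (Σ₃-0 M λ t u s r π → bit⁻ λ e → ¬edge (t , _ , π , u , _ , reflₚ , s , r , reflₚ , e)) z≤n
  ...   | yes t with (a ∷ b ∷ c ∷ []) , us , π , abc ← unpick 3 t = begin
      Σ₃ w M                     ≡⟨ Σ₃-↭ w-sym π ⟩
      Σ₃ w (a ∷ b ∷ c ∷ us)      ≤⟨ assemble (a ∷ b ∷ c ∷ []) us
        (subst (_≤ 1) (sym (trans (+-identityʳ _) (trans (+-identityʳ _) (+-identityʳ _))))
          (bit≤1 (h a b c)))
        (Σ₁-≤ 3 us λ t _ _ → Σ₂-≤tri (a ∷ b ∷ c ∷ []) (w≤1 t))
        pairs
        (Σ₃-0 us λ t u s r ρ → bit⁻ λ e → Avoids.¬matching A _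
          (Pick-↭ 6 (↭-sym (↭-trans π (++⁺ˡ (a ∷ b ∷ c ∷ []) ρ)))
            (a , _ , reflₚ , b , _ , reflₚ , c , _ , reflₚ , t , _ , reflₚ , u , _ , reflₚ
              , s , _ , reflₚ , from T-∧ (abc , e)))) ⟩
      1 + length us * 3 + 0      ≤⟨ size (length us) (s≤s⁻¹ (s≤s⁻¹ (s≤s⁻¹
                                      (subst (6 ≤_) (↭-length π) 6≤M)))) ⟩
      tri (2 + length us)        ≡⟨ cong (λ k → tri (k ∸ 1)) (↭-length π) ⟨
      tri (length M ∸ 1)         ∎
    where
    open ≤-Reasoning
    -- Here k = n - 3. The inequality is an equality at k = 3 and fails at k = 1 and k = 2, so six
    -- vertices are required.
    size : ∀ k → 3 ≤ k → 1 + k * 3 + 0 ≤ tri (2 + k)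
    size (suc (suc (suc k))) _ = slack (2 * k + tri k) (ring k (tri k))
      where
      ring : ∀ k t → 4 + k + (3 + k + (2 + k + (1 + k + (k + t))))
        ≡ 1 + (3 + k) * 3 + 0 + (2 * k + t)
      ring = solve-∀
    size 2 (s≤s (s≤s ()))
    size 1 (s≤s ())

    pairs : ∀ t u r → us ↭ t ∷ u ∷ r → Σ₁ (w t u) (a ∷ b ∷ c ∷ []) ≤ 0
    pairs t u r ρ = +-mono-≤ {y = 0} {v = 0}
      (apart a reflₚ abc)
      (+-mono-≤ {y = 0} {v = 0}
        (apart b (swap a b reflₚ) (subst T (h-swapˡ a b c) abc))
        (+-mono-≤ {y = 0} {v = 0}
          (apart c (↭-trans (prep a (swap b c reflₚ)) (swap a c reflₚ))
            (subst T (trans (h-swapʳ a b c) (h-swapˡ a c b)) abc)) z≤n))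
      where
      N : List V
      N = a ∷ b ∷ c ∷ t ∷ u ∷ r

      apart : ∀ q {x y s} → N ↭ q ∷ x ∷ y ∷ t ∷ u ∷ s → T (h q x y) → w t u q ≤ 0
      apart q {x} {y} σ e = subst (_≤ 0) (w₃ q t u) (bit⁻ λ e′ → ¬touch
        (Pick-↭ 5 (↭-sym (↭-trans π (↭-trans (++⁺ˡ (a ∷ b ∷ c ∷ []) ρ) σ)))
          (q , _ , reflₚ , x , _ , reflₚ , y , _ , reflₚ , t , _ , reflₚ , u , _ , reflₚ
            , from T-∧ (e , e′))))

  -- Graphs with a matching but without doubles and hinges.

  -- Besides starting the count below, this settles six vertices on its own, where `G` is weaker
  -- because it admits a clique on five vertices.
  six : ∀ {μ a b c d e f} → Avoids μ (a ∷ b ∷ c ∷ d ∷ e ∷ f ∷ []) →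
    T (h a b c) → T (h d e f) → Σ₃ w (a ∷ b ∷ c ∷ d ∷ e ∷ f ∷ []) ≤ 8
  six A abc def =
    search-bound 6 (weaken A) ((0 , 1 , 2) ∷ (3 , 4 , 5) ∷ []) [] []
      (c₃ (0 ∷ 1 ∷ 2 ∷ 3 ∷ 4 ∷ 5 ∷ [])) 8 (abc ∷ def ∷ []) [] []

  module _ {a b c d e f : V} (abc : T (h a b c)) (def : T (h d e f)) where

    private
      S : List V
      S = a ∷ b ∷ c ∷ d ∷ e ∷ f ∷ []

      S′ : List ℕ
      S′ = 0 ∷ 1 ∷ 2 ∷ 3 ∷ 4 ∷ 5 ∷ []

      two three : List Tri
      two = (0 , 1 , 2) ∷ (3 , 4 , 5) ∷ []
      three = (0 , 1 , 2) ∷ (3 , 4 , 5) ∷ (6 , 7 , 8) ∷ []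

    -- Without doubles the core of the matching has at most six edges, two below the value 8 of the
    -- bound. This surplus is what `Σ₁-≤2+2n` uses up: two outside vertices may jointly send six
    -- edges into the core, but three only eight. One outside vertex is too few for that lemma and
    -- is searched directly.
    spread-no-inner : ∀ us → Avoids spread (S ++ us) →
      (∀ t u s r → us ↭ t ∷ u ∷ s ∷ r → w t u s ≤ 0) →
      Σ₃ w (S ++ us) ≤ 8 + 2 * length us
    spread-no-inner []        A none = six A abc def
    spread-no-inner (t ∷ [])  A none =
      search-bound 7 A two [] [] (c₃ (0 ∷ 1 ∷ 2 ∷ 3 ∷ 4 ∷ 5 ∷ 6 ∷ [])) 10
        (abc ∷ def ∷ []) [] []
    spread-no-inner us@(_ ∷ _ ∷ us′) A none = ≤-trans
      (assemble S us
        (search-bound 6 A two [] [] (c₃ S′) 6 (abc ∷ def ∷ []) [] [])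
        (Σ₁-≤2+2n (λ t → Σ₂ (w t) S) (length us′) us refl
          (λ t u r π → search-bound 8 (A↭ π) two [] [] (c₂ 6 S′ ⊕ c₂ 7 S′) 6
            (abc ∷ def ∷ []) [] [])
          (λ t u s r π → search-bound 9 (A↭ π) two [] [] (c₂ 6 S′ ⊕ c₂ 7 S′ ⊕ c₂ 8 S′) 8
            (abc ∷ def ∷ []) [] []))
        (λ t u r π → search-bound 8 (A↭ π) two [] [] (c₁ 6 7 S′) 0 (abc ∷ def ∷ []) [] [])
        (Σ₃-0 us none))
      (≤-reflexive (+-identityʳ _))
      where
      A↭ : ∀ {vs} → us ↭ vs → Avoids spread (S ++ vs)
      A↭ π = Avoids-↭ (++⁺ˡ S π) A

    -- An edge x y z disjoint from a b c and d e f is met by no edge in exactly one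
    -- vertex, and the edges meeting it span only four vertices or share a pair.
    module _ (n : ℕ)
      (ih : ∀ us → length us < n → Avoids spread (S ++ us) →
            Σ₃ w (S ++ us) ≤ 8 + 2 * length us) where

      -- The bound grows by two per vertex, so deleting `j` vertices pays for `2 * j` edges.
      shrink : ∀ j K l m → K ≤ 2 * j → K + l * 0 + (8 + 2 * m) ≤ 8 + 2 * (j + m)
      shrink j K l m K≤2j = begin
        K + l * 0 + (8 + 2 * m)  ≡⟨ cong (λ z → K + z + (8 + 2 * m)) (*-zeroʳ l) ⟩
        K + 0 + (8 + 2 * m)      ≤⟨ +-monoˡ-≤ (8 + 2 * m) (+-monoˡ-≤ 0 K≤2j) ⟩
        2 * j + 0 + (8 + 2 * m)  ≡⟨ ring j m ⟩
        8 + 2 * (j + m)          ∎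
        where
        open ≤-Reasoning
        ring : ∀ j m → 2 * j + 0 + (8 + 2 * m) ≡ 8 + 2 * (j + m)
        ring = solve-∀

      -- If xzt and yzt are both absent, xyz is the only edge at `z`, and deleting `z` suffices.
      -- Otherwise the edges meeting x, y or z number at most the four triples of x, y, z, t, and
      -- deleting the three vertices pays for six.
      spread-page : ∀ {x y z t r} → Avoids spread (S ++ x ∷ y ∷ z ∷ t ∷ r) →
        4 + length r ≤ n → T (h x y z) → T (h x y t) →
        Σ₃ w (S ++ x ∷ y ∷ z ∷ t ∷ r) ≤ 8 + 2 * (4 + length r)
      spread-page {x} {y} {z} {t} {r} A le xyz xyt = go (n≤0⊎1≤n (w x z t + w y z t))
        where
        facts : List Tri
        facts = three ++ (6 , 7 , 9) ∷ []

        A↭ : ∀ {vs} → r ↭ vs → Avoids spread (S ++ x ∷ y ∷ z ∷ t ∷ vs)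
        A↭ π = Avoids-↭ (++⁺ˡ (S ++ x ∷ y ∷ z ∷ t ∷ []) π) A

        σ : S ++ x ∷ y ∷ z ∷ t ∷ r ↭ z ∷ S ++ x ∷ y ∷ t ∷ r
        σ = shift z (S ++ x ∷ y ∷ []) (t ∷ r)

        τ : S ++ x ∷ y ∷ z ∷ t ∷ r ↭ x ∷ y ∷ z ∷ S ++ t ∷ r
        τ = shifts S (x ∷ y ∷ z ∷ []) {t ∷ r}

        go : w x z t + w y z t ≤ 0 ⊎ 1 ≤ w x z t + w y z t →
          Σ₃ w (S ++ x ∷ y ∷ z ∷ t ∷ r) ≤ 8 + 2 * (4 + length r)
        go (inj₁ zt≤0) = begin
          Σ₃ w (S ++ x ∷ y ∷ z ∷ t ∷ r)
            ≡⟨ Σ₃-↭ w-sym σ ⟩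
          Σ₃ w (z ∷ S ++ x ∷ y ∷ t ∷ r)
            ≤⟨ remove {1} {0} (z ∷ []) (S ++ x ∷ y ∷ t ∷ []) r
                 (search-bound 10 A facts (c₀ 6 8 9 ⊕ c₀ 7 8 9 ∷ []) []
                   (c₂ 8 (S′ ++ 6 ∷ 7 ∷ 9 ∷ []) ⊕ c∅) 1 (abc ∷ def ∷ xyz ∷ xyt ∷ []) (zt≤0 ∷ []) [])
                 (λ u s ρ → search-bound 11 (A↭ ρ) facts [] []
                   (c₁ 8 10 (S′ ++ 6 ∷ 7 ∷ 9 ∷ []) ⊕ c∅) 0 (abc ∷ def ∷ xyz ∷ xyt ∷ []) [] [])
                 (λ u u′ s ρ → search-bound 12 (A↭ ρ) facts [] []
                   (c₀ 8 10 11 ⊕ c∅) 0 (abc ∷ def ∷ xyz ∷ xyt ∷ []) [] []) ⟩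
          1 + length r * 0 + Σ₃ w (S ++ x ∷ y ∷ t ∷ r)
            ≤⟨ +-monoʳ-≤ (1 + length r * 0) (ih (x ∷ y ∷ t ∷ r) le (Avoids-tail (Avoids-↭ σ A))) ⟩
          1 + length r * 0 + (8 + 2 * (3 + length r))
            ≤⟨ shrink 1 1 (length r) (3 + length r) (s≤s z≤n) ⟩
          8 + 2 * (4 + length r) ∎
          where open ≤-Reasoning
        go (inj₂ zt≥1) = begin
          Σ₃ w (S ++ x ∷ y ∷ z ∷ t ∷ r)
            ≡⟨ Σ₃-↭ w-sym τ ⟩
          Σ₃ w (x ∷ y ∷ z ∷ S ++ t ∷ r)
            ≤⟨ remove {4} {0} (x ∷ y ∷ z ∷ []) (S ++ t ∷ []) r
                 (search-bound 10 A facts [] (c₀ 6 8 9 ⊕ c₀ 7 8 9 ∷ [])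
                   (c₂ 6 (7 ∷ 8 ∷ S′ ++ 9 ∷ []) ⊕ c₂ 7 (8 ∷ S′ ++ 9 ∷ [])
                     ⊕ c₂ 8 (S′ ++ 9 ∷ []) ⊕ c∅) 4 (abc ∷ def ∷ xyz ∷ xyt ∷ []) [] (zt≥1 ∷ []))
                 (λ u s ρ → search-bound 11 (A↭ ρ) facts [] (c₀ 6 8 9 ⊕ c₀ 7 8 9 ∷ [])
                   (c₁ 6 10 (7 ∷ 8 ∷ S′ ++ 9 ∷ []) ⊕ c₁ 7 10 (8 ∷ S′ ++ 9 ∷ [])
                     ⊕ c₁ 8 10 (S′ ++ 9 ∷ []) ⊕ c∅) 0 (abc ∷ def ∷ xyz ∷ xyt ∷ []) [] (zt≥1 ∷ []))
                 (λ u u′ s ρ → search-bound 12 (A↭ ρ) facts [] []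
                   (c₀ 6 10 11 ⊕ c₀ 7 10 11 ⊕ c₀ 8 10 11 ⊕ c∅) 0 (abc ∷ def ∷ xyz ∷ xyt ∷ []) [] []) ⟩
          4 + length r * 0 + Σ₃ w (S ++ t ∷ r)
            ≤⟨ +-monoʳ-≤ (4 + length r * 0) (ih (t ∷ r) (≤-trans (m≤n+m _ 2) le)
                 (Avoids-++ʳ (x ∷ y ∷ z ∷ []) (Avoids-↭ τ A))) ⟩
          4 + length r * 0 + (8 + 2 * (1 + length r))
            ≤⟨ shrink 3 4 (length r) (1 + length r) (≤ᵇ⇒≤ 4 6 _) ⟩
          8 + 2 * (4 + length r) ∎
          where open ≤-Reasoning

      -- An edge sharing a pair with xyz leads to `spread-page` after renaming. If there is none,
      -- xyz is the only edge meeting its three vertices, and these are deleted.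
      spread-inner : ∀ {x y z r} → Avoids spread (S ++ x ∷ y ∷ z ∷ r) →
        3 + length r ≤ n → T (h x y z) →
        Σ₃ w (S ++ x ∷ y ∷ z ∷ r) ≤ 8 + 2 * (3 + length r)
      spread-inner {x} {y} {z} {r} A le xyz = go
        (find (w x y) r) (find (w x z) r) (find (w y z) r)
        where
        Page : V → V → Set
        Page x y = (Σ[ t ∈ V ] Σ[ s ∈ List V ] (r ↭ t ∷ s × 1 ≤ w x y t))
          ⊎ (∀ t s → r ↭ t ∷ s → w x y t ≤ 0)

        page : ∀ {x′ y′ z′} → x ∷ y ∷ z ∷ [] ↭ x′ ∷ y′ ∷ z′ ∷ [] → T (h x′ y′ z′) →
          Σ[ t ∈ V ] Σ[ s ∈ List V ] (r ↭ t ∷ s × 1 ≤ w x′ y′ t) →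
          Σ₃ w (S ++ x ∷ y ∷ z ∷ r) ≤ 8 + 2 * (3 + length r)
        page {x′} {y′} {z′} π xyz′ (t , s , ρ , xyt) =
          subst₂ _≤_ (sym (Σ₃-↭ w-sym σ)) (cong (λ k → 8 + 2 * (3 + k)) (sym (↭-length ρ)))
            (spread-page (Avoids-↭ σ A) (subst (λ k → 3 + k ≤ n) (↭-length ρ) le) xyz′ (bit-T xyt))
          where
          σ : S ++ x ∷ y ∷ z ∷ r ↭ S ++ x′ ∷ y′ ∷ z′ ∷ t ∷ s
          σ = ++⁺ˡ S (↭-trans (++⁺ʳ r π) (++⁺ˡ (x′ ∷ y′ ∷ z′ ∷ []) ρ))

        τ : S ++ x ∷ y ∷ z ∷ r ↭ x ∷ y ∷ z ∷ S ++ r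
        τ = shifts S (x ∷ y ∷ z ∷ []) {r}

        A↭ : ∀ {vs} → r ↭ vs → Avoids spread (S ++ x ∷ y ∷ z ∷ vs)
        A↭ π = Avoids-↭ (++⁺ˡ (S ++ x ∷ y ∷ z ∷ []) π) A

        go : Page x y → Page x z → Page y z →
          Σ₃ w (S ++ x ∷ y ∷ z ∷ r) ≤ 8 + 2 * (3 + length r)
        go (inj₁ p) _ _ = page reflₚ xyz p
        go (inj₂ _) (inj₁ p) _ =
          page (prep x (swap y z reflₚ)) (subst T (h-swapʳ x y z) xyz) p
        go (inj₂ _) (inj₂ _) (inj₁ p) =
          page (↭-trans (swap x y reflₚ) (prep y (swap x z reflₚ)))
            (subst T (trans (h-swapˡ x y z) (h-swapʳ y x z)) xyz) p
        go (inj₂ xy) (inj₂ xz) (inj₂ yz) = begin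
          Σ₃ w (S ++ x ∷ y ∷ z ∷ r)
            ≡⟨ Σ₃-↭ w-sym τ ⟩
          Σ₃ w (x ∷ y ∷ z ∷ S ++ r)
            ≤⟨ remove {1} {0} (x ∷ y ∷ z ∷ []) S r
                 (search-bound 9 A three [] []
                   (c₂ 6 (7 ∷ 8 ∷ S′) ⊕ c₂ 7 (8 ∷ S′) ⊕ c₂ 8 S′ ⊕ c∅) 1
                   (abc ∷ def ∷ xyz ∷ []) [] [])
                 (λ u s ρ → search-bound 10 (A↭ ρ) three
                   (c₀ 6 7 9 ∷ c₀ 6 8 9 ∷ c₀ 7 8 9 ∷ []) []
                   (c₁ 6 9 (7 ∷ 8 ∷ S′) ⊕ c₁ 7 9 (8 ∷ S′) ⊕ c₁ 8 9 S′ ⊕ c∅) 0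
                   (abc ∷ def ∷ xyz ∷ []) (xy u s ρ ∷ xz u s ρ ∷ yz u s ρ ∷ []) [])
                 (λ u u′ s ρ → search-bound 11 (A↭ ρ) three [] []
                   (c₀ 6 9 10 ⊕ c₀ 7 9 10 ⊕ c₀ 8 9 10 ⊕ c∅) 0
                   (abc ∷ def ∷ xyz ∷ []) [] []) ⟩
          1 + length r * 0 + Σ₃ w (S ++ r)
            ≤⟨ +-monoʳ-≤ (1 + length r * 0) (ih r (≤-trans (m≤n+m _ 2) le)
                 (Avoids-++ʳ (x ∷ y ∷ z ∷ []) (Avoids-↭ τ A))) ⟩
          1 + length r * 0 + (8 + 2 * length r)
            ≤⟨ shrink 3 1 (length r) (length r) (s≤s z≤n) ⟩
          8 + 2 * (3 + length r) ∎
          where open ≤-Reasoning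

    spread-bound : ∀ n us → length us < n → Avoids spread (S ++ us) →
      Σ₃ w (S ++ us) ≤ 8 + 2 * length us
    spread-bound (suc n) us (s≤s us≤n) A with pick? 3 edgeᵖ us
    ... | no none = spread-no-inner us A λ t u s r π → bit⁻ λ e →
      none (t , _ , π , u , _ , reflₚ , s , _ , reflₚ , e)
    ... | yes found with (x ∷ y ∷ z ∷ []) , r , π , xyz ← unpick 3 found =
      subst₂ _≤_ (sym (Σ₃-↭ w-sym (++⁺ˡ S π))) (cong (λ k → 8 + 2 * k) (sym (↭-length π)))
        (spread-inner n (spread-bound n) (Avoids-↭ (++⁺ˡ S π) A)
          (subst (_≤ n) (↭-length π) us≤n) xyz)

  -- Graphs with a hinge.

  module _ {v a b c d x y z : V} (vab : T (h v a b)) (vcd : T (h v c d)) (xyz : T (h x y z))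
    where

    private
      Q₇ Q₈ : List V
      Q₇ = a ∷ b ∷ c ∷ d ∷ x ∷ y ∷ z ∷ []
      Q₈ = v ∷ Q₇

      R₇ R₈ : List ℕ
      R₇ = 1 ∷ 2 ∷ 3 ∷ 4 ∷ 5 ∷ 6 ∷ 7 ∷ []
      R₈ = 0 ∷ R₇

      facts : List Tri
      facts = (0 , 1 , 2) ∷ (0 , 3 , 4) ∷ (5 , 6 , 7) ∷ []

    -- In case of equality x y z is the only edge avoiding v.
    CometBound : List V → Set
    CometBound us =
        Σ₃ w (Q₈ ++ us) ≤ 4 + tri (4 + length us)
      × (4 + tri (4 + length us) ≤ Σ₃ w (Q₈ ++ us) → Σ₃ w (Q₇ ++ us) ≤ 1)

    strictly : ∀ us → Σ₃ w (Q₈ ++ us) ≤ 3 + tri (4 + length us) → CometBound us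
    strictly us le = m≤n⇒m≤1+n le , λ ge → contradiction (≤-trans ge le) 1+n≰n

    -- The bound for `us` exceeds that for `r` by `4 + length r`, so this many edges at `u` are
    -- affordable. One fewer makes the bound strict (`loose`). Exactly that many are harmless if
    -- every edge at `u` contains `v` (`tight`), because the equality clause then passes from `r` to
    -- `us`.
    module Delete {us u r} (π : us ↭ u ∷ r) (A : Avoids nodouble (Q₈ ++ us))
      (bound : CometBound r) where

      A↭ : ∀ {vs} → r ↭ vs → Avoids nodouble (Q₈ ++ u ∷ vs)
      A↭ ρ = Avoids-↭ (++⁺ˡ Q₈ (↭-trans π (prep u ρ))) A

      removed : ∀ Q → Σ₃ w (Q ++ us) ≡ meet (u ∷ []) (Q ++ r) + Σ₃ w (Q ++ r)
      removed Q = trans (Σ₃-↭ w-sym (↭-trans (++⁺ˡ Q π) (shift u Q r)))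
        (Σ₃-meet (u ∷ []) (Q ++ r))

      ring : ∀ k r t → k + r + (4 + t) ≡ k + (4 + r + t)
      ring k r t = trans (+-assoc k r (4 + t)) (cong (k +_) (swap′ r t))
        where
        swap′ : ∀ r t → r + (4 + t) ≡ 4 + r + t
        swap′ = solve-∀

      loose : meet (u ∷ []) (Q₈ ++ r) ≤ 3 + length r → CometBound us
      loose deg = strictly us (begin
        Σ₃ w (Q₈ ++ us)                              ≡⟨ removed Q₈ ⟩
        meet (u ∷ []) (Q₈ ++ r) + Σ₃ w (Q₈ ++ r)     ≤⟨ +-mono-≤ deg (proj₁ bound) ⟩
        3 + length r + (4 + tri (4 + length r))      ≡⟨ ring 3 (length r) _ ⟩
        3 + tri (5 + length r)                       ≡⟨ cong (λ k → 3 + tri (4 + k)) (↭-length π) ⟨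
        3 + tri (4 + length us)                      ∎)
        where open ≤-Reasoning

      tight : meet (u ∷ []) (Q₈ ++ r) ≤ 4 + length r → meet (u ∷ []) (Q₇ ++ r) ≤ 0 →
        CometBound us
      tight deg off =
        subst₂ (λ e k → e ≤ 4 + tri (4 + k)) (sym (removed Q₈)) (sym (↭-length π)) (begin
          meet (u ∷ []) (Q₈ ++ r) + Σ₃ w (Q₈ ++ r)   ≤⟨ +-mono-≤ deg (proj₁ bound) ⟩
          4 + length r + (4 + tri (4 + length r))    ≡⟨ ring 4 (length r) _ ⟩
          4 + tri (5 + length r)                     ∎)
        -- Since `deg` is at most the growth of the bound, equality for `us` forces equality for
        -- `r`.
        , λ ge → subst (_≤ 1) (sym (removed Q₇)) (+-mono-≤ off (proj₂ bound
            (+-cancelˡ-≤ (4 + length r) _ _ (begin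
              4 + length r + (4 + tri (4 + length r))   ≡⟨ ring 4 (length r) _ ⟩
              4 + tri (5 + length r)
                ≡⟨ cong (λ k → 4 + tri (4 + k)) (↭-length π) ⟨
              4 + tri (4 + length us)                   ≤⟨ ge ⟩
              Σ₃ w (Q₈ ++ us)                           ≡⟨ removed Q₈ ⟩
              meet (u ∷ []) (Q₈ ++ r) + Σ₃ w (Q₈ ++ r)  ≤⟨ +-monoˡ-≤ _ deg ⟩
              4 + length r + Σ₃ w (Q₈ ++ r)             ∎))))
        where open ≤-Reasoning

      -- An edge at `u` inside `u` and `Q₇` avoids `v` and leaves `u` with at most three edges
      -- altogether. Without such an edge, every edge at `u` contains `v`.
      linked-to-base : 1 ≤ Σ₁ (w v u) Q₇ → CometBound us
      linked-to-base link = go (n≤0⊎1≤n (Σ₂ (w u) Q₇))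
        where
        pairs : ∀ t s r′ → r ↭ t ∷ s ∷ r′ → meet₂ (u ∷ []) t s ≤ 0
        pairs t s r′ ρ = search-bound 11 (A↭ ρ) facts [] (c₁ 0 8 R₇ ∷ [])
          (c₀ 8 9 10 ⊕ c∅) 0 (vab ∷ vcd ∷ xyz ∷ []) [] (link ∷ [])

        go : Σ₂ (w u) Q₇ ≤ 0 ⊎ 1 ≤ Σ₂ (w u) Q₇ → CometBound us
        go (inj₁ none) = tight
          (subst (λ k → meet (u ∷ []) (Q₈ ++ r) ≤ 4 + k) (*-identityʳ (length r))
            (meet-bound {4} {1} (u ∷ []) Q₈ r
              (search-bound 9 (A↭ reflₚ) facts (c₂ 8 R₇ ∷ []) (c₁ 0 8 R₇ ∷ [])
                (c₂ 8 R₈ ⊕ c∅) 4 (vab ∷ vcd ∷ xyz ∷ []) (none ∷ []) (link ∷ []))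
              (λ t r′ ρ → search-bound 10 (A↭ ρ) facts [] (c₁ 0 8 R₇ ∷ [])
                (c₁ 8 9 R₈ ⊕ c∅) 1 (vab ∷ vcd ∷ xyz ∷ []) [] (link ∷ []))
              pairs))
          (subst (meet (u ∷ []) (Q₇ ++ r) ≤_) (*-zeroʳ (length r))
            (meet-bound {0} {0} (u ∷ []) Q₇ r
              (subst (_≤ 0) (sym (+-identityʳ _)) none)
              (λ t r′ ρ → search-bound 10 (A↭ ρ) facts [] (c₁ 0 8 R₇ ∷ [])
                (c₁ 8 9 R₇ ⊕ c∅) 0 (vab ∷ vcd ∷ xyz ∷ []) [] (link ∷ []))
              pairs))
        go (inj₂ some) = loose (≤-trans
          (meet-bound {3} {0} (u ∷ []) Q₈ r
            (search-bound 9 (A↭ reflₚ) facts [] (c₁ 0 8 R₇ ∷ c₂ 8 R₇ ∷ [])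
              (c₂ 8 R₈ ⊕ c∅) 3 (vab ∷ vcd ∷ xyz ∷ []) [] (link ∷ some ∷ []))
            (λ t r′ ρ → search-bound 10 (A↭ ρ) facts [] (c₁ 0 8 R₇ ∷ c₂ 8 R₇ ∷ [])
              (c₁ 8 9 R₈ ⊕ c∅) 0 (vab ∷ vcd ∷ xyz ∷ []) [] (link ∷ some ∷ []))
            pairs)
          (+-monoʳ-≤ 3 (≤-trans (≤-reflexive (*-zeroʳ (length r))) z≤n)))

    -- A page is an edge containing `u` and `u′` but not `v`; its third vertex lies in `Q₇` or in
    -- `r`. Either kind costs `u` enough edges through `v` to make the bound strict, and without
    -- pages all edges at `u` contain `v`.
    module DeleteLinked {us u u′ r} (π : us ↭ u ∷ u′ ∷ r) (A : Avoids nodouble (Q₈ ++ us))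
      (bound : CometBound (u′ ∷ r)) (link : T (h v u u′)) where

      open Delete π A bound

      A↭′ : ∀ {vs} → r ↭ vs → Avoids nodouble (Q₈ ++ u ∷ u′ ∷ vs)
      A↭′ ρ = A↭ (prep u′ ρ)

      facts′ : List Tri
      facts′ = facts ++ (0 , 8 , 9) ∷ []

      R₉ : List ℕ
      R₉ = R₈ ++ 9 ∷ []

      pairs : ∀ t s r′ → r ↭ t ∷ s ∷ r′ → meet₂ (u ∷ []) t s ≤ 0
      pairs t s r′ ρ = search-bound 12 (A↭′ ρ) facts′ [] []
        (c₀ 8 10 11 ⊕ c∅) 0 (vab ∷ vcd ∷ xyz ∷ link ∷ []) [] []

      page-at-base : 1 ≤ Σ₁ (w u u′) Q₇ → CometBound us
      page-at-base page = loose (subst (λ k → meet (u ∷ []) (Q₈ ++ u′ ∷ r) ≤ 4 + k)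
        (*-identityʳ (length r))
        (meet-bound {4} {1} (u ∷ []) (Q₈ ++ u′ ∷ []) r
          (search-bound 10 (A↭′ reflₚ) facts′ [] (c₁ 8 9 R₇ ∷ [])
            (c₂ 8 R₉ ⊕ c∅) 4 (vab ∷ vcd ∷ xyz ∷ link ∷ []) [] (page ∷ []))
          (λ t r′ ρ → search-bound 11 (A↭′ ρ) facts′ [] (c₁ 8 9 R₇ ∷ [])
            (c₁ 8 10 R₉ ⊕ c∅) 1 (vab ∷ vcd ∷ xyz ∷ link ∷ []) [] (page ∷ []))
          pairs))

      page-outside : ∀ t s → r ↭ t ∷ s → 1 ≤ w u u′ t → CometBound us
      page-outside t s ρ page = loose (begin
        meet (u ∷ []) (Q₈ ++ u′ ∷ r)      ≡⟨ cong (_+ 0) (Σ₂-↭ (swapʳ w-sym u)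
                                               (++⁺ˡ (Q₈ ++ u′ ∷ []) ρ)) ⟩
        meet (u ∷ []) (Q₈ ++ u′ ∷ t ∷ s)  ≤⟨ meet-bound {5} {1} (u ∷ []) (Q₈ ++ u′ ∷ t ∷ []) s
          (search-bound 11 (A↭′ ρ) facts″ [] []
            (c₂ 8 R₁₀ ⊕ c∅) 5 (vab ∷ vcd ∷ xyz ∷ link ∷ bit-T page ∷ []) [] [])
          (λ q r′ τ → search-bound 12 (A↭′ (↭-trans ρ (prep t τ))) facts″ [] []
            (c₁ 8 11 R₁₀ ⊕ c∅) 1 (vab ∷ vcd ∷ xyz ∷ link ∷ bit-T page ∷ []) [] [])
          (λ q q′ r′ τ → pairs q q′ (t ∷ r′) (↭-trans ρ (pick-tail₂ τ))) ⟩
        5 + length s * 1                  ≡⟨ cong (5 +_) (*-identityʳ (length s)) ⟩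
        5 + length s                      ≡⟨ cong (4 +_) (↭-length ρ) ⟨
        4 + length r                      ∎)
        where
        open ≤-Reasoning
        facts″ : List Tri
        facts″ = facts′ ++ (8 , 9 , 10) ∷ []
        R₁₀ : List ℕ
        R₁₀ = R₉ ++ 10 ∷ []

      no-page : Σ₁ (w u u′) Q₇ ≤ 0 → (∀ t s → r ↭ t ∷ s → w u u′ t ≤ 0) → CometBound us
      no-page none₀ none = tight
        (subst (λ k → meet (u ∷ []) (Q₈ ++ u′ ∷ r) ≤ 5 + k) (*-identityʳ (length r))
          (meet-bound {5} {1} (u ∷ []) (Q₈ ++ u′ ∷ []) r
            (search-bound 10 (A↭′ reflₚ) facts′ (c₁ 8 9 R₇ ∷ []) []
              (c₂ 8 R₉ ⊕ c∅) 5 (vab ∷ vcd ∷ xyz ∷ link ∷ []) (none₀ ∷ []) [])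
            (λ t r′ ρ → search-bound 11 (A↭′ ρ) facts′ (c₀ 8 9 10 ∷ []) []
              (c₁ 8 10 R₉ ⊕ c∅) 1 (vab ∷ vcd ∷ xyz ∷ link ∷ []) (none t r′ ρ ∷ []) [])
            pairs))
        (subst (meet (u ∷ []) (Q₇ ++ u′ ∷ r) ≤_) (*-zeroʳ (length r))
          (meet-bound {0} {0} (u ∷ []) (Q₇ ++ u′ ∷ []) r
            (search-bound 10 (A↭′ reflₚ) facts′ (c₁ 8 9 R₇ ∷ []) []
              (c₂ 8 (R₇ ++ 9 ∷ []) ⊕ c∅) 0 (vab ∷ vcd ∷ xyz ∷ link ∷ []) (none₀ ∷ []) [])
            (λ t r′ ρ → search-bound 11 (A↭′ ρ) facts′ (c₀ 8 9 10 ∷ []) []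
              (c₁ 8 10 (R₇ ++ 9 ∷ []) ⊕ c∅) 0 (vab ∷ vcd ∷ xyz ∷ link ∷ []) (none t r′ ρ ∷ []) [])
            pairs))

      linked : CometBound us
      linked with n≤0⊎1≤n (Σ₁ (w u u′) Q₇) | find (w u u′) r
      ... | inj₂ page  | _                        = page-at-base page
      ... | inj₁ none₀ | inj₁ (t , s , ρ , page)  = page-outside t s ρ page
      ... | inj₁ none₀ | inj₂ none                = no-page none₀ none

    private
      others : ℕ
      others = meet (a ∷ b ∷ c ∷ d ∷ []) (x ∷ y ∷ z ∷ [])

      others′ : Sum
      others′ = c₂ 1 (2 ∷ 3 ∷ 4 ∷ 5 ∷ 6 ∷ 7 ∷ []) ⊕ c₂ 2 (3 ∷ 4 ∷ 5 ∷ 6 ∷ 7 ∷ [])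
        ⊕ c₂ 3 (4 ∷ 5 ∷ 6 ∷ 7 ∷ []) ⊕ c₂ 4 (5 ∷ 6 ∷ 7 ∷ []) ⊕ c∅

    -- The value is `4 + tri 4`. An edge that avoids `v` and meets a, b, c or d (`others`) lowers
    -- the maximum to 9, so equality leaves xyz as the only edge avoiding `v`.
    eight : Avoids nodouble (Q₈ ++ []) → CometBound []
    eight A = search-bound 8 A facts [] [] (c₃ R₈) 10 (vab ∷ vcd ∷ xyz ∷ []) [] [] , only
      where
      only : 10 ≤ Σ₃ w (Q₈ ++ []) → Σ₃ w (Q₇ ++ []) ≤ 1
      only ge with n≤0⊎1≤n others
      ... | inj₂ some = contradiction
        (≤-trans ge (search-bound 8 A facts [] (others′ ∷ []) (c₃ R₈) 9
          (vab ∷ vcd ∷ xyz ∷ []) [] (some ∷ [])))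
        1+n≰n
      ... | inj₁ none = ≤-trans (≤-reflexive (Σ₃-meet (a ∷ b ∷ c ∷ d ∷ []) (x ∷ y ∷ z ∷ [])))
        (+-mono-≤ none
          (search-bound 8 A [] [] [] (c₃ (5 ∷ 6 ∷ 7 ∷ [])) 1 [] [] []))

    -- No edge at `v` leaves the eight vertices of the hinge, so a, b, c, d lie in few edges and can
    -- be deleted together: at most six within the named vertices and two more for each vertex of
    -- `r`. The sum with `rest` is exactly one below the comet.
    module Unlinked {u₀ r} (A : Avoids nodouble (Q₈ ++ u₀ ∷ r))
      (base : ∀ t s → u₀ ∷ r ↭ t ∷ s → Σ₁ (w v t) Q₇ ≤ 0)
      (pair : ∀ t t′ s → u₀ ∷ r ↭ t ∷ t′ ∷ s → w v t t′ ≤ 0)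
      (ih : ∀ ys → length ys ≤ 5 + length r → Avoids plain ys → Σ₃ w ys ≤ F (length ys))
      where

      σ : Q₈ ++ u₀ ∷ r ↭ a ∷ b ∷ c ∷ d ∷ v ∷ x ∷ y ∷ z ∷ u₀ ∷ r
      σ = ↭-sym (shift v (a ∷ b ∷ c ∷ d ∷ []) (x ∷ y ∷ z ∷ u₀ ∷ r))

      A-rest : Avoids nodouble (v ∷ x ∷ y ∷ z ∷ u₀ ∷ r)
      A-rest = Avoids-++ʳ (a ∷ b ∷ c ∷ d ∷ []) (Avoids-↭ σ A)

      A↭ : ∀ {vs} → r ↭ vs → Avoids nodouble (Q₈ ++ u₀ ∷ vs)
      A↭ ρ = Avoids-↭ (++⁺ˡ (Q₈ ++ u₀ ∷ []) ρ) A

      links : Σ₂ (w v) (x ∷ y ∷ z ∷ u₀ ∷ r) ≤ 3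
      links = subst₂ _≤_ (+-identityʳ _) (cong (3 +_) (*-zeroʳ (1 + length r)))
        (meet-bound {3} {0} (v ∷ []) (x ∷ y ∷ z ∷ []) (u₀ ∷ r)
          (search-bound 8 A [] [] [] (c₂ 0 (5 ∷ 6 ∷ 7 ∷ []) ⊕ c∅) 3 [] [] [])
          (λ t s ρ → search-bound 9 (Avoids-↭ (++⁺ˡ Q₈ ρ) A) [] (c₁ 0 8 R₇ ∷ []) []
            (c₁ 0 8 (5 ∷ 6 ∷ 7 ∷ []) ⊕ c∅) 0 [] (base t s ρ ∷ []) [])
          (λ t t′ s ρ → subst (_≤ 0) (sym (+-identityʳ _)) (pair t t′ s ρ)))

      -- Applying `F` to the whole list suffices only for one vertex in `r`. For longer `r` the
      -- vertex `v`, with at most three of these edges, is split off, leaving at least six vertices.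
      -- For empty `r` three of the ten triples are excluded by `base`.
      rest : Σ₃ w (v ∷ x ∷ y ∷ z ∷ u₀ ∷ r) ≤ 4 + tri (3 + length r)
      rest = go r refl
        where
        go : ∀ s → r ≡ s → Σ₃ w (v ∷ x ∷ y ∷ z ∷ u₀ ∷ r) ≤ 4 + tri (3 + length r)
        go [] refl = search-bound 9 A [] (c₁ 0 8 R₇ ∷ []) []
          (c₃ (0 ∷ 5 ∷ 6 ∷ 7 ∷ 8 ∷ [])) 7 [] (base u₀ [] reflₚ ∷ []) []
        go (_ ∷ []) refl = ih (v ∷ x ∷ y ∷ z ∷ u₀ ∷ r) ≤-refl (weaken A-rest)
        go (_ ∷ _ ∷ s) refl = +-mono-≤ (m≤n⇒m≤1+n links)
          (ih (x ∷ y ∷ z ∷ u₀ ∷ r) (n≤1+n _) (weaken (Avoids-tail A-rest)))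

      unlinked : CometBound (u₀ ∷ r)
      unlinked = strictly (u₀ ∷ r) (begin
        Σ₃ w (Q₈ ++ u₀ ∷ r)
          ≡⟨ Σ₃-↭ w-sym σ ⟩
        Σ₃ w (a ∷ b ∷ c ∷ d ∷ v ∷ x ∷ y ∷ z ∷ u₀ ∷ r)
          ≤⟨ remove {6} {2} (a ∷ b ∷ c ∷ d ∷ []) (v ∷ x ∷ y ∷ z ∷ u₀ ∷ []) r
               (search-bound 9 A facts (c₁ 0 8 R₇ ∷ []) []
                 (c₂ 1 (2 ∷ 3 ∷ 4 ∷ 0 ∷ 5 ∷ 6 ∷ 7 ∷ 8 ∷ []) ⊕ c₂ 2 (3 ∷ 4 ∷ 0 ∷ 5 ∷ 6 ∷ 7 ∷ 8 ∷ [])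
                   ⊕ c₂ 3 (4 ∷ 0 ∷ 5 ∷ 6 ∷ 7 ∷ 8 ∷ []) ⊕ c₂ 4 (0 ∷ 5 ∷ 6 ∷ 7 ∷ 8 ∷ []) ⊕ c∅) 6
                 (vab ∷ vcd ∷ xyz ∷ []) (base u₀ r reflₚ ∷ []) [])
               (λ t s ρ → search-bound 10 (A↭ ρ) facts (c₁ 0 9 R₇ ∷ []) []
                 (c₁ 1 9 (2 ∷ 3 ∷ 4 ∷ 0 ∷ 5 ∷ 6 ∷ 7 ∷ 8 ∷ []) ⊕ c₁ 2 9 (3 ∷ 4 ∷ 0 ∷ 5 ∷ 6 ∷ 7 ∷ 8 ∷ [])
                   ⊕ c₁ 3 9 (4 ∷ 0 ∷ 5 ∷ 6 ∷ 7 ∷ 8 ∷ []) ⊕ c₁ 4 9 (0 ∷ 5 ∷ 6 ∷ 7 ∷ 8 ∷ []) ⊕ c∅) 2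
                 (vab ∷ vcd ∷ xyz ∷ []) (base t (u₀ ∷ s) (pick-tail ρ) ∷ []) [])
               (λ t t′ s ρ → search-bound 11 (A↭ ρ) facts
                 (c₁ 0 9 R₇ ∷ c₁ 0 10 R₇ ∷ []) []
                 (c₀ 1 9 10 ⊕ c₀ 2 9 10 ⊕ c₀ 3 9 10 ⊕ c₀ 4 9 10 ⊕ c∅) 0
                 (vab ∷ vcd ∷ xyz ∷ [])
                 (base t _ (pick-tail ρ) ∷ base t′ _
                   (pick-tail (↭-trans ρ (swap t t′ reflₚ))) ∷ []) []) ⟩
        6 + length r * 2 + Σ₃ w (v ∷ x ∷ y ∷ z ∷ u₀ ∷ r)
          ≤⟨ +-monoʳ-≤ (6 + length r * 2) rest ⟩
        6 + length r * 2 + (4 + tri (3 + length r))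
          ≡⟨ ring (length r) _ ⟩
        3 + tri (5 + length r) ∎)
        where
        open ≤-Reasoning
        ring : ∀ r t → 6 + r * 2 + (4 + t) ≡ 3 + (4 + r + (3 + r + t))
        ring = solve-∀

    hinge-bound : ∀ n us → length us < n → Avoids nodouble (Q₈ ++ us) →
      (∀ ys → length ys < 8 + length us → Avoids plain ys → Σ₃ w ys ≤ F (length ys)) →
      CometBound us
    hinge-bound (suc n) us (s≤s us≤n) A ih = go (find (λ t → Σ₁ (w v t) Q₇) us) (pick? 2 (h v) us)
      where
      shorter : ∀ {u r} → us ↭ u ∷ r → CometBound r
      shorter {u} {r} π = hinge-bound n r (subst (_≤ n) (↭-length π) us≤n)
        (Avoids-tail (Avoids-↭ (↭-trans (++⁺ˡ Q₈ π) (shift u Q₈ r)) A))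
        (λ ys le → ih ys (≤-trans le (+-monoʳ-≤ 8 (subst (length r ≤_) (sym (↭-length π)) (n≤1+n _)))))

      go : (Σ[ t ∈ V ] Σ[ s ∈ List V ] (us ↭ t ∷ s × 1 ≤ Σ₁ (w v t) Q₇))
           ⊎ (∀ t s → us ↭ t ∷ s → Σ₁ (w v t) Q₇ ≤ 0) →
        Dec (Pick 2 (h v) us) → CometBound us
      go (inj₁ (u , r , π , link)) _ = Delete.linked-to-base π A (shorter π) link
      go (inj₂ base) (yes p) with (u ∷ u′ ∷ []) , r , π , link ← unpick 2 p =
        DeleteLinked.linked π A (shorter π) link
      go (inj₂ base) (no none) = none-linked us refl
        where
        none-linked : ∀ vs → vs ≡ us → CometBound us
        none-linked [] refl = eight A
        none-linked (u₀ ∷ r) refl = Unlinked.unlinked A base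
          (λ t t′ s π → bit⁻ λ e → none (t , _ , π , t′ , s , reflₚ , e))
          (λ ys le → ih ys (≤-trans (s≤s le) (m≤n+m (6 + length r) 3)))

  -- Classification, and the bound `F` by induction.

  record Hinge (M : List V) : Set where
    field
      {v a b c d x y z} : V
      {us}  : List V
      π     : M ↭ v ∷ a ∷ b ∷ c ∷ d ∷ x ∷ y ∷ z ∷ us
      vab   : T (h v a b)
      vcd   : T (h v c d)
      xyz   : T (h x y z)
      avoid : Avoids nodouble (v ∷ a ∷ b ∷ c ∷ d ∷ x ∷ y ∷ z ∷ us)
      bound : CometBound vab vcd xyz us

  data Kind (M : List V) : Set where
    sparse : Σ₃ w M ≤ G (length M) → Kind M
    hinged : Hinge M → Kind M
    stellar : ¬ Pick 6 matchingᵖ M → Σ₃ w M ≤ tri (length M ∸ 1) → Kind M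

  classify : ∀ M → 6 ≤ length M → Avoids plain M →
    (∀ ys → length ys < length M → Avoids plain ys → Σ₃ w ys ≤ F (length ys)) → Kind M
  classify M 6≤M A ih with pick? 5 doubleᵖ M
  ... | yes found
    with (a ∷ b ∷ c ∷ p ∷ q ∷ []) , us , π , e ← unpick 5 found
    with abc , e′ ← to (T-∧ {h a b c}) e
    with apq , bpq ← to (T-∧ {h a p q}) e′ =
    sparse (subst₂ _≤_ (sym (Σ₃-↭ w-sym π)) (cong G (sym (↭-length π)))
      (double-bound (Avoids-↭ π A) abc apq bpq
        (+-cancelˡ-≤ 5 _ _ (subst (6 ≤_) (↭-length π) 6≤M))
        (λ ys le → ih ys (subst (length ys <_) (sym (↭-length π))
          (s≤s (≤-trans le (m≤n+m _ 4)))))))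
  ... | no ¬double with pick? 6 matchingᵖ M
  ...   | no ¬matching = stellar ¬matching (star-bound (record
      { unique = unique ; ¬path = ¬path ; ¬triangle = ¬triangle
      ; ¬double = λ _ → ¬double ; ¬matching = λ _ → ¬matching ; ¬hinge = λ () }) 6≤M)
    where open Avoids A hiding (¬double; ¬matching)
  ...   | yes found-matching with pick? 8 hingeᵖ M
  ...     | yes found
    with (v ∷ a ∷ b ∷ c ∷ d ∷ x ∷ y ∷ z ∷ []) , us , π , e ← unpick 8 found
    with vab , e′ ← to (T-∧ {h v a b}) e
    with vcd , xyz ← to (T-∧ {h v c d}) e′ =
    hinged record
      { π = π ; vab = vab ; vcd = vcd ; xyz = xyz ; avoid = A′
      ; bound = hinge-bound vab vcd xyz (suc (length us)) us ≤-refl A′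
          (λ ys le → ih ys (subst (length ys <_) (sym (↭-length π)) le))
      }
    where
    open Avoids A hiding (¬double)
    A′ : Avoids nodouble _
    A′ = Avoids-↭ π (record
      { unique = unique ; ¬path = ¬path ; ¬triangle = ¬triangle
      ; ¬double = λ _ → ¬double ; ¬matching = λ () ; ¬hinge = λ () })
  ...     | no ¬hinge
    with (a ∷ b ∷ c ∷ d ∷ e ∷ f ∷ []) , us , π , e′ ← unpick 6 found-matching
    with abc , def ← to (T-∧ {h a b c}) e′ =
    sparse (subst₂ _≤_ (sym (Σ₃-↭ w-sym π)) (cong G (sym (↭-length π)))
      (≤-trans (spread-bound abc def (suc (length us)) us ≤-refl (Avoids-↭ π (record
        { unique = unique ; ¬path = ¬path ; ¬triangle = ¬triangle
        ; ¬double = λ _ → ¬double ; ¬matching = λ () ; ¬hinge = λ _ → ¬hinge })))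
        (8+2r≤G (length us))))
    where open Avoids A hiding (¬double; ¬hinge)

  Kind⇒F : ∀ {M} k → length M ≡ 6 + k → Kind M → Σ₃ w M ≤ F (length M)
  Kind⇒F k eq (sparse le) = ≤-trans le (subst (λ n → G n ≤ F n) (sym eq) (G≤F k))
  Kind⇒F k eq (stellar _ le) = ≤-trans le (subst (λ n → tri (n ∸ 1) ≤ F n) (sym eq) ≤-refl)
  Kind⇒F k eq (hinged H)  = subst₂ _≤_ (sym (Σ₃-↭ w-sym π)) (cong F (sym (↭-length π)))
    (≤-trans (proj₁ bound) (comet≤F (length us)))
    where open Hinge H

  F-bound : ∀ n M → length M < n → Avoids plain M → Σ₃ w M ≤ F (length M)
  F-bound (suc n) M (s≤s M≤n) A with length M ≤? 5
  ... | yes M≤5 = ≤-trans (Σ₃-mono M λ t u s _ _ → w≤1 t u s) (small M M≤5)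
    where
    small : ∀ (xs : List V) → length xs ≤ 5 → Σ₃ (λ _ _ _ → 1) xs ≤ F (length xs)
    small []                      _ = ≤-refl
    small (_ ∷ [])                _ = ≤-refl
    small (_ ∷ _ ∷ [])            _ = ≤-refl
    small (_ ∷ _ ∷ _ ∷ [])        _ = ≤-refl
    small (_ ∷ _ ∷ _ ∷ _ ∷ [])    _ = ≤-refl
    small (_ ∷ _ ∷ _ ∷ _ ∷ _ ∷ []) _ = ≤-refl
    small (_ ∷ _ ∷ _ ∷ _ ∷ _ ∷ _ ∷ _) (s≤s (s≤s (s≤s (s≤s (s≤s ())))))
  ... | no M≰5 = Kind⇒F (length M ∸ 6) (sym (m+[n∸m]≡n (≰⇒> M≰5)))
    (classify M (≰⇒> M≰5) A λ ys le → F-bound n ys (≤-trans le M≤n))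

  kind : ∀ M → 6 ≤ length M → Avoids plain M → Kind M
  kind M 6≤M A = classify M 6≤M A λ ys le → F-bound (suc (length ys)) ys ≤-refl

  -- Equality in the hinge bound.

  -- `head` is a count, from which `Σ₃-squeeze` recovers the four edges.
  record Comet (M : List V) : Set where
    field
      {v x y z} : V
      {R}  : List V
      π    : M ↭ v ∷ x ∷ y ∷ z ∷ R
      head : 4 ≤ Σ₃ w (v ∷ x ∷ y ∷ z ∷ [])
      tail : ∀ s t r → R ↭ s ∷ t ∷ r → T (h v s t)

  -- By the equality clause all edges but xyz contain `v`, and no edge at `v` joins x, y, z to the
  -- other vertices. This leaves at most 3 edges at `v` with a pair from x, y, z and
  -- `tri (length R)` with a pair from `R`; the total demands that both values be attained.
  extremal : ∀ {M} (H : Hinge M) → 4 + tri (length M ∸ 4) ≤ Σ₃ w M → Comet M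
  extremal {M} H ge = record
    { π    = ↭-trans π (prep v σ)
    ; head = +-mono-≤ {3} {Σ₂ (w v) (x ∷ y ∷ z ∷ [])} {1}
        (+-cancelʳ-≤ _ 3 _ (≤-trans links
          (+-monoʳ-≤ (Σ₂ (w v) (x ∷ y ∷ z ∷ [])) (Σ₂-≤tri R (w≤1 v)))))
        (subst (1 ≤_) (sym (trans (+-identityʳ _) (trans (+-identityʳ _) (+-identityʳ _))))
          (bit⁺ xyz))
    ; tail = λ s t r ρ → bit-T (Σ₂-squeeze (swapʳ w-sym v) (λ _ _ → refl) R
        (λ t u _ _ → w≤1 v t u)
        (subst (_≤ Σ₂ (w v) R) (sym (Σ₂-1 R))
          (+-cancelˡ-≤ 3 _ _ (≤-trans links
            (+-monoˡ-≤ (Σ₂ (w v) R) (Σ₂-≤tri (x ∷ y ∷ z ∷ []) (w≤1 v))))))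
        s t r ρ)
    }
    where
    open Hinge H
    open ≤-Reasoning

    R : List V
    R = a ∷ b ∷ c ∷ d ∷ us

    σ : a ∷ b ∷ c ∷ d ∷ x ∷ y ∷ z ∷ us ↭ x ∷ y ∷ z ∷ R
    σ = shifts (a ∷ b ∷ c ∷ d ∷ []) (x ∷ y ∷ z ∷ []) {us}

    facts : List Tri
    facts = (0 , 1 , 2) ∷ (0 , 3 , 4) ∷ (5 , 6 , 7) ∷ []

    edges : ℕ
    edges = Σ₃ w (v ∷ a ∷ b ∷ c ∷ d ∷ x ∷ y ∷ z ∷ us)

    edges≥ : 4 + tri (4 + length us) ≤ edges
    edges≥ = subst₂ (λ k e → 4 + tri (k ∸ 4) ≤ e) (↭-length π) (Σ₃-↭ w-sym π) ge

    -- An edge through v, a vertex t of `R` and x would be the middle of a path whose ends are xyz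
    -- and whichever of vab, vcd omits t; likewise with y or z in place of x.
    crossing : Σ₁ (λ t → Σ₁ (w v t) (x ∷ y ∷ z ∷ [])) R ≤ 0
    crossing = ≤-trans (≤-reflexive (Σ₁-++ _ (a ∷ b ∷ c ∷ d ∷ []) us)) (+-mono-≤
      (search-bound 8 avoid facts [] []
        (c₁ 0 1 (5 ∷ 6 ∷ 7 ∷ []) ⊕ c₁ 0 2 (5 ∷ 6 ∷ 7 ∷ []) ⊕ c₁ 0 3 (5 ∷ 6 ∷ 7 ∷ [])
          ⊕ c₁ 0 4 (5 ∷ 6 ∷ 7 ∷ []) ⊕ c∅) 0 (vab ∷ vcd ∷ xyz ∷ []) [] [])
      (Σ₁-0 us λ t r ρ → search-bound 9
        (Avoids-↭ (++⁺ˡ (v ∷ a ∷ b ∷ c ∷ d ∷ x ∷ y ∷ z ∷ []) ρ) avoid) facts [] []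
        (c₁ 0 8 (5 ∷ 6 ∷ 7 ∷ [])) 0 (vab ∷ vcd ∷ xyz ∷ []) [] []))

    links : 3 + tri (length R) ≤ Σ₂ (w v) (x ∷ y ∷ z ∷ []) + Σ₂ (w v) R
    links = +-cancelʳ-≤ 1 _ _ (begin
      3 + tri (length R) + 1
        ≡⟨ +-comm (3 + tri (length R)) 1 ⟩
      4 + tri (length R)
        ≤⟨ edges≥ ⟩
      edges
        ≤⟨ +-monoʳ-≤ _ (proj₂ bound edges≥) ⟩
      Σ₂ (w v) (a ∷ b ∷ c ∷ d ∷ x ∷ y ∷ z ∷ us) + 1
        ≡⟨ cong (_+ 1) (Σ₂-↭ (swapʳ w-sym v) σ) ⟩
      Σ₂ (w v) (x ∷ y ∷ z ∷ R) + 1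
        ≡⟨ cong (_+ 1) (Σ₂-++ (swapʳ w-sym v) (x ∷ y ∷ z ∷ []) R) ⟩
      Σ₂ (w v) (x ∷ y ∷ z ∷ []) + Σ₁ (λ t → Σ₁ (w v t) (x ∷ y ∷ z ∷ [])) R + Σ₂ (w v) R + 1
        ≤⟨ +-monoˡ-≤ 1 (+-monoˡ-≤ (Σ₂ (w v) R)
             (+-monoʳ-≤ (Σ₂ (w v) (x ∷ y ∷ z ∷ [])) crossing)) ⟩
      Σ₂ (w v) (x ∷ y ∷ z ∷ []) + 0 + Σ₂ (w v) R + 1
        ≡⟨ cong (λ k → k + Σ₂ (w v) R + 1) (+-identityʳ (Σ₂ (w v) (x ∷ y ∷ z ∷ []))) ⟩
      Σ₂ (w v) (x ∷ y ∷ z ∷ []) + Σ₂ (w v) R + 1 ∎)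

-- Subsets

triple-swapˡ : ∀ {n} (x y z : Fin n) → triple x y z ≡ triple y x z
triple-swapˡ x y z = begin
  ⁅ x ⁆ ∪ ⁅ y ⁆ ∪ ⁅ z ⁆    ≡⟨ ∪-assoc ⁅ x ⁆ ⁅ y ⁆ ⁅ z ⁆ ⟨
  (⁅ x ⁆ ∪ ⁅ y ⁆) ∪ ⁅ z ⁆  ≡⟨ cong (_∪ ⁅ z ⁆) (∪-comm ⁅ x ⁆ ⁅ y ⁆) ⟩
  (⁅ y ⁆ ∪ ⁅ x ⁆) ∪ ⁅ z ⁆  ≡⟨ ∪-assoc ⁅ y ⁆ ⁅ x ⁆ ⁅ z ⁆ ⟩
  ⁅ y ⁆ ∪ ⁅ x ⁆ ∪ ⁅ z ⁆    ∎
  where open ≡-Reasoning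

triple-swapʳ : ∀ {n} (x y z : Fin n) → triple x y z ≡ triple x z y
triple-swapʳ x y z = cong (⁅ x ⁆ ∪_) (∪-comm ⁅ y ⁆ ⁅ z ⁆)

∈-triple⁻ : ∀ {n} {t x y z : Fin n} → t ∈ˢ triple x y z → t ≡ x ⊎ t ≡ y ⊎ t ≡ z
∈-triple⁻ {x = x} {y} {z} t∈ with x∈p∪q⁻ ⁅ x ⁆ _ t∈
... | inj₁ t∈x = inj₁ (x∈⁅y⁆⇒x≡y x t∈x)
... | inj₂ t∈yz with x∈p∪q⁻ ⁅ y ⁆ _ t∈yz
...   | inj₁ t∈y = inj₂ (inj₁ (x∈⁅y⁆⇒x≡y y t∈y))
...   | inj₂ t∈z = inj₂ (inj₂ (x∈⁅y⁆⇒x≡y z t∈z))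

∈-triple₁ : ∀ {n} (x y z : Fin n) → x ∈ˢ triple x y z
∈-triple₁ x y z = x∈p∪q⁺ (inj₁ (x∈⁅x⁆ x))

∈-triple₂ : ∀ {n} (x y z : Fin n) → y ∈ˢ triple x y z
∈-triple₂ x y z = x∈p∪q⁺ (inj₂ (x∈p∪q⁺ (inj₁ (x∈⁅x⁆ y))))

∈-triple₃ : ∀ {n} (x y z : Fin n) → z ∈ˢ triple x y z
∈-triple₃ x y z = x∈p∪q⁺ {p = ⁅ x ⁆} (inj₂ (x∈p∪q⁺ {p = ⁅ y ⁆} (inj₂ (x∈⁅x⁆ z))))

card-pair : ∀ {n} {x y : Fin n} → x ≢ y → ∣ ⁅ x ⁆ ∪ ⁅ y ⁆ ∣ ≡ 2
card-pair {x = zero}  {zero}  x≢y = contradiction refl x≢y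
card-pair {x = zero}  {suc y} x≢y =
  cong suc (trans (cong ∣_∣ (∪-identityˡ ⁅ y ⁆)) (∣⁅x⁆∣≡1 y))
card-pair {x = suc x} {zero}  x≢y =
  cong suc (trans (cong ∣_∣ (∪-identityʳ ⁅ x ⁆)) (∣⁅x⁆∣≡1 x))
card-pair {x = suc x} {suc y} x≢y = card-pair (x≢y ∘ cong suc)

card-triple : ∀ {n} {x y z : Fin n} → x ≢ y → x ≢ z → y ≢ z → ∣ triple x y z ∣ ≡ 3
card-triple {x = zero} {zero} x≢y _ _ = contradiction refl x≢y
card-triple {x = zero} {suc y} {zero} _ x≢z _ = contradiction refl x≢z
card-triple {x = zero} {suc y} {suc z} _ _ y≢z =
  cong suc (trans (cong ∣_∣ (∪-identityˡ (⁅ y ⁆ ∪ ⁅ z ⁆))) (card-pair (y≢z ∘ cong suc)))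
card-triple {x = suc x} {zero} {zero} _ _ y≢z = contradiction refl y≢z
card-triple {x = suc x} {zero} {suc z} _ x≢z _ =
  cong suc (trans (cong (λ p → ∣ ⁅ x ⁆ ∪ p ∣) (∪-identityˡ ⁅ z ⁆)) (card-pair (x≢z ∘ cong suc)))
card-triple {x = suc x} {suc y} {zero} x≢y _ _ =
  cong suc (trans (cong (λ p → ∣ ⁅ x ⁆ ∪ p ∣) (∪-identityʳ ⁅ y ⁆)) (card-pair (x≢y ∘ cong suc)))
card-triple {x = suc x} {suc y} {suc z} x≢y x≢z y≢z =
  card-triple (x≢y ∘ cong suc) (x≢z ∘ cong suc) (y≢z ∘ cong suc)

card-0 : ∀ {n} (e : Subset n) → ∣ e ∣ ≡ 0 → e ≡ ⊥
card-0 []            _  = refl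
card-0 (outside ∷ e) eq = cong (outside ∷_) (card-0 e eq)

card-1 : ∀ {n} (e : Subset n) → ∣ e ∣ ≡ 1 → ∃[ x ] e ≡ ⁅ x ⁆
card-1 (outside ∷ e) eq with x , refl ← card-1 e eq = suc x , refl
card-1 (inside ∷ e)  eq = zero , cong (inside ∷_) (card-0 e (suc-injective eq))

card-2 : ∀ {n} (e : Subset n) → ∣ e ∣ ≡ 2 → ∃[ x ] ∃[ y ] (x ≢ y × e ≡ ⁅ x ⁆ ∪ ⁅ y ⁆)
card-2 (outside ∷ e) eq with x , y , x≢y , refl ← card-2 e eq =
  suc x , suc y , x≢y ∘ Fin.suc-injective , refl
card-2 (inside ∷ e)  eq with x , refl ← card-1 e (suc-injective eq) =
  zero , suc x , (λ ()) , cong (inside ∷_) (sym (∪-identityˡ _))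

card-3 : ∀ {n} (e : Subset n) → ∣ e ∣ ≡ 3 →
  ∃[ x ] ∃[ y ] ∃[ z ] (x ≢ y × x ≢ z × y ≢ z × e ≡ triple x y z)
card-3 (outside ∷ e) eq with x , y , z , x≢y , x≢z , y≢z , refl ← card-3 e eq =
  suc x , suc y , suc z , x≢y ∘ Fin.suc-injective , x≢z ∘ Fin.suc-injective ,
  y≢z ∘ Fin.suc-injective , refl
card-3 (inside ∷ e)  eq with y , z , y≢z , refl ← card-2 e (suc-injective eq) =
  zero , suc y , suc z , (λ ()) , (λ ()) , y≢z ∘ Fin.suc-injective ,
  cong (inside ∷_) (sym (∪-identityˡ _))

image-⊥ : ∀ {m n} (f : Fin m → Fin n) → image f ⊥ ≡ ⊥
image-⊥ {zero}  f = refl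
image-⊥ {suc m} f = image-⊥ (f ∘ suc)

image-⁅⁆ : ∀ {m n} (f : Fin m → Fin n) x → image f ⁅ x ⁆ ≡ ⁅ f x ⁆
image-⁅⁆ f zero    = trans (cong (⁅ f zero ⁆ ∪_) (image-⊥ (f ∘ suc))) (∪-identityʳ _)
image-⁅⁆ f (suc x) = image-⁅⁆ (f ∘ suc) x

image-∪ : ∀ {m n} (f : Fin m → Fin n) p q → image f (p ∪ q) ≡ image f p ∪ image f q
image-∪ f []            []            = sym (∪-idem ⊥)
image-∪ f (outside ∷ p) (outside ∷ q) = image-∪ (f ∘ suc) p q
image-∪ f (inside  ∷ p) (outside ∷ q) =
  trans (cong (⁅ f zero ⁆ ∪_) (image-∪ (f ∘ suc) p q)) (sym (∪-assoc ⁅ f zero ⁆ _ _))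
image-∪ f (outside ∷ p) (inside  ∷ q) = begin
  ⁅ f zero ⁆ ∪ image f′ (p ∪ q)           ≡⟨ cong (⁅ f zero ⁆ ∪_) (image-∪ f′ p q) ⟩
  ⁅ f zero ⁆ ∪ image f′ p ∪ image f′ q    ≡⟨ ∪-assoc ⁅ f zero ⁆ _ _ ⟨
  (⁅ f zero ⁆ ∪ image f′ p) ∪ image f′ q  ≡⟨ cong (_∪ image f′ q) (∪-comm ⁅ f zero ⁆ _) ⟩
  (image f′ p ∪ ⁅ f zero ⁆) ∪ image f′ q  ≡⟨ ∪-assoc (image f′ p) _ _ ⟩
  image f′ p ∪ ⁅ f zero ⁆ ∪ image f′ q    ∎
  where
  open ≡-Reasoning
  f′ = f ∘ suc
image-∪ f (inside  ∷ p) (inside  ∷ q) = begin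
  a ∪ image f′ (p ∪ q)               ≡⟨ cong (a ∪_) (image-∪ f′ p q) ⟩
  a ∪ image f′ p ∪ image f′ q        ≡⟨ cong (_∪ (image f′ p ∪ image f′ q)) (∪-idem a) ⟨
  (a ∪ a) ∪ image f′ p ∪ image f′ q  ≡⟨ ∪-assoc a a _ ⟩
  a ∪ a ∪ image f′ p ∪ image f′ q    ≡⟨ cong (a ∪_) (∪-assoc a _ _) ⟨
  a ∪ (a ∪ image f′ p) ∪ image f′ q  ≡⟨ cong (λ r → a ∪ r ∪ image f′ q) (∪-comm a _) ⟩
  a ∪ (image f′ p ∪ a) ∪ image f′ q  ≡⟨ cong (a ∪_) (∪-assoc (image f′ p) a _) ⟩
  a ∪ image f′ p ∪ a ∪ image f′ q    ≡⟨ ∪-assoc a _ _ ⟨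
  (a ∪ image f′ p) ∪ a ∪ image f′ q  ∎
  where
  open ≡-Reasoning
  f′ = f ∘ suc
  a  = ⁅ f zero ⁆

image-triple : ∀ {m n} (f : Fin m → Fin n) x y z →
  image f (triple x y z) ≡ triple (f x) (f y) (f z)
image-triple f x y z = trans (image-∪ f ⁅ x ⁆ _) (cong₂ _∪_ (image-⁅⁆ f x)
  (trans (image-∪ f ⁅ y ⁆ _) (cong₂ _∪_ (image-⁅⁆ f y) (image-⁅⁆ f z))))

-- Counting edges

Σ₁-map : ∀ {A B : Set} (f : B → ℕ) (g : A → B) xs → Σ₁ f (map g xs) ≡ Σ₁ (f ∘ g) xs
Σ₁-map f g []       = refl
Σ₁-map f g (x ∷ xs) = cong (f (g x) +_) (Σ₁-map f g xs)

Σ₂-map : ∀ {A B : Set} (f : B → B → ℕ) (g : A → B) xs →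
  Σ₂ f (map g xs) ≡ Σ₂ (λ x y → f (g x) (g y)) xs
Σ₂-map f g []       = refl
Σ₂-map f g (x ∷ xs) = cong₂ _+_ (Σ₁-map (f (g x)) g xs) (Σ₂-map f g xs)

Σ₃-map : ∀ {A B : Set} (f : B → B → B → ℕ) (g : A → B) xs →
  Σ₃ f (map g xs) ≡ Σ₃ (λ x y z → f (g x) (g y) (g z)) xs
Σ₃-map f g []       = refl
Σ₃-map f g (x ∷ xs) = cong₂ _+_ (Σ₂-map (f (g x)) g xs) (Σ₃-map f g xs)

-- Restricting to one size permits recursion on the vertices: subsets containing the first vertex
-- give a sum for size k - 1, the others a sum for size k.
Supported : ∀ {n} → ℕ → (Subset n → ℕ) → Set
Supported k g = ∀ e → ∣ e ∣ ≢ k → g e ≡ 0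

module _ {n} (g : Subset (suc n) → ℕ) where

  sum-subsets : Σ₁ g (subsets (suc n)) ≡
    Σ₁ (g ∘ (outside ∷_)) (subsets n) + Σ₁ (g ∘ (inside ∷_)) (subsets n)
  sum-subsets = trans (Σ₁-++ g (map (outside ∷_) (subsets n)) _)
    (cong₂ _+_ (Σ₁-map g (outside ∷_) (subsets n)) (Σ₁-map g (inside ∷_) (subsets n)))

  outside-supported : ∀ {k} → Supported k g → Supported k (g ∘ (outside ∷_))
  outside-supported s e = s (outside ∷ e)

  inside-supported : ∀ {k} → Supported (suc k) g → Supported k (g ∘ (inside ∷_))
  inside-supported s e ≢k = s (inside ∷ e) (≢k ∘ suc-injective)

allFin-suc : ∀ n → allFin (suc n) ≡ zero ∷ map suc (allFin n)
allFin-suc n = cong (zero ∷_) (sym (map-tabulate (λ i → i) suc))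

sum-0 : ∀ n (g : Subset n → ℕ) → Supported 0 g → Σ₁ g (subsets n) ≡ g ⊥
sum-0 zero    g s = +-identityʳ _
sum-0 (suc n) g s = begin
  Σ₁ g (subsets (suc n))      ≡⟨ sum-subsets g ⟩
  _                           ≡⟨ cong₂ _+_ (sum-0 n _ (outside-supported g s))
    (trans (Σ₁-cong (λ e → s (inside ∷ e) λ ()) (subsets n)) (Σ₁-const0 (subsets n))) ⟩
  g ⊥ + 0                     ≡⟨ +-identityʳ _ ⟩
  g ⊥                         ∎
  where open ≡-Reasoning

sum-1 : ∀ n (g : Subset n → ℕ) → Supported 1 g →
  Σ₁ g (subsets n) ≡ Σ₁ (λ x → g ⁅ x ⁆) (allFin n)
sum-1 zero    g s = trans (+-identityʳ _) (s [] λ ())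
sum-1 (suc n) g s = begin
  Σ₁ g (subsets (suc n))
    ≡⟨ sum-subsets g ⟩
  _ ≡⟨ cong₂ _+_ (sum-1 n _ (outside-supported g s)) (sum-0 n _ (inside-supported g s)) ⟩
  Σ₁ (λ x → g ⁅ suc x ⁆) (allFin n) + g ⁅ zero ⁆
    ≡⟨ +-comm _ (g ⁅ zero ⁆) ⟩
  g ⁅ zero ⁆ + Σ₁ (λ x → g ⁅ suc x ⁆) (allFin n)
    ≡⟨ cong (g ⁅ zero ⁆ +_) (Σ₁-map (λ x → g ⁅ x ⁆) suc (allFin n)) ⟨
  Σ₁ (λ x → g ⁅ x ⁆) (zero ∷ map suc (allFin n))
    ≡⟨ cong (Σ₁ (λ x → g ⁅ x ⁆)) (allFin-suc n) ⟨
  Σ₁ (λ x → g ⁅ x ⁆) (allFin (suc n)) ∎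
  where open ≡-Reasoning

sum-2 : ∀ n (g : Subset n → ℕ) → Supported 2 g →
  Σ₁ g (subsets n) ≡ Σ₂ (λ x y → g (⁅ x ⁆ ∪ ⁅ y ⁆)) (allFin n)
sum-2 zero    g s = trans (+-identityʳ _) (s [] λ ())
sum-2 (suc n) g s = begin
  Σ₁ g (subsets (suc n))
    ≡⟨ sum-subsets g ⟩
  _ ≡⟨ cong₂ _+_ (sum-2 n _ (outside-supported g s)) (sum-1 n _ (inside-supported g s)) ⟩
  Σ₂ (λ x y → g₂ (suc x) (suc y)) (allFin n) + Σ₁ (λ y → g (inside ∷ ⁅ y ⁆)) (allFin n)
    ≡⟨ +-comm (Σ₂ (λ x y → g₂ (suc x) (suc y)) (allFin n)) _ ⟩
  Σ₁ (λ y → g (inside ∷ ⁅ y ⁆)) (allFin n) + Σ₂ (λ x y → g₂ (suc x) (suc y)) (allFin n)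
    ≡⟨ cong₂ _+_
         (trans (Σ₁-cong (λ y → cong (g ∘ (inside ∷_)) (sym (∪-identityˡ ⁅ y ⁆))) (allFin n))
           (sym (Σ₁-map (g₂ zero) suc (allFin n))))
         (sym (Σ₂-map g₂ suc (allFin n))) ⟩
  Σ₂ g₂ (zero ∷ map suc (allFin n))
    ≡⟨ cong (Σ₂ g₂) (allFin-suc n) ⟨
  Σ₂ g₂ (allFin (suc n)) ∎
  where
  open ≡-Reasoning
  g₂ : Fin (suc n) → Fin (suc n) → ℕ
  g₂ x y = g (⁅ x ⁆ ∪ ⁅ y ⁆)

sum-3 : ∀ n (g : Subset n → ℕ) → Supported 3 g →
  Σ₁ g (subsets n) ≡ Σ₃ (λ x y z → g (triple x y z)) (allFin n)
sum-3 zero    g s = trans (+-identityʳ _) (s [] λ ())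
sum-3 (suc n) g s = begin
  Σ₁ g (subsets (suc n))
    ≡⟨ sum-subsets g ⟩
  _ ≡⟨ cong₂ _+_ (sum-3 n _ (outside-supported g s)) (sum-2 n _ (inside-supported g s)) ⟩
  Σ₃ (λ x y z → g₃ (suc x) (suc y) (suc z)) (allFin n)
    + Σ₂ (λ y z → g (inside ∷ (⁅ y ⁆ ∪ ⁅ z ⁆))) (allFin n)
    ≡⟨ +-comm (Σ₃ (λ x y z → g₃ (suc x) (suc y) (suc z)) (allFin n)) _ ⟩
  Σ₂ (λ y z → g (inside ∷ (⁅ y ⁆ ∪ ⁅ z ⁆))) (allFin n)
    + Σ₃ (λ x y z → g₃ (suc x) (suc y) (suc z)) (allFin n)
    ≡⟨ cong₂ _+_
         (trans (Σ₂-cong (λ y z → cong (g ∘ (inside ∷_)) (sym (∪-identityˡ (⁅ y ⁆ ∪ ⁅ z ⁆))))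
                  (allFin n))
           (sym (Σ₂-map (g₃ zero) suc (allFin n))))
         (sym (Σ₃-map g₃ suc (allFin n))) ⟩
  Σ₃ g₃ (zero ∷ map suc (allFin n))
    ≡⟨ cong (Σ₃ g₃) (allFin-suc n) ⟨
  Σ₃ g₃ (allFin (suc n)) ∎
  where
  open ≡-Reasoning
  g₃ : Fin (suc n) → Fin (suc n) → Fin (suc n) → ℕ
  g₃ x y z = g (triple x y z)

length-filter : ∀ {A : Set} {P : A → Set} (P? : ∀ x → Dec (P x)) xs →
  length (filter P? xs) ≡ Σ₁ (bit ∘ does ∘ P?) xs
length-filter P? []       = refl
length-filter P? (x ∷ xs) with does (P? x)
... | true  = cong suc (length-filter P? xs)
... | false = length-filter P? xs

-- The graph as a function on vertices

adj : ∀ {n} → 3-Graph n → Fin n → Fin n → Fin n → Bool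
adj H x y z = does (Edge? H (triple x y z))

adj⁺ : ∀ {n} (H : 3-Graph n) {x y z} → Edge H (triple x y z) → T (adj H x y z)
adj⁺ H e = from T-≡ (dec-true (Edge? H _) e)

adj⁻ : ∀ {n} (H : 3-Graph n) {x y z} → T (adj H x y z) → Edge H (triple x y z)
adj⁻ H {x} {y} {z} t with Edge? H (triple x y z)
... | yes e = e

adj-swapˡ : ∀ {n} (H : 3-Graph n) x y z → adj H x y z ≡ adj H y x z
adj-swapˡ H x y z = cong (does ∘ Edge? H) (triple-swapˡ x y z)

adj-swapʳ : ∀ {n} (H : 3-Graph n) x y z → adj H x y z ≡ adj H x z y
adj-swapʳ H x y z = cong (does ∘ Edge? H) (triple-swapʳ x y z)

module GraphBounds {n} (H : 3-Graph n) =
  Hypergraph (adj H) (adj-swapˡ H) (adj-swapʳ H)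

module _ {n} (H : 3-Graph n) where

  open GraphBounds H

  edge-count : ∥ H ∥ ≡ Σ₃ w (allFin n)
  edge-count = trans (length-filter (Edge? H) (subsets n))
    (sum-3 n (bit ∘ does ∘ Edge? H) λ e ≢3 → n≤0⇒n≡0
      (bit⁻ λ t → ≢3 (uniform H (witness e t))))
    where
    witness : ∀ e → T (does (Edge? H e)) → Edge H e
    witness e t with Edge? H e
    ... | yes p = p

  image-edge⁺ : ∀ {m} (f : Fin m → Fin n) x y z →
    T (adj H (f x) (f y) (f z)) → Edge H (image f (triple x y z))
  image-edge⁺ f x y z t = subst (Edge H) (sym (image-triple f x y z)) (adj⁻ H t)

  image-edge⁻ : ∀ {m} (f : Fin m → Fin n) x y z →
    Edge H (image f (triple x y z)) → T (adj H (f x) (f y) (f z))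
  image-edge⁻ f x y z e = adj⁺ H (subst (Edge H) (image-triple f x y z) e)

  Unique-++ˡ : ∀ (xs {ys} : List (Fin n)) → Unique (xs ++ ys) → Unique xs
  Unique-++ˡ xs u = subst Unique (take-++ xs) (Unique.take⁺ (length xs) u)
    where
    take-++ : ∀ (xs {ys} : List (Fin n)) → take (length xs) (xs ++ ys) ≡ xs
    take-++ []       = refl
    take-++ (x ∷ xs) = cong (x ∷_) (take-++ xs)

  lookup-∈ : ∀ {k} (xs : Vec (Fin n) k) i → lookup xs i ∈ toList xs
  lookup-∈ (x ∷ xs) zero    = here refl
  lookup-∈ (x ∷ xs) (suc i) = there (lookup-∈ xs i)

  lookup-injective : ∀ {k} (xs : Vec (Fin n) k) → Unique (toList xs) →
    Injective _≡_ _≡_ (lookup xs)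
  lookup-injective (x ∷ xs) (x∉ ∷ u) {zero}  {zero}  eq = refl
  lookup-injective (x ∷ xs) (x∉ ∷ u) {zero}  {suc j} eq =
    contradiction eq (All.lookup x∉ (lookup-∈ xs j))
  lookup-injective (x ∷ xs) (x∉ ∷ u) {suc i} {zero}  eq =
    contradiction (sym eq) (All.lookup x∉ (lookup-∈ xs i))
  lookup-injective (x ∷ xs) (x∉ ∷ u) {suc i} {suc j} eq =
    cong suc (lookup-injective xs u eq)

  picked-embedding : ∀ k {f : Fun {Fin n} k} → Pick k f (allFin n) →
    Σ[ ys ∈ Vec (Fin n) k ] (Injective _≡_ _≡_ (lookup ys) × T (app f ys))
  picked-embedding k p with ys , r , π , t ← unpick k p =
    ys , lookup-injective ys (Unique-++ˡ (toList ys) (Unique-↭ π (Unique.allFin⁺ n))) , t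

  P-free⇒¬path : ¬ Contains H P → ¬ Pick 7 pathᵖ (allFin n)
  P-free⇒¬path free p
    with ys@(a ∷ b ∷ c ∷ d ∷ e ∷ f ∷ g ∷ []) , inj , t ← picked-embedding 7 p
    with abc , t ← to (T-∧ {adj H a b c}) t
    with cde , efg ← to (T-∧ {adj H c d e}) t =
    free (lookup ys , inj , λ where
      _ (here refl)                 → image-edge⁺ (lookup ys) (# 0) (# 1) (# 2) abc
      _ (there (here refl))         → image-edge⁺ (lookup ys) (# 2) (# 3) (# 4) cde
      _ (there (there (here refl))) → image-edge⁺ (lookup ys) (# 4) (# 5) (# 6) efg)

  C-free⇒¬triangle : ¬ Contains H C → ¬ Pick 6 triangleᵖ (allFin n)
  C-free⇒¬triangle free p
    with ys@(a ∷ b ∷ c ∷ d ∷ e ∷ f ∷ []) , inj , t ← picked-embedding 6 p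
    with afb , t ← to (T-∧ {adj H a f b}) t
    with bdc , cea ← to (T-∧ {adj H b d c}) t =
    free (lookup ys , inj , λ where
      _ (here refl)                 → image-edge⁺ (lookup ys) (# 0) (# 5) (# 1) afb
      _ (there (here refl))         → image-edge⁺ (lookup ys) (# 1) (# 3) (# 2) bdc
      _ (there (there (here refl))) → image-edge⁺ (lookup ys) (# 2) (# 4) (# 0) cea)

  contains-M : Contains H M → Pick 6 matchingᵖ (allFin n)
  contains-M (f , inj , edges) =
    pick (f (# 0) ∷ f (# 1) ∷ f (# 2) ∷ f (# 3) ∷ f (# 4) ∷ f (# 5) ∷ [])
      (Unique.map⁺ inj (Unique.allFin⁺ 6))
      (All.universal ∈-allFin _)
      (from T-∧ (image-edge⁻ f (# 0) (# 1) (# 2) (edges _ (here refl))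
                , image-edge⁻ f (# 3) (# 4) (# 5) (edges _ (there (here refl)))))

-- Upper bounds for admissible graphs.

Forbidden Required : Family
Forbidden = (7 , P) ∷ (6 , C) ∷ []
Required  = (6 , M) ∷ []

admissible⁻ : ∀ {n} (H : 3-Graph n) → Admissible Forbidden Required H →
  ¬ Contains H P × ¬ Contains H C × Contains H M
admissible⁻ H (¬P ∷ ¬C ∷ [] , here m) = ¬P , ¬C , m

module _ {n} (H : 3-Graph n) (adm : Admissible Forbidden Required H) where

  open GraphBounds H

  avoids : Avoids plain (allFin n)
  avoids = record
    { unique    = Unique.allFin⁺ n
    ; ¬path     = P-free⇒¬path H (proj₁ (admissible⁻ H adm))
    ; ¬triangle = C-free⇒¬triangle H (proj₁ (proj₂ (admissible⁻ H adm)))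
    ; ¬double = λ () ; ¬matching = λ () ; ¬hinge = λ () }

  matching-edges : Pick 6 matchingᵖ (allFin n)
  matching-edges = contains-M H (proj₂ (proj₂ (admissible⁻ H adm)))

  length-allFin : length (allFin n) ≡ n
  length-allFin = length-tabulate {n = n} (λ i → i)

  -- The matching covers all six vertices, so the list left over by `unpick` is empty and `six`
  -- applies to the whole graph.
  upper-six : n ≡ 6 → ∥ H ∥ ≤ 8
  upper-six n≡6 = subst (_≤ 8) (sym (edge-count H)) (bound (unpick 6 matching-edges))
    where
    bound : Σ[ ys ∈ Vec (Fin n) 6 ] Σ[ r ∈ List (Fin n) ]
      (allFin n ↭ toList ys ++ r × T (app matchingᵖ ys)) → Σ₃ w (allFin n) ≤ 8
    bound ((a ∷ b ∷ c ∷ d ∷ e ∷ f ∷ []) , r , π , t) = exact r π (to (T-∧ {adj H a b c}) t)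
      where
      exact : ∀ r → allFin n ↭ a ∷ b ∷ c ∷ d ∷ e ∷ f ∷ r →
        T (adj H a b c) × T (adj H d e f) → Σ₃ w (allFin n) ≤ 8
      exact []      π (abc , def) =
        subst (_≤ 8) (sym (Σ₃-↭ w-sym π)) (six (Avoids-↭ π avoids) abc def)
      exact (_ ∷ _) π _ =
        contradiction (trans (sym (↭-length π)) (trans length-allFin n≡6)) λ ()

  upper : 6 ≤ n → ∥ H ∥ ≤ G n ⊎ Hinge (allFin n)
  upper 6≤n with kind (allFin n) (subst (6 ≤_) (sym length-allFin) 6≤n) avoids
  ... | sparse le   = inj₁ (subst₂ _≤_ (sym (edge-count H)) (cong G length-allFin) le)
  ... | hinged h    = inj₂ h
  ... | stellar ¬m _ = contradiction matching-edges ¬m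

  hinge-upper : Hinge (allFin n) → 8 ≤ n × ∥ H ∥ ≤ 4 + tri (n ∸ 4)
  hinge-upper h =
    subst (8 ≤_) size (m≤m+n 8 (length us))
    , subst₂ _≤_ (sym (trans (edge-count H) (Σ₃-↭ w-sym π)))
        (cong (λ k → 4 + tri (k ∸ 4)) size) (proj₁ bound)
    where
    open Hinge h
    size : 8 + length us ≡ n
    size = trans (sym (↭-length π)) length-allFin

-- Constructions on six to ten vertices.

∈-image⁻ : ∀ {m n} (f : Fin m → Fin n) p {x} → x ∈ˢ image f p → ∃[ i ] (i ∈ˢ p × x ≡ f i)
∈-image⁻ f []            x∈ = contradiction x∈ ∉⊥
∈-image⁻ f (outside ∷ p) x∈ with i , i∈p , eq ← ∈-image⁻ (f ∘ suc) p x∈ =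
  suc i , there i∈p , eq
∈-image⁻ f (inside ∷ p)  x∈ with x∈p∪q⁻ ⁅ f zero ⁆ _ x∈
... | inj₁ x∈f0 = zero , here , x∈⁅y⁆⇒x≡y (f zero) x∈f0
... | inj₂ x∈p with i , i∈p , eq ← ∈-image⁻ (f ∘ suc) p x∈p = suc i , there i∈p , eq

contains-M? : ∀ {n} (H : 3-Graph n) (xs : Vec (Fin n) 6) →
  let f = lookup xs in
  {_ : True (Fin.all? λ i → Fin.all? λ j → (f i Fin.≟ f j) →-dec (i Fin.≟ j))}
  {_ : True (Edge? H (image f (triple (# 0) (# 1) (# 2))))}
  {_ : True (Edge? H (image f (triple (# 3) (# 4) (# 5))))} → Contains H M
contains-M? H xs {inj} {e₁} {e₂} = lookup xs , (λ {i} {j} → toWitness inj i j) , λ where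
  _ (here refl)         → toWitness e₁
  _ (there (here refl)) → toWitness e₂

-- Two of any three edges contain the same of the two pairs and so share two vertices,
-- which no two edges of P or C do.
books : ∀ k → 3-Graph (4 + k)
books k = record
  { Edge    = λ e → ∣ e ∣ ≡ 3 × (Fat e (# 0) (# 1) ⊎ Fat e (# 2) (# 3))
  ; Edge?   = λ e → (∣ e ∣ ≟ 3) ×-dec (fat? e (# 0) (# 1) ⊎-dec fat? e (# 2) (# 3))
  ; uniform = proj₁
  }
  where
  Fat : Subset (4 + k) → Fin (4 + k) → Fin (4 + k) → Set
  Fat e p q = p ∈ˢ e × q ∈ˢ e

  fat? : ∀ e p q → Dec (Fat e p q)
  fat? e p q = (p ∈? e) ×-dec (q ∈? e)

Overlap : ∀ {m} → Subset m → Subset m → Fin m → Set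
Overlap e e′ c = ∀ i → i ∈ˢ e → i ∈ˢ e′ → i ≡ c

overlap? : ∀ {m} (e e′ : Subset m) c → Dec (Overlap e e′ c)
overlap? e e′ c = Fin.all? λ i → (i ∈? e) →-dec ((i ∈? e′) →-dec (i Fin.≟ c))

module _ {m n} (f : Fin m → Fin n) (inj : Injective _≡_ _≡_ f) where

  common : ∀ {e e′ c x} → Overlap e e′ c → x ∈ˢ image f e → x ∈ˢ image f e′ → x ≡ f c
  common {e} {e′} o x∈e x∈e′
    with i , i∈e , x≡fi ← ∈-image⁻ f e x∈e | j , j∈e′ , x≡fj ← ∈-image⁻ f e′ x∈e′ =
    trans x≡fi (cong f (o i i∈e
      (subst (_∈ˢ e′) (inj (trans (sym x≡fj) x≡fi)) j∈e′)))

  no-common-pair : ∀ {e e′ c x y} → x ≢ y → Overlap e e′ c →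
    x ∈ˢ image f e × y ∈ˢ image f e → x ∈ˢ image f e′ × y ∈ˢ image f e′ → Absurd
  no-common-pair x≢y o (x∈e , y∈e) (x∈e′ , y∈e′) =
    x≢y (trans (common o x∈e x∈e′) (sym (common o y∈e y∈e′)))

books-free : ∀ {m k} (F : 3-Graph m) (e₁ e₂ e₃ : Subset m) (a b c : Fin m) →
  Edge F e₁ → Edge F e₂ → Edge F e₃ →
  Overlap e₁ e₂ a → Overlap e₁ e₃ b → Overlap e₂ e₃ c → ¬ Contains (books k) F
books-free F e₁ e₂ e₃ a b c E₁ E₂ E₃ o₁₂ o₁₃ o₂₃ (f , inj , edges)
  with proj₂ (edges e₁ E₁) | proj₂ (edges e₂ E₂) | proj₂ (edges e₃ E₃)
... | inj₁ p | inj₁ q | _      = no-common-pair f inj (λ ()) o₁₂ p q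
... | inj₁ p | _      | inj₁ r = no-common-pair f inj (λ ()) o₁₃ p r
... | _      | inj₁ q | inj₁ r = no-common-pair f inj (λ ()) o₂₃ q r
... | inj₂ p | inj₂ q | _      = no-common-pair f inj (λ ()) o₁₂ p q
... | inj₂ p | _      | inj₂ r = no-common-pair f inj (λ ()) o₁₃ p r
... | _      | inj₂ q | inj₂ r = no-common-pair f inj (λ ()) o₂₃ q r

books-admissible : ∀ k → Contains (books k) M → Admissible Forbidden Required (books k)
books-admissible k m =
  (books-free P p₁ p₂ p₃ (# 2) (# 0) (# 4)
     (here refl) (there (here refl)) (there (there (here refl)))
     (toWitness {a? = overlap? p₁ p₂ (# 2)} _)
     (toWitness {a? = overlap? p₁ p₃ (# 0)} _)
     (toWitness {a? = overlap? p₂ p₃ (# 4)} _)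
  ∷ books-free C t₁ t₂ t₃ (# 1) (# 0) (# 2)
     (here refl) (there (here refl)) (there (there (here refl)))
     (toWitness {a? = overlap? t₁ t₂ (# 1)} _)
     (toWitness {a? = overlap? t₁ t₃ (# 0)} _)
     (toWitness {a? = overlap? t₂ t₃ (# 2)} _)
  ∷ []) , here m
  where
  p₁ = triple (# 0) (# 1) (# 2)
  p₂ = triple (# 2) (# 3) (# 4)
  p₃ = triple (# 4) (# 5) (# 6)
  t₁ = triple (# 0) (# 5) (# 1)
  t₂ = triple (# 1) (# 3) (# 2)
  t₃ = triple (# 2) (# 4) (# 0)

books-vertices : ∀ k → Vec (Fin (6 + k)) 6
books-vertices k = # 0 ∷ # 1 ∷ # 4 ∷ # 2 ∷ # 3 ∷ # 5 ∷ []

-- Each of the two disjoint pairs lies in n - 2 triples and no triple contains both, whence 2n - 4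
-- edges; the count itself is by evaluation.
books-6 : Σ[ H ∈ 3-Graph 6 ] (Admissible Forbidden Required H × ∥ H ∥ ≡ 8)
books-6 = books 2 , books-admissible 2 (contains-M? (books 2) (books-vertices 0)) , refl

books-7 : Σ[ H ∈ 3-Graph 7 ] (Admissible Forbidden Required H × ∥ H ∥ ≡ 10)
books-7 = books 3 , books-admissible 3 (contains-M? (books 3) (books-vertices 1)) , refl

books-8 : Σ[ H ∈ 3-Graph 8 ] (Admissible Forbidden Required H × ∥ H ∥ ≡ 12)
books-8 = books 4 , books-admissible 4 (contains-M? (books 4) (books-vertices 2)) , refl

books-9 : Σ[ H ∈ 3-Graph 9 ] (Admissible Forbidden Required H × ∥ H ∥ ≡ 14)
books-9 = books 5 , books-admissible 5 (contains-M? (books 5) (books-vertices 3)) , refl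

half : Fin 10 → Fin 2
half x = proj₁ (remQuot {2} 5 x)

-- The disjoint union of two complete graphs on five vertices. `P` and `C` are connected and have
-- more than five vertices, so neither embeds.
two-cliques : 3-Graph 10
two-cliques = record
  { Edge    = λ e → ∣ e ∣ ≡ 3 × ∃[ s ] (∀ x → x ∈ˢ e → half x ≡ s)
  ; Edge?   = λ e → (∣ e ∣ ≟ 3) ×-dec
                (Fin.any? λ s → Fin.all? λ x → (x ∈? e) →-dec (half x Fin.≟ s))
  ; uniform = proj₁
  }

one-half : ∀ {m} {f : Fin m → Fin 10} x y z → Edge two-cliques (image f (triple x y z)) →
  half (f x) ≡ half (f y) × half (f y) ≡ half (f z)
one-half {f = f} x y z (_ , s , same) rewrite image-triple f x y z =
  trans (same _ (∈-triple₁ (f x) (f y) (f z))) (sym (same _ (∈-triple₂ (f x) (f y) (f z)))) ,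
  trans (same _ (∈-triple₂ (f x) (f y) (f z))) (sym (same _ (∈-triple₃ (f x) (f y) (f z))))

half-small : ∀ {m} (f : Fin m → Fin 10) s → 5 < m → Injective _≡_ _≡_ f →
  ¬ (∀ i → half (f i) ≡ s)
half-small f s 5<m inj same
  with i , j , i<j , eq ← Fin.pigeonhole 5<m (λ i → proj₂ (remQuot {2} 5 (f i))) =
  Fin.<⇒≢ i<j (inj (trans (sym (Fin.combine-remQuot {2} 5 (f i)))
    (trans (cong₂ combine (trans (same i) (sym (same j))) eq)
      (Fin.combine-remQuot {2} 5 (f j)))))

two-cliques-admissible : Admissible Forbidden Required two-cliques
two-cliques-admissible = (no-P ∷ no-C ∷ []) ,
  here (contains-M? two-cliques (# 0 ∷ # 1 ∷ # 2 ∷ # 5 ∷ # 6 ∷ # 7 ∷ []))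
  where
  no-P : ¬ Contains two-cliques P
  no-P (f , inj , edges)
    with e₀₁ , e₁₂ ← one-half {f = f} (# 0) (# 1) (# 2) (edges _ (here refl))
       | e₂₃ , e₃₄ ← one-half {f = f} (# 2) (# 3) (# 4) (edges _ (there (here refl)))
       | e₄₅ , e₅₆ ← one-half {f = f} (# 4) (# 5) (# 6) (edges _ (there (there (here refl)))) =
    half-small f _ (≤ᵇ⇒≤ 6 7 _) inj same
    where
    same : ∀ i → half (f i) ≡ half (f (# 2))
    same zero                                     = trans e₀₁ e₁₂
    same (suc zero)                               = e₁₂
    same (suc (suc zero))                         = refl
    same (suc (suc (suc zero)))                   = sym e₂₃
    same (suc (suc (suc (suc zero))))             = sym (trans e₂₃ e₃₄)
    same (suc (suc (suc (suc (suc zero)))))       = sym (trans e₂₃ (trans e₃₄ e₄₅))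
    same (suc (suc (suc (suc (suc (suc zero)))))) = sym (trans e₂₃ (trans e₃₄ (trans e₄₅ e₅₆)))

  no-C : ¬ Contains two-cliques C
  no-C (f , inj , edges)
    with e₀₅ , e₅₁ ← one-half {f = f} (# 0) (# 5) (# 1) (edges _ (here refl))
       | e₁₃ , e₃₂ ← one-half {f = f} (# 1) (# 3) (# 2) (edges _ (there (here refl)))
       | e₂₄ , e₄₀ ← one-half {f = f} (# 2) (# 4) (# 0) (edges _ (there (there (here refl)))) =
    half-small f _ (≤ᵇ⇒≤ 6 6 _) inj same
    where
    same : ∀ i → half (f i) ≡ half (f (# 0))
    same zero                               = refl
    same (suc zero)                         = sym (trans e₀₅ e₅₁)
    same (suc (suc zero))                   = trans e₂₄ e₄₀
    same (suc (suc (suc zero)))             = trans e₃₂ (trans e₂₄ e₄₀)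
    same (suc (suc (suc (suc zero))))       = e₄₀
    same (suc (suc (suc (suc (suc zero))))) = sym e₀₅

two-cliques-10 : Σ[ H ∈ 3-Graph 10 ] (Admissible Forbidden Required H × ∥ H ∥ ≡ 20)
two-cliques-10 = two-cliques , two-cliques-admissible , refl

choose-2 : ∀ n → n choose 2 ≡ tri n
choose-2 zero    = refl
choose-2 (suc n) = trans (sym (nCk+nC[k+1]≡[n+1]C[k+1] n 1)) (cong₂ _+_ (nC1≡n n) (choose-2 n))

-- Images

image-∘ : ∀ {l m n} (g : Fin m → Fin n) (f : Fin l → Fin m) p →
  image g (image f p) ≡ image (g ∘ f) p
image-∘ g f []            = image-⊥ g
image-∘ g f (outside ∷ p) = image-∘ g (f ∘ suc) p
image-∘ g f (inside ∷ p)  = trans (image-∪ g ⁅ f zero ⁆ _)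
  (cong₂ _∪_ (image-⁅⁆ g (f zero)) (image-∘ g (f ∘ suc) p))

image-cong : ∀ {m n} {f g : Fin m → Fin n} → (∀ i → f i ≡ g i) → ∀ p → image f p ≡ image g p
image-cong f≡g []            = refl
image-cong f≡g (outside ∷ p) = image-cong (f≡g ∘ suc) p
image-cong f≡g (inside ∷ p)  = cong₂ (λ x q → ⁅ x ⁆ ∪ q) (f≡g zero) (image-cong (f≡g ∘ suc) p)

image-suc : ∀ {m n} (f : Fin m → Fin n) p → image (suc ∘ f) p ≡ outside ∷ image f p
image-suc f []            = refl
image-suc f (outside ∷ p) = image-suc (f ∘ suc) p
image-suc f (inside ∷ p)  = cong (⁅ suc (f zero) ⁆ ∪_) (image-suc (f ∘ suc) p)

image-id : ∀ {n} (p : Subset n) → image id p ≡ p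
image-id []            = refl
image-id (outside ∷ p) = trans (image-suc id p) (cong (outside ∷_) (image-id p))
image-id (inside ∷ p)  = trans (cong (⁅ zero ⁆ ∪_) (image-suc id p))
  (cong (inside ∷_) (trans (∪-identityˡ _) (image-id p)))
image-inverse : ∀ {m n} (g : Fin m → Fin n) (f : Fin n → Fin m) → (∀ i → g (f i) ≡ i) →
  ∀ p → image g (image f p) ≡ p
image-inverse g f gf p = trans (image-∘ g f p) (trans (image-cong gf p) (image-id p))

-- The comet

module _ {n : ℕ} where

  low⇒edge : ∀ {i j k : Fin n} → i ≢ j → i ≢ k → j ≢ k →
    toℕ i < 4 → toℕ j < 4 → toℕ k < 4 → Edge (Co n) (triple i j k)
  low⇒edge {i} {j} {k} i≢j i≢k j≢k i< j< k< = card-triple i≢j i≢k j≢k , inj₁ λ x x∈ → case (∈-triple⁻ x∈)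
    where
    case : ∀ {x} → x ≡ i ⊎ x ≡ j ⊎ x ≡ k → toℕ x < 4
    case (inj₁ refl)        = i<
    case (inj₂ (inj₁ refl)) = j<
    case (inj₂ (inj₂ refl)) = k<

  star⇒edge : ∀ {c u v : Fin n} → toℕ c ≡ 0 → 4 ≤ toℕ u → 4 ≤ toℕ v → u ≢ v →
    Edge (Co n) (triple c u v)
  star⇒edge {c} {u} {v} c0 4≤u 4≤v u≢v =
    card-triple (centre≢ 4≤u) (centre≢ 4≤v) u≢v , inj₂ (c , u , v , c0 , 4≤u , 4≤v , refl)
    where
    centre≢ : ∀ {x} → 4 ≤ toℕ x → c ≢ x
    centre≢ 4≤x refl = contradiction (subst (4 ≤_) c0 4≤x) λ ()

  OnRay : Fin n → Set
  OnRay x = toℕ x ≡ 0 ⊎ 4 ≤ toℕ x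

  edge-cases : ∀ {e} → Edge (Co n) e →
    (∀ x → x ∈ˢ e → toℕ x < 4) ⊎
    ((∀ x → x ∈ˢ e → OnRay x) × ∃[ c ] (c ∈ˢ e × toℕ c ≡ 0))
  edge-cases (_ , inj₁ low) = inj₁ low
  edge-cases (_ , inj₂ (c , u , v , c0 , 4≤u , 4≤v , refl)) =
    inj₂ ((λ x x∈ → case (∈-triple⁻ x∈)) , c , ∈-triple₁ c u v , c0)
    where
    case : ∀ {x} → x ≡ c ⊎ x ≡ u ⊎ x ≡ v → OnRay x
    case (inj₁ refl)        = inj₁ c0
    case (inj₂ (inj₁ refl)) = inj₂ 4≤u
    case (inj₂ (inj₂ refl)) = inj₂ 4≤v

  low-ray : ∀ {x : Fin n} → toℕ x < 4 → OnRay x → toℕ x ≡ 0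
  low-ray x< (inj₁ x0)  = x0
  low-ray x< (inj₂ 4≤x) = contradiction 4≤x (<⇒≱ x<)

  five-low : ∀ (xs : Vec (Fin n) 5) → Injective _≡_ _≡_ (lookup xs) →
    ¬ (∀ i → toℕ (lookup xs i) < 4)
  five-low xs inj low
    with i , j , i<j , eq ← Fin.pigeonhole ≤-refl (λ i → fromℕ< (low i)) =
    Fin.<⇒≢ i<j (inj (Fin.toℕ-injective
      (trans (sym (Fin.toℕ-fromℕ< (low i))) (trans (cong toℕ eq) (Fin.toℕ-fromℕ< (low j))))))

  -- Edges of the comet touch only at the centre: two edges inside the head would span five of its
  -- four vertices, a head edge and a star edge have only the centre in common, and two star edges
  -- both contain it.
  touch-centre : ∀ {x y z a b : Fin n} → Injective _≡_ _≡_ (lookup (x ∷ y ∷ z ∷ a ∷ b ∷ [])) →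
    Edge (Co n) (triple x y z) → Edge (Co n) (triple x a b) → toℕ x ≡ 0
  touch-centre {x} {y} {z} {a} {b} inj e f with edge-cases e | edge-cases f
  ... | inj₁ low | inj₂ (ray , _) =
    low-ray (low x (∈-triple₁ x y z)) (ray x (∈-triple₁ x a b))
  ... | inj₂ (ray , _) | inj₁ low =
    low-ray (low x (∈-triple₁ x a b)) (ray x (∈-triple₁ x y z))
  ... | inj₁ low | inj₁ low′ = contradiction
    (λ where
      zero                         → low x (∈-triple₁ x y z)
      (suc zero)                   → low y (∈-triple₂ x y z)
      (suc (suc zero))             → low z (∈-triple₃ x y z)
      (suc (suc (suc zero)))       → low′ a (∈-triple₂ x a b)
      (suc (suc (suc (suc zero)))) → low′ b (∈-triple₃ x a b))
    (five-low (x ∷ y ∷ z ∷ a ∷ b ∷ []) inj)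
  ... | inj₂ (_ , c , c∈ , c0) | inj₂ (_ , d , d∈ , d0) =
    case (∈-triple⁻ c∈) (∈-triple⁻ d∈)
    where
    c≡d : c ≡ d
    c≡d = Fin.toℕ-injective (trans c0 (sym d0))

    apart : ∀ i j → i ≢ j → lookup (x ∷ y ∷ z ∷ a ∷ b ∷ []) i ≡ c →
      lookup (x ∷ y ∷ z ∷ a ∷ b ∷ []) j ≡ d → Absurd
    apart i j i≢j i≡c j≡d = i≢j (inj (trans i≡c (trans c≡d (sym j≡d))))

    case : c ≡ x ⊎ c ≡ y ⊎ c ≡ z → d ≡ x ⊎ d ≡ a ⊎ d ≡ b → toℕ x ≡ 0
    case (inj₁ refl) _ = c0
    case _ (inj₁ refl) = d0
    case (inj₂ (inj₁ p)) (inj₂ (inj₁ q)) = ⊥-elim (apart (# 1) (# 3) (λ ()) (sym p) (sym q))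
    case (inj₂ (inj₁ p)) (inj₂ (inj₂ q)) = ⊥-elim (apart (# 1) (# 4) (λ ()) (sym p) (sym q))
    case (inj₂ (inj₂ p)) (inj₂ (inj₁ q)) = ⊥-elim (apart (# 2) (# 3) (λ ()) (sym p) (sym q))
    case (inj₂ (inj₂ p)) (inj₂ (inj₂ q)) = ⊥-elim (apart (# 2) (# 4) (λ ()) (sym p) (sym q))

  distinct-indices : ∀ {m k} (is : Vec (Fin m) k)
    {_ : True (Fin.all? λ i → Fin.all? λ j → (lookup is i Fin.≟ lookup is j) →-dec (i Fin.≟ j))} →
    Injective _≡_ _≡_ (lookup is)
  distinct-indices is {t} {i} {j} = toWitness t i j

  copy-centre : ∀ {m} (f : Fin m → Fin n) → Injective _≡_ _≡_ f →
    ∀ (is : Vec (Fin m) 5) → Injective _≡_ _≡_ (lookup is) → let g = lookup is in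
    Edge (Co n) (image f (triple (g (# 0)) (g (# 1)) (g (# 2)))) →
    Edge (Co n) (image f (triple (g (# 0)) (g (# 3)) (g (# 4)))) → toℕ (f (g (# 0))) ≡ 0
  copy-centre f inj is@(i ∷ j ∷ k ∷ a ∷ b ∷ []) is-inj e e′ =
    touch-centre {f i} {f j} {f k} {f a} {f b} distinct
      (subst (Edge (Co n)) (image-triple f i j k) e)
      (subst (Edge (Co n)) (image-triple f i a b) e′)
    where
    look : ∀ t → lookup (f i ∷ f j ∷ f k ∷ f a ∷ f b ∷ []) t ≡ f (lookup is t)
    look zero                         = refl
    look (suc zero)                   = refl
    look (suc (suc zero))             = refl
    look (suc (suc (suc zero)))       = refl
    look (suc (suc (suc (suc zero)))) = refl

    distinct : Injective _≡_ _≡_ (lookup (f i ∷ f j ∷ f k ∷ f a ∷ f b ∷ []))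
    distinct {s} {t} eq = is-inj (inj (trans (sym (look s)) (trans eq (look t))))

  -- Both joints of the path, the vertices 2 and 4, would be mapped to the centre. Each index vector
  -- names a joint, followed by the other two vertices of either edge. The same is done for the
  -- corners 1 and 2 of the triangle.
  comet-P-free : ¬ Contains (Co n) P
  comet-P-free (f , inj , edges) = contradiction (inj (Fin.toℕ-injective (trans
      (copy-centre f inj (# 2 ∷ # 0 ∷ # 1 ∷ # 3 ∷ # 4 ∷ []) (distinct-indices (# 2 ∷ # 0 ∷ # 1 ∷ # 3 ∷ # 4 ∷ []))
        (edges _ (here refl)) (edges _ (there (here refl))))
      (sym (copy-centre f inj (# 4 ∷ # 2 ∷ # 3 ∷ # 5 ∷ # 6 ∷ []) (distinct-indices (# 4 ∷ # 2 ∷ # 3 ∷ # 5 ∷ # 6 ∷ []))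
        (edges _ (there (here refl))) (edges _ (there (there (here refl)))))))))
    λ ()

  comet-C-free : ¬ Contains (Co n) C
  comet-C-free (f , inj , edges) = contradiction (inj (Fin.toℕ-injective (trans
      (copy-centre f inj (# 1 ∷ # 0 ∷ # 5 ∷ # 3 ∷ # 2 ∷ []) (distinct-indices (# 1 ∷ # 0 ∷ # 5 ∷ # 3 ∷ # 2 ∷ []))
        (edges _ (here refl)) (edges _ (there (here refl))))
      (sym (copy-centre f inj (# 2 ∷ # 1 ∷ # 3 ∷ # 4 ∷ # 0 ∷ []) (distinct-indices (# 2 ∷ # 1 ∷ # 3 ∷ # 4 ∷ # 0 ∷ []))
        (edges _ (there (here refl))) (edges _ (there (there (here refl)))))))))
    λ ()

comet-contains-M : ∀ k → Contains (Co (6 + k)) M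
comet-contains-M k = f , lookup-injective (Co (6 + k)) vs unique , λ where
    _ (here refl)         → subst (Edge (Co (6 + k))) (sym (image-triple f (# 0) (# 1) (# 2)))
      (low⇒edge (λ ()) (λ ()) (λ ()) (≤ᵇ⇒≤ 2 4 _) (≤ᵇ⇒≤ 3 4 _) (≤ᵇ⇒≤ 4 4 _))
    _ (there (here refl)) → subst (Edge (Co (6 + k))) (sym (image-triple f (# 3) (# 4) (# 5)))
      (star⇒edge refl (≤ᵇ⇒≤ 4 4 _) (≤ᵇ⇒≤ 4 5 _) (λ ()))
  where
  vs : Vec (Fin (6 + k)) 6
  vs = # 1 ∷ # 2 ∷ # 3 ∷ # 0 ∷ # 4 ∷ # 5 ∷ []

  f : Fin 6 → Fin (6 + k)
  f = lookup vs

  unique : Unique (toList vs)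
  unique = ((λ ()) ∷ (λ ()) ∷ (λ ()) ∷ (λ ()) ∷ (λ ()) ∷ [])
    ∷ ((λ ()) ∷ (λ ()) ∷ (λ ()) ∷ (λ ()) ∷ []) ∷ ((λ ()) ∷ (λ ()) ∷ (λ ()) ∷ [])
    ∷ ((λ ()) ∷ (λ ()) ∷ []) ∷ ((λ ()) ∷ []) ∷ [] ∷ []

comet-admissible : ∀ k → Admissible Forbidden Required (Co (6 + k))
comet-admissible k = (comet-P-free ∷ comet-C-free ∷ []) , here (comet-contains-M k)

rays : ∀ m → List (Fin (4 + m))
rays m = tabulate λ i → suc (suc (suc (suc i)))

rays-far : ∀ {m x} → x ∈ rays m → 4 ≤ toℕ x
rays-far x∈ with i , refl ← ∈-tabulate⁻ x∈ = s≤s (s≤s (s≤s (s≤s z≤n)))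

-- H is abstract because the decision procedure of Co is expensive to unfold.
size-bound : ∀ m (H : 3-Graph (4 + m)) →
  (∀ {i j k} → i ≢ j → i ≢ k → j ≢ k → toℕ i < 4 → toℕ j < 4 → toℕ k < 4 →
    Edge H (triple i j k)) →
  (∀ {u v} → 4 ≤ toℕ u → 4 ≤ toℕ v → u ≢ v → Edge H (triple zero u v)) →
  4 + tri m ≤ ∥ H ∥
size-bound m H low⇒ ray⇒ = begin
  4 + tri m                          ≡⟨ cong (λ k → 4 + tri k) (length-tabulate far) ⟨
  4 + tri (length R)                 ≡⟨ cong (4 +_) (Σ₂-1 R) ⟨
  4 + Σ₂ (λ _ _ → 1) R               ≤⟨ +-mono-≤ head (Σ₂-mono R ray) ⟩
  Σ₃ w Q + Σ₂ (w zero) R             ≤⟨ m≤m+n _ _ ⟩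
  Σ₃ w Q + Σ₂ (w zero) R + (crossing + (others + Σ₃ w R))
    ≡⟨ ring (Σ₃ w Q) (Σ₂ (w zero) R) crossing others (Σ₃ w R) ⟩
  Σ₃ w Q + crossing + (Σ₂ (w zero) R + others) + Σ₃ w R
    ≡⟨ Σ₃-++ w-sym Q R ⟨
  Σ₃ w (allFin (4 + m))              ≡⟨ edge-count H ⟨
  ∥ H ∥                              ∎
  where
  open ≤-Reasoning
  open GraphBounds H

  far : Fin m → Fin (4 + m)
  far i = suc (suc (suc (suc i)))

  Q R : List (Fin (4 + m))
  Q = # 0 ∷ # 1 ∷ # 2 ∷ # 3 ∷ []
  R = rays m

  crossing others : ℕ
  crossing = Σ₁ (λ t → Σ₂ (w t) Q) R
  others   = Σ₁ (λ q → Σ₂ (w q) R) (# 1 ∷ # 2 ∷ # 3 ∷ [])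

  ring : ∀ a b c d e → a + b + (c + (d + e)) ≡ a + c + (b + d) + e
  ring = solve-∀

  low : ∀ {i j k : Fin (4 + m)} → i ≢ j → i ≢ k → j ≢ k →
    toℕ i < 4 → toℕ j < 4 → toℕ k < 4 → w i j k ≡ 1
  low i≢j i≢k j≢k i< j< k< = ≤-antisym (w≤1 _ _ _)
    (bit⁺ (adj⁺ H (low⇒ i≢j i≢k j≢k i< j< k<)))

  head : 4 ≤ Σ₃ w Q
  head
    rewrite low {# 0} {# 1} {# 2} (λ ()) (λ ()) (λ ()) (≤ᵇ⇒≤ 1 4 _) (≤ᵇ⇒≤ 2 4 _) (≤ᵇ⇒≤ 3 4 _)
          | low {# 0} {# 1} {# 3} (λ ()) (λ ()) (λ ()) (≤ᵇ⇒≤ 1 4 _) (≤ᵇ⇒≤ 2 4 _) (≤ᵇ⇒≤ 4 4 _)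
          | low {# 0} {# 2} {# 3} (λ ()) (λ ()) (λ ()) (≤ᵇ⇒≤ 1 4 _) (≤ᵇ⇒≤ 3 4 _) (≤ᵇ⇒≤ 4 4 _)
          | low {# 1} {# 2} {# 3} (λ ()) (λ ()) (λ ()) (≤ᵇ⇒≤ 2 4 _) (≤ᵇ⇒≤ 3 4 _) (≤ᵇ⇒≤ 4 4 _) =
    ≤-refl

  ray : ∀ t u r → R ↭ t ∷ u ∷ r → 1 ≤ w zero t u
  ray t u r π with (t≢u ∷ _) ∷ _ ← Unique-↭ π
    (Unique.tabulate⁺ λ { refl → refl }) =
    bit⁺ (adj⁺ H {zero} {t} {u} (ray⇒
      (rays-far (∈-resp-↭ (↭-sym π) (here refl)))
      (rays-far (∈-resp-↭ (↭-sym π) (there (here refl)))) t≢u))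

-- The opposite inequality, for n ≥ 11, follows from the upper bound for admissible graphs.
comet-size : ∀ m → 4 + tri m ≤ ∥ Co (4 + m) ∥
comet-size m = size-bound m (Co (4 + m)) low⇒edge (star⇒edge refl)

-- Isomorphisms

bit-mono : ∀ {a b} → (T a → T b) → bit a ≤ bit b
bit-mono {false} f = z≤n
bit-mono {true}  f = bit⁺ (f _)

-- The images are distinct, so they can be moved to the front of the list of all vertices, and equal
-- lengths leave no remainder.
injective-↭ : ∀ {n} (f : Fin n → Fin n) → Injective _≡_ _≡_ f → map f (allFin n) ↭ allFin n
injective-↭ {n} f inj with cover (map f (allFin n)) (Unique.map⁺ inj (Unique.allFin⁺ n))
  (All.universal ∈-allFin _)
... | [] , π = ↭-sym (subst (allFin n ↭_) (++-identityʳ _) π)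
... | y ∷ r , π = contradiction sizes (m+1+n≢m (length (map f (allFin n))) ∘ sym)
  where
  sizes : length (map f (allFin n)) ≡ length (map f (allFin n)) + suc (length r)
  sizes = trans (length-map f (allFin n)) (trans (↭-length π) (length-++ (map f (allFin n))))

module _ {n} {H G : 3-Graph n} (H≅G : H ≅ G) where

  private
    π = proj₁ H≅G
    iso = proj₂ H≅G

    π-injective : Injective _≡_ _≡_ (π ⟨$⟩ʳ_)
    π-injective eq = trans (sym (inverseˡ π)) (trans (cong (π ⟨$⟩ˡ_) eq) (inverseˡ π))

    π⁻¹-injective : Injective _≡_ _≡_ (π ⟨$⟩ˡ_)
    π⁻¹-injective eq = trans (sym (inverseʳ π)) (trans (cong (π ⟨$⟩ʳ_) eq) (inverseʳ π))

  ≅-copy⁺ : ∀ {m} {F : 3-Graph m} → Contains H F → Contains G F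
  ≅-copy⁺ (f , inj , edges) = (π ⟨$⟩ʳ_) ∘ f , inj ∘ π-injective , λ e Fe →
    subst (Edge G) (image-∘ (π ⟨$⟩ʳ_) f e) (to (iso _) (edges e Fe))

  ≅-copy⁻ : ∀ {m} {F : 3-Graph m} → Contains G F → Contains H F
  ≅-copy⁻ (f , inj , edges) = (π ⟨$⟩ˡ_) ∘ f , inj ∘ π⁻¹-injective , λ e Fe →
    from (iso _) (subst (Edge G)
      (sym (trans (image-∘ (π ⟨$⟩ʳ_) ((π ⟨$⟩ˡ_) ∘ f) e) (image-cong (λ i → inverseʳ π) e)))
      (edges e Fe))

  ≅-size : ∥ G ∥ ≤ ∥ H ∥
  ≅-size = begin
    ∥ G ∥                            ≡⟨ edge-count G ⟩
    Σ₃ wᴳ (allFin n)                 ≡⟨ Σ₃-↭ (GraphBounds.w-sym G)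
                                          (injective-↭ (π ⟨$⟩ʳ_) π-injective) ⟨
    Σ₃ wᴳ (map (π ⟨$⟩ʳ_) (allFin n)) ≡⟨ Σ₃-map wᴳ (π ⟨$⟩ʳ_) (allFin n) ⟩
    Σ₃ (λ i j k → wᴳ (π ⟨$⟩ʳ i) (π ⟨$⟩ʳ j) (π ⟨$⟩ʳ k)) (allFin n)
      ≤⟨ Σ₃-mono (allFin n) (λ i j k _ _ → bit-mono λ t → adj⁺ H (from (iso _)
           (subst (Edge G) (sym (image-triple (π ⟨$⟩ʳ_) i j k)) (adj⁻ G t)))) ⟩
    Σ₃ (GraphBounds.w H) (allFin n)  ≡⟨ edge-count H ⟨
    ∥ H ∥                            ∎
    where
    open ≤-Reasoning
    wᴳ = GraphBounds.w G

module _ {n} {H G : 3-Graph n} (σ : Fin n → Fin n) (inj : Injective _≡_ _≡_ σ)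
  (hom : ∀ e → Edge G e → Edge H (image σ e)) (H≤G : ∥ H ∥ ≤ ∥ G ∥) where

  private
    preimage : ∀ k → ∃[ i ] k ≡ σ i
    preimage k with i , _ , eq ← ∈-map⁻ σ (∈-resp-↭ (↭-sym (injective-↭ σ inj)) (∈-allFin k)) =
      i , eq

    τ : Fin n → Fin n
    τ k = proj₁ (preimage k)

    στ : ∀ k → σ (τ k) ≡ k
    στ k = sym (proj₂ (preimage k))

    τσ : ∀ i → τ (σ i) ≡ i
    τσ i = inj (στ (σ i))

    τ-≢ : ∀ {a b} → a ≢ b → τ a ≢ τ b
    τ-≢ {a} {b} a≢b eq = a≢b (trans (sym (στ a)) (trans (cong σ eq) (στ b)))

    wᴳ wᴴ : Fin n → Fin n → Fin n → ℕ
    wᴳ = GraphBounds.w G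
    wᴴ i j k = GraphBounds.w H (σ i) (σ j) (σ k)

    wᴴ-sym : Symmetric₃ wᴴ
    wᴴ-sym = record
      { swapˡ = λ i j k → swapˡ (GraphBounds.w-sym H) (σ i) (σ j) (σ k)
      ; swapʳ = λ i j k → swapʳ (GraphBounds.w-sym H) (σ i) (σ j) (σ k) }

    total : Σ₃ wᴴ (allFin n) ≤ Σ₃ wᴳ (allFin n)
    total = begin
      Σ₃ wᴴ (allFin n)                         ≡⟨ Σ₃-map (GraphBounds.w H) σ (allFin n) ⟨
      Σ₃ (GraphBounds.w H) (map σ (allFin n))  ≡⟨ Σ₃-↭ (GraphBounds.w-sym H) (injective-↭ σ inj) ⟩
      Σ₃ (GraphBounds.w H) (allFin n)          ≡⟨ edge-count H ⟨
      ∥ H ∥                                    ≤⟨ H≤G ⟩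
      ∥ G ∥                                    ≡⟨ edge-count G ⟩
      Σ₃ wᴳ (allFin n)                         ∎
      where open ≤-Reasoning

    reflects : ∀ i j k → i ≢ j → i ≢ k → j ≢ k →
      T (adj H (σ i) (σ j) (σ k)) → T (adj G i j k)
    reflects i j k i≢j i≢k j≢k t =
      bit-T (≤-trans (bit⁺ t) (Σ₃-squeeze (GraphBounds.w-sym G) wᴴ-sym (allFin n)
        (λ a b c _ _ → bit-mono λ e → adj⁺ H
          (subst (Edge H) (image-triple σ a b c) (hom _ (adj⁻ G e))))
        total i j k (proj₁ position) (proj₂ position)))
      where
      position : Σ[ r ∈ List (Fin n) ] allFin n ↭ i ∷ j ∷ k ∷ r
      position = cover (i ∷ j ∷ k ∷ [])
        ((i≢j ∷ i≢k ∷ []) ∷ (j≢k ∷ []) ∷ [] ∷ []) (All.universal ∈-allFin _)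

  -- An injection of the vertices is a bijection, and the images of the edges of `G` already number
  -- at least `∥ H ∥`. Hence `Σ₃-squeeze` leaves no further edge in `H`, and `σ` reflects edges as
  -- well.
  embedding⇒≅ : H ≅ G
  embedding⇒≅ = permutation τ σ τσ στ , λ e → mk⇔ (forth e) (back e)
    where
    forth : ∀ e → Edge H e → Edge G (image τ e)
    forth e He with a , b , c , a≢b , a≢c , b≢c , refl ← card-3 e (uniform H He) =
      subst (Edge G) (sym (image-triple τ a b c))
        (adj⁻ G (reflects (τ a) (τ b) (τ c) (τ-≢ a≢b) (τ-≢ a≢c) (τ-≢ b≢c)
          (subst (λ (x , y , z) → T (adj H x y z))
            (sym (cong₂ _,_ (στ a) (cong₂ _,_ (στ b) (στ c)))) (adj⁺ H He))))

    back : ∀ e → Edge G (image τ e) → Edge H e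
    back e Ge = subst (Edge H) (image-inverse σ τ στ e) (hom (image τ e) Ge)

module _ {n} (H : 3-Graph n) (K : GraphBounds.Comet H (allFin n)) where

  open GraphBounds H
  open Comet K

  private
    L : List (Fin n)
    L = v ∷ x ∷ y ∷ z ∷ R

    length-L : length L ≡ n
    length-L = trans (sym (↭-length π)) (length-tabulate {n = n} id)

    L-unique : Unique L
    L-unique = Unique-↭ π (Unique.allFin⁺ n)

    σ : Fin n → Fin n
    σ i = nth v L (toℕ i)

    σ-injective : Injective _≡_ _≡_ σ
    σ-injective {i} {j} eq = Fin.toℕ-injective (nth-injective v L-unique (bound i) (bound j) eq)
      where
      bound : ∀ i → toℕ i < length L
      bound i = subst (toℕ i <_) (sym length-L) (Fin.toℕ<n i)

    σ-low : ∀ i → toℕ i < 4 → σ i ∈ v ∷ x ∷ y ∷ z ∷ []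
    σ-low i = at (toℕ i)
      where
      at : ∀ k → k < 4 → nth v L k ∈ v ∷ x ∷ y ∷ z ∷ []
      at 0 _ = here refl
      at 1 _ = there (here refl)
      at 2 _ = there (there (here refl))
      at 3 _ = there (there (there (here refl)))
      at (suc (suc (suc (suc _)))) (s≤s (s≤s (s≤s (s≤s ()))))

    σ-far : ∀ i → 4 ≤ toℕ i → σ i ∈ R
    σ-far i 4≤i = at (toℕ i) 4≤i (subst (toℕ i <_) (sym length-L) (Fin.toℕ<n i))
      where
      at : ∀ k → 4 ≤ k → k < length L → nth v L k ∈ R
      at _ (s≤s (s≤s (s≤s (s≤s z≤n)))) (s≤s (s≤s (s≤s (s≤s k<)))) = nth-∈ v R k<

    σ-centre : ∀ i → toℕ i ≡ 0 → σ i ≡ v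
    σ-centre i eq = cong (nth v L) eq

    head-edge : ∀ {a b c} → Unique (a ∷ b ∷ c ∷ []) →
      All (_∈ v ∷ x ∷ y ∷ z ∷ []) (a ∷ b ∷ c ∷ []) → Edge H (triple a b c)
    head-edge {a} {b} {c} u m with r , ρ ← cover _ u m =
      adj⁻ H (bit-T (Σ₃-squeeze w-sym (record { swapˡ = λ _ _ _ → refl ; swapʳ = λ _ _ _ → refl })
        (v ∷ x ∷ y ∷ z ∷ []) (λ a b c _ _ → w≤1 a b c) head a b c r ρ))

    tail-edge : ∀ {a b} → a ≢ b → a ∈ R → b ∈ R → Edge H (triple v a b)
    tail-edge a≢b a∈ b∈ with r , ρ ← cover _ ((a≢b ∷ []) ∷ [] ∷ []) (a∈ ∷ b∈ ∷ []) =
      adj⁻ H (tail _ _ r ρ)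

  comet-hom : ∀ e → Edge (Co n) e → Edge H (image σ e)
  comet-hom e (3-set , inj₁ low)
    with a , b , c , a≢b , a≢c , b≢c , refl ← card-3 e 3-set =
    subst (Edge H) (sym (image-triple σ a b c)) (head-edge
      ((a≢b ∘ σ-injective ∷ a≢c ∘ σ-injective ∷ []) ∷ (b≢c ∘ σ-injective ∷ []) ∷ [] ∷ [])
      (σ-low a (low a (∈-triple₁ a b c)) ∷ σ-low b (low b (∈-triple₂ a b c))
        ∷ σ-low c (low c (∈-triple₃ a b c)) ∷ []))
  comet-hom _ (3-set , inj₂ (c , s , t , c0 , 4≤s , 4≤t , refl)) =
    subst (Edge H) (sym (trans (image-triple σ c s t)
        (cong (λ k → triple k (σ s) (σ t)) (σ-centre c c0))))
      (tail-edge (s≢t ∘ σ-injective) (σ-far s 4≤s) (σ-far t 4≤t))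
    where
    s≢t : s ≢ t
    s≢t refl = contradiction
      (trans (sym 3-set) (trans (cong (λ p → ∣ ⁅ c ⁆ ∪ p ∣) (∪-idem ⁅ s ⁆)) (card-pair c≢s))) λ ()
      where
      c≢s : c ≢ s
      c≢s refl = contradiction (subst (4 ≤_) c0 4≤s) λ ()

  comet-≅ : ∥ H ∥ ≤ ∥ Co n ∥ → H ≅ Co n
  comet-≅ = embedding⇒≅ {H = H} {G = Co n} σ σ-injective comet-hom

-- Stated for a variable n: at a numeral, case analysis would unfold ∥ H ∥.
module _ {n} (H : 3-Graph n) (adm : Admissible Forbidden Required H) (6≤n : 6 ≤ n) where

  upper-by : ∀ {B} → G n ≤ B → (8 ≤ n → 4 + tri (n ∸ 4) ≤ B) → ∥ H ∥ ≤ B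
  upper-by G≤B comet≤B with upper H adm 6≤n
  ... | inj₁ le = ≤-trans le G≤B
  ... | inj₂ h  = let 8≤n , le = hinge-upper H adm h in ≤-trans le (comet≤B 8≤n)

  large⇒comet : G n < ∥ H ∥ → 4 + tri (n ∸ 4) ≤ ∥ H ∥ → GraphBounds.Comet H (allFin n)
  large⇒comet G< ge with upper H adm 6≤n
  ... | inj₁ le = contradiction le (<⇒≱ G<)
  ... | inj₂ h  = GraphBounds.extremal H h (subst₂ _≤_
    (cong (λ m → 4 + tri (m ∸ 4)) (sym (length-allFin H adm))) (edge-count H) ge)

-- The ranges of n.

-- Up to ten vertices the comet stays within `G`: a hinge does not fit on seven vertices, and the
-- comet is below `G` at eight, equal to it at nine and one below at ten.
upper-small : ∀ k (H : 3-Graph (7 + k)) → Admissible Forbidden Required H → k ≤ 3 →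
  ∥ H ∥ ≤ G (7 + k)
upper-small k H adm k≤3 =
  upper-by H adm (m≤m+n 6 (suc k)) ≤-refl (λ 8≤n → comet≤G k 8≤n k≤3)
  where
  comet≤G : ∀ k → 8 ≤ 7 + k → k ≤ 3 → 4 + tri (3 + k) ≤ G (7 + k)
  comet≤G 0 8≤7 _ = contradiction 8≤7 1+n≰n
  comet≤G 1 _ _ = ≤ᵇ⇒≤ 10 12 _
  comet≤G 2 _ _ = ≤ᵇ⇒≤ 14 14 _
  comet≤G 3 _ _ = ≤ᵇ⇒≤ 19 20 _
  comet≤G (suc (suc (suc (suc _)))) _ (s≤s (s≤s (s≤s ())))

module _ (k : ℕ) where

  private
    n = 11 + k

  upper-large : (H : 3-Graph n) → Admissible Forbidden Required H → ∥ H ∥ ≤ 4 + tri (7 + k)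
  upper-large H adm = upper-by H adm (m≤m+n 6 (5 + k)) (n≤1+n _) (λ _ → ≤-refl)

  comet-adm : Admissible Forbidden Required (Co n)
  comet-adm = comet-admissible (5 + k)

  comet-edges : ∥ Co n ∥ ≡ 4 + tri (7 + k)
  comet-edges = ≤-antisym (upper-large (Co n) comet-adm) (comet-size (7 + k))

  extremal-number : ex₃ n Forbidden Required (4 + tri (7 + k))
  extremal-number = (Co n , comet-adm , comet-edges) , upper-large

  extremal⇒comet : (H : 3-Graph n) → Ex₃ n Forbidden Required H → H ≅ Co n
  extremal⇒comet H (adm , _ , maximal) = comet-≅ H
    -- Here `G n` is by definition `3 + tri (7 + k)`, so `large` also states that `∥ H ∥` exceeds
    -- it.
    (large⇒comet H adm (m≤m+n 6 (5 + k)) large large)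
    (≤-trans (upper-large H adm) (≤-reflexive (sym comet-edges)))
    where
    large : 4 + tri (7 + k) ≤ ∥ H ∥
    large = ≤-trans (≤-reflexive (sym comet-edges)) (maximal (Co n) comet-adm)

  comet⇒extremal : (H : 3-Graph n) → H ≅ Co n → Ex₃ n Forbidden Required H
  comet⇒extremal H iso = adm , (H , adm , refl) , λ H′ adm′ →
    ≤-trans (upper-large H′ adm′) (≤-trans (≤-reflexive (sym comet-edges))
      (≅-size {H = H} {Co n} iso))
    where
    adm : Admissible Forbidden Required H
    adm = let ¬P , ¬C , m = admissible⁻ (Co n) comet-adm in
      (¬P ∘ ≅-copy⁺ {H = H} {Co n} iso {F = P} ∷ ¬C ∘ ≅-copy⁺ {H = H} {Co n} iso {F = C} ∷ [])
      , here (≅-copy⁻ {H = H} {Co n} iso {F = M} m)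

mainTheorem6 :
      ((n : ℕ) → 6 ≤ n → n ≤ 9 → ex₃ n ((7 , P) ∷ (6 , C) ∷ []) ((6 , M) ∷ []) (2 * n ∸ 4))
    × ex₃ 10 ((7 , P) ∷ (6 , C) ∷ []) ((6 , M) ∷ []) 20
    × ((n : ℕ) → 11 ≤ n →
          ex₃ n ((7 , P) ∷ (6 , C) ∷ []) ((6 , M) ∷ []) (4 + ((n ∸ 4) choose 2))
        × ((H : 3-Graph n) → Ex₃ n ((7 , P) ∷ (6 , C) ∷ []) ((6 , M) ∷ []) H ⇔ H ≅ Co n))
mainTheorem6 = small , (two-cliques-10 , λ H adm → upper-small 3 H adm (≤ᵇ⇒≤ 3 3 _)) , large
  where
  small : (n : ℕ) → 6 ≤ n → n ≤ 9 → ex₃ n Forbidden Required (2 * n ∸ 4)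
  small 6 _ _ = books-6 , λ H adm → upper-six H adm refl
  small 7 _ _ = books-7 , λ H adm → upper-small 0 H adm (≤ᵇ⇒≤ 0 3 _)
  small 8 _ _ = books-8 , λ H adm → upper-small 1 H adm (≤ᵇ⇒≤ 1 3 _)
  small 9 _ _ = books-9 , λ H adm → upper-small 2 H adm (≤ᵇ⇒≤ 2 3 _)
  small (suc (suc (suc (suc (suc (suc (suc (suc (suc (suc n)))))))))) _ n≤9 =
    contradiction n≤9 (<⇒≱ (m≤m+n 10 n))
  small 0 () _
  small 1 (s≤s ()) _
  small 2 (s≤s (s≤s ())) _
  small 3 (s≤s (s≤s (s≤s ()))) _
  small 4 (s≤s (s≤s (s≤s (s≤s ())))) _
  small 5 (s≤s (s≤s (s≤s (s≤s (s≤s ()))))) _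

  Large : ℕ → Set₁
  Large n = ex₃ n Forbidden Required (4 + ((n ∸ 4) choose 2))
    × ((H : 3-Graph n) → Ex₃ n Forbidden Required H ⇔ H ≅ Co n)

  at : ∀ k → Large (11 + k)
  at k = subst (ex₃ (11 + k) Forbidden Required) (cong (4 +_) (sym (choose-2 (7 + k))))
      (extremal-number k)
    , λ H → mk⇔ (extremal⇒comet k H) (comet⇒extremal k H)

  large : (n : ℕ) → 11 ≤ n → Large n
  large n 11≤n = subst Large (m+[n∸m]≡n 11≤n) (at (n ∸ 11))
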